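{- Let $V$ be a finite set and let $f:2^V\to\mathbb{Z}$ be a submodular function. Let $\mathcal{F}\subseteq 2^V$ be an intersecting family or a crossing family. Suppose that we are given a membership oracle for $\mathcal{F}$. Then a minimizer of $f$ over $2^V\setminus\mathcal{F}$ can be obtained in polynomial time.
   Context: A set function $f:2^V\to\mathbb{Z}$ is submodular if $f(X)+f(Y)\ge f(X\cup Y)+f(X\cap Y)$ for all $X,Y\subseteq V$. It is accessed in the evaluation oracle model, i.e. through an oracle returning $f(X)$ for any given $X\subseteq V$. A family $\mathcal{F}\subseteq 2^V$ is an intersecting family if for all $X,Y\in\mathcal{F}$ with $X\cap Y\neq\emptyset$ we have $X\cup Y,X\cap Y\in\mathcal{F}$. It is a crossing family if for all $X,Y\in\mathcal{F}$ with $X\cap Y\neq\emptyset$ and $X\cup Y\neq V$ we have $X\cup Y,X\cap Y\in\mathcal{F}$. A membership oracle for $\mathcal{F}$ decides, for any given $X\subseteq V$, whether $X\in\mathcal{F}$. Polynomial time means polynomial in $n=|V|$, counting oracle queries (for $f$ and for $\mathcal{F}$) and elementary operations. A minimizer of $f$ over a family $\mathcal{G}\subseteq 2^V$ is a set $X\in\mathcal{G}$ with $f(X)\le f(Y)$ for all $Y\in\mathcal{G}$; the algorithm is required to output one whenever $\mathcal{G}$ is nonempty. -}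

module Defs where

open import Data.Bool using (if_then_else_; not; _∧_)
open import Data.Fin using (toℕ)
open import Data.Fin.Subset using (Subset; _∪_; _∩_; ⊤; ⊥)
open import Data.Integer using (ℤ; +_; 0ℤ; 1ℤ; _+_; _-_; _≤_; _≥_)
import Data.Integer.Properties as ℤ
open import Data.List using (List; []; _∷_)
open import Data.Nat as ℕ using (ℕ; suc)
open import Data.Product using (_×_)
open import Data.Vec using (tabulate)
open import Level using (Level; 0ℓ)
open import Relation.Binary.PropositionalEquality using (_≢_)
open import Relation.Nullary using (¬_; does)
open import Relation.Unary using (Pred; Decidable; _∈_)

private
  variable
    n : ℕ
    ℓ : Level

------------------------------------------------------------------------
-- Set functions and set families over the ground set V = Fin n

Submodular : (Subset n → ℤ) → Set
Submodular f = ∀ X Y → f X + f Y ≥ f (X ∪ Y) + f (X ∩ Y)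

Intersecting : Pred (Subset n) ℓ → Set ℓ
Intersecting F = ∀ X Y → X ∈ F → Y ∈ F →
  X ∩ Y ≢ ⊥ → (X ∪ Y) ∈ F × (X ∩ Y) ∈ F

Crossing : Pred (Subset n) ℓ → Set ℓ
Crossing F = ∀ X Y → X ∈ F → Y ∈ F →
  X ∩ Y ≢ ⊥ → X ∪ Y ≢ ⊤ → (X ∪ Y) ∈ F × (X ∩ Y) ∈ F

Minimizer : (Subset n → ℤ) → Pred (Subset n) ℓ → Subset n → Set ℓ
Minimizer f G X = X ∈ G × (∀ Y → Y ∈ G → f X ≤ f Y)

------------------------------------------------------------------------
-- Algorithms: programs for a random-access machine with two oracles
--
-- Memory holds integers in registers (named by ℕ) and in arrays (named
-- by ℕ, with two integer indices).  A program is a fixed finite piece of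
-- syntax, so it is uniform in n, which it receives as input.
--
-- The elementary operations are constants, memory accesses, addition,
-- subtraction and comparison, each of unit cost.  Multiplication and
-- division are not primitive: at unit cost, repeated squaring would
-- produce integers of exponential length in polynomially many steps.
-- With the operations below, t steps lengthen integers by at most t
-- bits, so counting operations is a realistic measure of time.

data Expr : Set where
  lit     : ℤ → Expr
  reg     : ℕ → Expr
  arr     : ℕ → Expr → Expr → Expr
  _⊕_ _⊖_ : Expr → Expr → Expr

infixl 6 _⊕_ _⊖_

data Cmd : Set where
  skip         : Cmd
  _⨾_          : Cmd → Cmd → Cmd
  setReg       : ℕ → Expr → Cmd
  setArr       : ℕ → Expr → Expr → Expr → Cmd
  -- Oracle calls: the answer goes to the register (first argument), and
  -- the queried set is the given row (third) of the given array (second).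
  askValue     : ℕ → ℕ → Expr → Cmd
  askMember    : ℕ → ℕ → Expr → Cmd
  ifLeq        : Expr → Expr → Cmd → Cmd → Cmd
  whileLeq     : Expr → Expr → Cmd → Cmd

infixr 5 _⨾_

record State : Set where
  constructor state
  field
    regs : ℕ → ℤ
    arrs : ℕ → ℤ → ℤ → ℤ

open State public

writeReg : ℕ → ℤ → State → State
writeReg x v σ = record σ
  { regs = λ y → if does (x ℕ.≟ y) then v else regs σ y }

writeArr : ℕ → ℤ → ℤ → ℤ → State → State
writeArr a i j v σ = record σ
  { arrs = λ b k l →
      if does (a ℕ.≟ b) ∧ does (i ℤ.≟ k) ∧ does (j ℤ.≟ l)
      then v else arrs σ b k l }

eval : Expr → State → ℤ
eval (lit v)     σ = v
eval (reg x)     σ = regs σ x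
eval (arr a i j) σ = arrs σ a (eval i σ) (eval j σ)
eval (d ⊕ e)     σ = eval d σ + eval e σ
eval (d ⊖ e)     σ = eval d σ - eval e σ

cost : Expr → ℕ
cost (lit v)     = 1
cost (reg x)     = 1
cost (arr a i j) = suc (cost i ℕ.+ cost j)
cost (d ⊕ e)     = suc (cost d ℕ.+ cost e)
cost (d ⊖ e)     = suc (cost d ℕ.+ cost e)

-- A subset is stored as a row of an array: j belongs to it iff the entry
-- in column j, for 0 ≤ j < n, is nonzero.
rowSet : (n : ℕ) → ℕ → ℤ → State → Subset n
rowSet n a i σ = tabulate λ j → not (does (arrs σ a i (+ toℕ j) ℤ.≟ 0ℤ))

-- Run f F? c σ t σ′: with evaluation oracle f and membership oracle F?,
-- the program c started in σ halts in σ′, with t the total number of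
-- oracle calls and elementary operations.
data Run {n : ℕ} (f : Subset n → ℤ)
         {F : Pred (Subset n) 0ℓ} (F? : Decidable F) :
         Cmd → State → ℕ → State → Set where

  run-skip : ∀ {σ} → Run f F? skip σ 1 σ

  run-seq : ∀ {c d σ σ′ σ″ s t} →
    Run f F? c σ s σ′ → Run f F? d σ′ t σ″ →
    Run f F? (c ⨾ d) σ (s ℕ.+ t) σ″

  run-setReg : ∀ {x e σ} →
    Run f F? (setReg x e) σ (suc (cost e)) (writeReg x (eval e σ) σ)

  run-setArr : ∀ {a i j e σ} →
    Run f F? (setArr a i j e) σ (suc (cost i ℕ.+ cost j ℕ.+ cost e))
      (writeArr a (eval i σ) (eval j σ) (eval e σ) σ)

  run-askValue : ∀ {x a i σ} →
    Run f F? (askValue x a i) σ (suc (cost i))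
      (writeReg x (f (rowSet n a (eval i σ) σ)) σ)

  run-askMember : ∀ {x a i σ} →
    Run f F? (askMember x a i) σ (suc (cost i))
      (writeReg x
        (if does (F? (rowSet n a (eval i σ) σ)) then 1ℤ else 0ℤ) σ)

  run-then : ∀ {d e b c σ σ′ t} → eval d σ ≤ eval e σ →
    Run f F? b σ t σ′ →
    Run f F? (ifLeq d e b c) σ (suc (cost d ℕ.+ cost e ℕ.+ t)) σ′

  run-else : ∀ {d e b c σ σ′ t} → ¬ (eval d σ ≤ eval e σ) →
    Run f F? c σ t σ′ →
    Run f F? (ifLeq d e b c) σ (suc (cost d ℕ.+ cost e ℕ.+ t)) σ′

  run-loop : ∀ {d e c σ σ′ σ″ s t} → eval d σ ≤ eval e σ →
    Run f F? c σ s σ′ → Run f F? (whileLeq d e c) σ′ t σ″ →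
    Run f F? (whileLeq d e c) σ
      (suc (cost d ℕ.+ cost e ℕ.+ (s ℕ.+ t))) σ″

  run-exit : ∀ {d e c σ} → ¬ (eval d σ ≤ eval e σ) →
    Run f F? (whileLeq d e c) σ (suc (cost d ℕ.+ cost e)) σ

-- Input: n in register 0, all other memory zero.
initial : ℕ → State
initial n = writeReg 0 (+ n) (state (λ _ → 0ℤ) (λ _ _ _ → 0ℤ))

-- Output: the set in row 0 of array 0.
output : (n : ℕ) → State → Subset n
output n = rowSet n 0 0ℤ

------------------------------------------------------------------------
-- Polynomials with natural coefficients, constant term first

Polynomial : Set
Polynomial = List ℕ

infix 8 _⟦_⟧

_⟦_⟧ : Polynomial → ℕ → ℕ
[]      ⟦ x ⟧ = 0
(a ∷ p) ⟦ x ⟧ = a ℕ.+ x ℕ.* p ⟦ x ⟧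

-- An intersecting family is crossing, so let F be crossing.  For a, a′ and
-- c, b let X be any minimiser of f over the sets that contain a, a′ and
-- avoid c, b.  If all such X compatible with a set Y ≠ ∅, V belong to F,
-- then intersecting over b and uniting over a′ shows that Y belongs to F.
-- Hence ∅, V and the O(n⁴) sets X contain a minimiser of f outside F.
--
-- Each X is found with additions and comparisons only.  Keep a preorder R
-- such that some minimiser X* is an ideal of R, and let η be the largest
-- marginal f(R v) − f(R v minus the class of v).  If η ≤ 0, the largest
-- ideal is optimal.  Otherwise either a marginal at the top is below −nη,
-- which forces its element into X*, or f plus a multiple of cardinality is
-- monotone on ideals, and closing sets under R turns f into a submodular
-- function on all sets whose greedy bases are bounded by poly(n) η.
-- Repeatedly add to S the greedy base for the increasing order of S: this
-- is lazy gradient descent on the Lovász extension, and after poly(n)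
-- rounds |S w| is large only if S w determines whether w ∈ X*.  Running
-- this above each principal ideal as root yields a new pair for R, since
-- otherwise all the sums are too small to account for the marginal η.

module Submission where

open import Defs
open import Data.Bool using (Bool; true; false; if_then_else_; not; _∧_; _∨_)
import Data.Bool.Properties as Bool
open import Data.Empty using (⊥; ⊥-elim)
open import Data.Fin as Fin using (Fin; zero; suc; toℕ; fromℕ<)
import Data.Fin.Properties as Fin
open import Data.Fin.Subset using (Subset; _∪_; _∩_)
open import Data.Integer using (ℤ; +_; 0ℤ; 1ℤ; _+_; _-_; _*_; -_; _≤_; _<_)
import Data.Integer.Base as ℤ
import Data.Integer.Properties as ℤ
open import Algebra.Properties.CommutativeMonoid.Sum ℤ.+-0-commutativeMonoid using (sum; ∑-distrib-+; sum-cong-≗)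
open import Algebra.Properties.Semiring.Sum ℤ.+-*-semiring using (*-distribˡ-sum)
open import Data.Integer.Tactic.RingSolver using (solve-∀)
open import Data.List using (List; []; _∷_; allFin)
open import Data.List.Membership.Propositional using (_∈_)
open import Data.List.Membership.Propositional.Properties using (∈-allFin)
open import Data.List.Relation.Unary.Any using (here; there)
open import Data.Nat as ℕ using (ℕ; zero; suc)
import Data.Nat.Properties as ℕ
open import Data.Nat.Tactic.RingSolver using () renaming (solve-∀ to solve-∀ℕ)
open import Data.Product using (Σ-syntax; ∃-syntax; _×_; _,_; proj₁; proj₂)
open import Data.Sum using (_⊎_; inj₁; inj₂; [_,_]′)
open import Data.Unit using (⊤; tt)
open import Data.Vec using (Vec; []; _∷_; lookup; tabulate)
open import Data.Vec.Properties using (tabulate-cong; tabulate∘lookup; lookup∘tabulate; lookup-replicate)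
open import Function using (_∘_; case_of_)
open import Level using (0ℓ)
open import Relation.Binary.Definitions using (tri<; tri≈; tri>)
open import Relation.Binary.PropositionalEquality
open import Relation.Nullary using (¬_; does; yes; no; Dec; contradiction)
open import Relation.Nullary.Decidable using (_×-dec_; decidable-stable)
open import Relation.Unary using (Pred; Decidable; Satisfiable; ∁)

_⊞_ : Polynomial → Polynomial → Polynomial
[]      ⊞ q       = q
(a ∷ p) ⊞ []      = a ∷ p
(a ∷ p) ⊞ (b ∷ q) = (a ℕ.+ b) ∷ (p ⊞ q)

scale : ℕ → Polynomial → Polynomial
scale c []      = []
scale c (a ∷ p) = c ℕ.* a ∷ scale c p

infixl 6 _⊞_

⊞-eval : ∀ p q x → (p ⊞ q) ⟦ x ⟧ ≡ p ⟦ x ⟧ ℕ.+ q ⟦ x ⟧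
⊞-eval []      q       x = refl
⊞-eval (a ∷ p) []      x = sym (ℕ.+-identityʳ _)
⊞-eval (a ∷ p) (b ∷ q) x = trans (cong (λ y → a ℕ.+ b ℕ.+ x ℕ.* y) (⊞-eval p q x))
  (rearrange a b x (p ⟦ x ⟧) (q ⟦ x ⟧))
  where
  rearrange : ∀ a b x y z → a ℕ.+ b ℕ.+ x ℕ.* (y ℕ.+ z) ≡ a ℕ.+ x ℕ.* y ℕ.+ (b ℕ.+ x ℕ.* z)
  rearrange = solve-∀ℕ

scale-eval : ∀ c p x → scale c p ⟦ x ⟧ ≡ c ℕ.* p ⟦ x ⟧
scale-eval c []      x = sym (ℕ.*-zeroʳ c)
scale-eval c (a ∷ p) x = trans (cong (λ y → c ℕ.* a ℕ.+ x ℕ.* y) (scale-eval c p x))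
  (rearrange c a x (p ⟦ x ⟧))
  where
  rearrange : ∀ c a x y → c ℕ.* a ℕ.+ x ℕ.* (c ℕ.* y) ≡ c ℕ.* (a ℕ.+ x ℕ.* y)
  rearrange = solve-∀ℕ

-- Programs whose only iteration is a counting loop have a total
-- denotation and a time bound that is read off the syntax.

data Prog : Set where
  nop      : Prog
  _⨟_      : Prog → Prog → Prog
  set      : ℕ → Expr → Prog
  put      : ℕ → Expr → Expr → Expr → Prog
  value    : ℕ → ℕ → Expr → Prog
  member   : ℕ → ℕ → Expr → Prog
  branch   : Expr → Expr → Prog → Prog → Prog
  -- loop i c p runs p with register i equal to 0, 1, …, n + c - 1.
  loop     : ℕ → ℕ → Prog → Prog

infixr 5 _⨟_

compile : Prog → Cmd
compile nop              = skip
compile (p ⨟ q)          = compile p ⨾ compile q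
compile (set x e)        = setReg x e
compile (put a i j e)    = setArr a i j e
compile (value x a i)    = askValue x a i
compile (member x a i)   = askMember x a i
compile (branch d e p q) = ifLeq d e (compile p) (compile q)
compile (loop i c p)     = setReg i (lit 0ℤ) ⨾
  whileLeq (reg i ⊕ lit 1ℤ) (reg 0 ⊕ lit (+ c)) (compile p ⨾ setReg i (reg i ⊕ lit 1ℤ))

timeBound : Prog → Polynomial
timeBound nop              = 1 ∷ []
timeBound (p ⨟ q)          = timeBound p ⊞ timeBound q
timeBound (set x e)        = suc (cost e) ∷ []
timeBound (put a i j e)    = suc (cost i ℕ.+ cost j ℕ.+ cost e) ∷ []
timeBound (value x a i)    = suc (cost i) ∷ []
timeBound (member x a i)   = suc (cost i) ∷ []
timeBound (branch d e p q) =
  (suc (cost d ℕ.+ cost e) ∷ []) ⊞ (timeBound p ⊞ timeBound q)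
timeBound (loop i c p)     =
  let once = (11 ∷ []) ⊞ timeBound p in (9 ∷ once) ⊞ scale c once

writes : ℕ → Prog → Bool
writes x nop              = false
writes x (p ⨟ q)          = writes x p ∨ writes x q
writes x (set y e)        = does (y ℕ.≟ x)
writes x (put a i j e)    = false
writes x (value y a i)    = does (y ℕ.≟ x)
writes x (member y a i)   = does (y ℕ.≟ x)
writes x (branch d e p q) = writes x p ∨ writes x q
writes x (loop i c p)     = does (i ℕ.≟ x) ∨ writes x p

stores : ℕ → Prog → Bool
stores a nop              = false
stores a (p ⨟ q)          = stores a p ∨ stores a q
stores a (set y e)        = false
stores a (put b i j e)    = does (b ℕ.≟ a)
stores a (value y b i)    = false
stores a (member y b i)   = false
stores a (branch d e p q) = stores a p ∨ stores a q
stores a (loop i c p)     = stores a p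

wellFormed : Prog → Bool
wellFormed nop              = true
wellFormed (p ⨟ q)          = wellFormed p ∧ wellFormed q
wellFormed (set x e)        = true
wellFormed (put a i j e)    = true
wellFormed (value x a i)    = true
wellFormed (member x a i)   = true
wellFormed (branch d e p q) = wellFormed p ∧ wellFormed q
wellFormed (loop i c p)     = not (writes i p) ∧ wellFormed p

-- Opaque, because unfolding nested loops is exponential.
opaque
  iterate : ℕ → (State → State) → ℕ → State → State
  iterate i h zero    σ = writeReg i 0ℤ σ
  iterate i h (suc k) σ =
    writeReg i (regs (h (iterate i h k σ)) i + 1ℤ) (h (iterate i h k σ))

∨-falseˡ : ∀ {x y} → x ∨ y ≡ false → x ≡ false
∨-falseˡ {false} _ = refl

∨-falseʳ : ∀ {x y} → x ∨ y ≡ false → y ≡ false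
∨-falseʳ {false} e = e

∧-trueˡ : ∀ {x y} → x ∧ y ≡ true → x ≡ true
∧-trueˡ {true} _ = refl

∧-trueʳ : ∀ {x y} → x ∧ y ≡ true → y ≡ true
∧-trueʳ {true} e = e

not-true : ∀ {x} → not x ≡ true → x ≡ false
not-true {false} _ = refl

+≤+⇒≤ : ∀ {m n} → + m ≤ + n → m ℕ.≤ n
+≤+⇒≤ (ℤ.+≤+ p) = p

≡ᵇ-refl : ∀ i → (i ℕ.≡ᵇ i) ≡ true
≡ᵇ-refl zero    = refl
≡ᵇ-refl (suc i) = ≡ᵇ-refl i

module Semantics {n : ℕ} (f : Subset n → ℤ) {F : Pred (Subset n) 0ℓ} (F? : Decidable F) where

  ⟪_⟫ : Prog → State → State
  ⟪ nop ⟫            σ = σ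
  ⟪ p ⨟ q ⟫          σ = ⟪ q ⟫ (⟪ p ⟫ σ)
  ⟪ set x e ⟫        σ = writeReg x (eval e σ) σ
  ⟪ put a i j e ⟫    σ = writeArr a (eval i σ) (eval j σ) (eval e σ) σ
  ⟪ value x a i ⟫    σ = writeReg x (f (rowSet n a (eval i σ) σ)) σ
  ⟪ member x a i ⟫   σ =
    writeReg x (if does (F? (rowSet n a (eval i σ) σ)) then 1ℤ else 0ℤ) σ
  ⟪ branch d e p q ⟫ σ = if does (eval d σ ℤ.≤? eval e σ) then ⟪ p ⟫ σ else ⟪ q ⟫ σ
  ⟪ loop i c p ⟫     σ = iterate i ⟪ p ⟫ (n ℕ.+ c) σ

  opaque
    unfolding iterate

    regs-frame : ∀ p σ x → writes x p ≡ false → regs (⟪ p ⟫ σ) x ≡ regs σ x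
    regs-frame nop              σ x e = refl
    regs-frame (p ⨟ q)          σ x e =
      trans (regs-frame q (⟪ p ⟫ σ) x (∨-falseʳ {writes x p} e)) (regs-frame p σ x (∨-falseˡ e))
    regs-frame (set y d)        σ x e rewrite e = refl
    regs-frame (put a i j d)    σ x e = refl
    regs-frame (value y a i)    σ x e rewrite e = refl
    regs-frame (member y a i)   σ x e rewrite e = refl
    regs-frame (branch d₁ d₂ p q) σ x e with does (eval d₁ σ ℤ.≤? eval d₂ σ)
    ... | true  = regs-frame p σ x (∨-falseˡ e)
    ... | false = regs-frame q σ x (∨-falseʳ {writes x p} e)
    regs-frame (loop i c p)     σ x e = go (n ℕ.+ c)
      where
      go : ∀ k → regs (iterate i ⟪ p ⟫ k σ) x
           ≡ regs σ x
      go zero    rewrite ∨-falseˡ {does (i ℕ.≟ x)} e = refl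
      go (suc k) rewrite ∨-falseˡ {does (i ℕ.≟ x)} e =
        trans (regs-frame p _ x (∨-falseʳ {does (i ℕ.≟ x)} e)) (go k)

    arrs-frame : ∀ p σ a → stores a p ≡ false → ∀ k l → arrs (⟪ p ⟫ σ) a k l ≡ arrs σ a k l
    arrs-frame nop              σ a e k l = refl
    arrs-frame (p ⨟ q)          σ a e k l =
      trans (arrs-frame q (⟪ p ⟫ σ) a (∨-falseʳ {stores a p} e) k l) (arrs-frame p σ a (∨-falseˡ e) k l)
    arrs-frame (set y d)        σ a e k l = refl
    arrs-frame (put b i j d)    σ a e k l rewrite e = refl
    arrs-frame (value y b i)    σ a e k l = refl
    arrs-frame (member y b i)   σ a e k l = refl
    arrs-frame (branch d₁ d₂ p q) σ a e k l with does (eval d₁ σ ℤ.≤? eval d₂ σ)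
    ... | true  = arrs-frame p σ a (∨-falseˡ e) k l
    ... | false = arrs-frame q σ a (∨-falseʳ {stores a p} e) k l
    arrs-frame (loop i c p)     σ a e k l = go (n ℕ.+ c)
      where
      go : ∀ j → arrs (iterate i ⟪ p ⟫ j σ) a k l
           ≡ arrs σ a k l
      go zero    = refl
      go (suc j) = trans (arrs-frame p _ a e k l) (go j)

  record Frame (p : Prog) (σ τ : State) : Set where
    constructor frame
    field
      onReg : ∀ x → writes x p ≡ false → regs τ x ≡ regs σ x
      onArr : ∀ a → stores a p ≡ false → ∀ k l → arrs τ a k l ≡ arrs σ a k l
  open Frame public

  frame-run : ∀ p σ → Frame p σ (⟪ p ⟫ σ)
  frame-run p σ = frame (regs-frame p σ) (arrs-frame p σ)

  writeReg-same : ∀ i v σ → regs (writeReg i v σ) i ≡ v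
  writeReg-same i v σ = cong (λ b → if b then v else regs σ i) (≡ᵇ-refl i)

  module _ {i c : ℕ} {p : Prog} where

    opaque
      unfolding iterate

      loop-counter : ∀ {σ} → writes i p ≡ false → ∀ k → regs (iterate i ⟪ p ⟫ k σ) i ≡ + k
      loop-counter {σ} safe zero    = writeReg-same i 0ℤ σ
      loop-counter {σ} safe (suc k) = begin
        regs (iterate i ⟪ p ⟫ (suc k) σ) i           ≡⟨ writeReg-same i _ (⟪ p ⟫ τ) ⟩
        regs (⟪ p ⟫ τ) i + 1ℤ     ≡⟨ cong (_+ 1ℤ) (regs-frame p τ i safe) ⟩
        regs τ i + 1ℤ             ≡⟨ cong (_+ 1ℤ) (loop-counter {σ} safe k) ⟩
        + k + 1ℤ                  ≡⟨ cong +_ (ℕ.+-comm k 1) ⟩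
        + suc k                   ∎
        where
        open ≡-Reasoning
        τ : State
        τ = iterate i ⟪ p ⟫ k σ

      loop-frame : ∀ {σ} k → Frame (loop i c p) σ (iterate i ⟪ p ⟫ k σ)
      onReg (loop-frame zero) x e rewrite ∨-falseˡ {does (i ℕ.≟ x)} e = refl
      onReg (loop-frame {σ} (suc k)) x e rewrite ∨-falseˡ {does (i ℕ.≟ x)} e =
        trans (regs-frame p _ x (∨-falseʳ {does (i ℕ.≟ x)} e)) (onReg (loop-frame {σ} k) x e)
      onArr (loop-frame zero) a e k l = refl
      onArr (loop-frame {σ} (suc j)) a e k l =
        trans (arrs-frame p _ a e k l) (onArr (loop-frame {σ} j) a e k l)

    opaque
      unfolding iterate

      loop-rule : ∀ {σ} (Inv : ℕ → State → Set) → writes i p ≡ false →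
        Inv 0 (writeReg i 0ℤ σ) →
        (∀ k τ z → k ℕ.< n ℕ.+ c → Frame (loop i c p) σ τ → regs τ i ≡ + k → Inv k τ →
          Inv (suc k) (writeReg i z (⟪ p ⟫ τ))) →
        Inv (n ℕ.+ c) (⟪ loop i c p ⟫ σ)
      loop-rule {σ} Inv safe start next = go (n ℕ.+ c) ℕ.≤-refl
        where
        go : ∀ k → k ℕ.≤ n ℕ.+ c → Inv k (iterate i ⟪ p ⟫ k σ)
        go zero    _ = start
        go (suc k) k<n = next k _ _ k<n (loop-frame k) (loop-counter {σ} safe k) (go k (ℕ.<⇒≤ k<n))

  loop-rule-Fin : ∀ {i p σ} (Inv : ℕ → State → Set) → writes i p ≡ false →
    Inv 0 (writeReg i 0ℤ σ) →
    (∀ (v : Fin n) τ z → Frame (loop i 0 p) σ τ → regs τ i ≡ + toℕ v → Inv (toℕ v) τ →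
      Inv (suc (toℕ v)) (writeReg i z (⟪ p ⟫ τ))) →
    Inv n (⟪ loop i 0 p ⟫ σ)
  loop-rule-Fin {i} {p} {σ} Inv safe start next =
    subst (λ k → Inv k (⟪ loop i 0 p ⟫ σ)) (ℕ.+-identityʳ n)
      (loop-rule {i} {0} {p} Inv safe start λ k τ z k<n+0 fr ri inv →
        let k<n = subst (k ℕ.<_) (ℕ.+-identityʳ n) k<n+0
            eq = Fin.toℕ-fromℕ< k<n
        in subst (λ j → Inv (suc j) (writeReg i z (⟪ p ⟫ τ))) eq
             (next (fromℕ< k<n) τ z fr (trans ri (cong +_ (sym eq))) (subst (λ j → Inv j τ) (sym eq) inv)))

  opaque
    execute : Prog → State → State
    execute p σ = ⟪ p ⟫ σ

    execute-def : ∀ p σ → execute p σ ≡ ⟪ p ⟫ σ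
    execute-def p σ = refl

    execute-⨟ : ∀ p q σ → execute (p ⨟ q) σ ≡ execute q (execute p σ)
    execute-⨟ p q σ = refl

  Halts : Prog → State → Set
  Halts p σ = ∃[ t ] Run f F? (compile p) σ t (⟪ p ⟫ σ) × t ℕ.≤ timeBound p ⟦ n ⟧

  const-bound : ∀ a → a ℕ.≤ (a ∷ []) ⟦ n ⟧
  const-bound a = ℕ.m≤m+n a _

  ⊞-bound : ∀ p q {s t} → s ℕ.≤ p ⟦ n ⟧ → t ℕ.≤ q ⟦ n ⟧ → s ℕ.+ t ℕ.≤ (p ⊞ q) ⟦ n ⟧
  ⊞-bound p q s≤ t≤ = subst (_ ℕ.≤_) (sym (⊞-eval p q n)) (ℕ.+-mono-≤ s≤ t≤)

  opaque
    unfolding iterate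

    halts : ∀ p σ → wellFormed p ≡ true → writes 0 p ≡ false → regs σ 0 ≡ + n → Halts p σ
    halts nop σ wf keep r0 = 1 , run-skip , const-bound 1
    halts (p ⨟ q) σ wf keep r0
      with s , run-p , s≤ ← halts p σ (∧-trueˡ wf) (∨-falseˡ keep) r0
      with t , run-q , t≤ ← halts q (⟪ p ⟫ σ) (∧-trueʳ {wellFormed p} wf) (∨-falseʳ {writes 0 p} keep)
                             (trans (regs-frame p σ 0 (∨-falseˡ keep)) r0) =
      s ℕ.+ t , run-seq run-p run-q , ⊞-bound (timeBound p) (timeBound q) s≤ t≤
    halts (set x e) σ wf keep r0 = _ , run-setReg , const-bound _
    halts (put a i j e) σ wf keep r0 = _ , run-setArr , const-bound _
    halts (value x a i) σ wf keep r0 = _ , run-askValue , const-bound _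
    halts (member x a i) σ wf keep r0 = _ , run-askMember , const-bound _
    halts (branch d e p q) σ wf keep r0 with eval d σ ℤ.≤? eval e σ
    ... | yes d≤e
      with t , run , t≤ ← halts p σ (∧-trueˡ wf) (∨-falseˡ keep) r0 =
      _ , run-then d≤e run ,
      ⊞-bound (_ ∷ []) (timeBound p ⊞ timeBound q) (const-bound _)
        (subst (t ℕ.≤_) (sym (⊞-eval (timeBound p) (timeBound q) n)) (ℕ.≤-trans t≤ (ℕ.m≤m+n _ _)))
    ... | no d≰e
      with t , run , t≤ ← halts q σ (∧-trueʳ {wellFormed p} wf) (∨-falseʳ {writes 0 p} keep) r0 =
      _ , run-else d≰e run ,
      ⊞-bound (_ ∷ []) (timeBound p ⊞ timeBound q) (const-bound _)
        (subst (t ℕ.≤_) (sym (⊞-eval (timeBound p) (timeBound q) n)) (ℕ.≤-trans t≤ (ℕ.m≤n+m _ _)))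
    halts (loop i c p) σ wf keep r0 =
      let t , run , t≤ = from (n ℕ.+ c) 0 (ℕ.+-identityʳ _) in
      2 ℕ.+ t , run-seq run-setReg run , bound t≤
      where
      safe : writes i p ≡ false
      safe = not-true (∧-trueˡ wf)
      at : ℕ → State
      at k = iterate i ⟪ p ⟫ k σ
      T : ℕ
      T = timeBound p ⟦ n ⟧
      guard-l : ∀ k → eval (reg i ⊕ lit 1ℤ) (at k) ≡ + suc k
      guard-l k = trans (cong (_+ 1ℤ) (loop-counter {i} {c} {p} {σ} safe k)) (cong +_ (ℕ.+-comm k 1))
      reg0 : ∀ k → regs (at k) 0 ≡ + n
      reg0 k = trans (onReg (loop-frame {i} {c} {p} {σ} k) 0 keep) r0
      guard-r : ∀ k → eval (reg 0 ⊕ lit (+ c)) (at k) ≡ + (n ℕ.+ c)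
      guard-r k = cong (_+ + c) (reg0 k)
      body : Cmd
      body = compile p ⨾ setReg i (reg i ⊕ lit 1ℤ)
      loop-cost : ∀ j T → 7 ℕ.+ (T ℕ.+ 4) ℕ.+ (j ℕ.* (11 ℕ.+ T) ℕ.+ 7) ≡ suc j ℕ.* (11 ℕ.+ T) ℕ.+ 7
      loop-cost = solve-∀ℕ
      from : ∀ j k → j ℕ.+ k ≡ n ℕ.+ c →
        ∃[ t ] Run f F? (whileLeq (reg i ⊕ lit 1ℤ) (reg 0 ⊕ lit (+ c)) body) (at k) t (at (n ℕ.+ c))
               × t ℕ.≤ j ℕ.* (11 ℕ.+ T) ℕ.+ 7
      from zero k refl = 7 , run-exit halted , ℕ.≤-refl
        where
        halted : ¬ (eval (reg i ⊕ lit 1ℤ) (at k) ≤ eval (reg 0 ⊕ lit (+ c)) (at k))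
        halted le rewrite guard-l k | guard-r k = ℕ.<-irrefl refl (+≤+⇒≤ le)
      from (suc j) k eq
        with s , run-p , s≤ ← halts p (at k) (∧-trueʳ {not (writes i p)} wf)
                                (∨-falseʳ {does (i ℕ.≟ 0)} keep) (reg0 k)
        with t , run , t≤ ← from j (suc k) (trans (ℕ.+-suc j k) eq) =
        _ , run-loop go (run-seq run-p run-setReg) run ,
        subst (7 ℕ.+ (s ℕ.+ 4 ℕ.+ t) ℕ.≤_) (loop-cost j T)
          (ℕ.+-monoʳ-≤ 7 (ℕ.+-mono-≤ (ℕ.+-monoˡ-≤ 4 s≤) t≤))
        where
        go : eval (reg i ⊕ lit 1ℤ) (at k) ≤ eval (reg 0 ⊕ lit (+ c)) (at k)
        go rewrite guard-l k | guard-r k =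
          ℤ.+≤+ (subst (suc k ℕ.≤_) eq (ℕ.s≤s (ℕ.m≤n+m k j)))
      once : Polynomial
      once = (11 ∷ []) ⊞ timeBound p
      bound : ∀ {t} → t ℕ.≤ (n ℕ.+ c) ℕ.* (11 ℕ.+ T) ℕ.+ 7 → 2 ℕ.+ t ℕ.≤ timeBound (loop i c p) ⟦ n ⟧
      bound {t} t≤ = ℕ.≤-trans (ℕ.+-monoʳ-≤ 2 t≤) (ℕ.≤-reflexive (begin
        2 ℕ.+ ((n ℕ.+ c) ℕ.* (11 ℕ.+ T) ℕ.+ 7)          ≡⟨ rearrange n c T ⟩
        9 ℕ.+ n ℕ.* (11 ℕ.+ n ℕ.* 0 ℕ.+ T) ℕ.+ c ℕ.* (11 ℕ.+ n ℕ.* 0 ℕ.+ T)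
          ≡⟨ cong (λ y → 9 ℕ.+ n ℕ.* y ℕ.+ c ℕ.* y) (sym (⊞-eval (11 ∷ []) (timeBound p) n)) ⟩
        (9 ∷ once) ⟦ n ⟧ ℕ.+ c ℕ.* once ⟦ n ⟧           ≡⟨ cong ((9 ∷ once) ⟦ n ⟧ ℕ.+_) (sym (scale-eval c once n)) ⟩
        (9 ∷ once) ⟦ n ⟧ ℕ.+ scale c once ⟦ n ⟧         ≡⟨ sym (⊞-eval (9 ∷ once) (scale c once) n) ⟩
        timeBound (loop i c p) ⟦ n ⟧ ∎))
        where
        open ≡-Reasoning
        rearrange : ∀ n c T → 2 ℕ.+ ((n ℕ.+ c) ℕ.* (11 ℕ.+ T) ℕ.+ 7) ≡
          9 ℕ.+ n ℕ.* (11 ℕ.+ n ℕ.* 0 ℕ.+ T) ℕ.+ c ℕ.* (11 ℕ.+ n ℕ.* 0 ℕ.+ T)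
        rearrange = solve-∀ℕ

lin₁ : ∀ {a b c d} → d - c ≡ b - a → a ≤ b → c ≤ d
lin₁ eq p = ℤ.0≤i-j⇒j≤i (subst (0ℤ ≤_) (sym eq) (ℤ.i≤j⇒0≤j-i p))

lin₂ : ∀ {a b a′ b′ c d} → d - c ≡ (b - a) + (b′ - a′) → a ≤ b → a′ ≤ b′ → c ≤ d
lin₂ eq p q = ℤ.0≤i-j⇒j≤i (subst (0ℤ ≤_) (sym eq) (ℤ.+-mono-≤ (ℤ.i≤j⇒0≤j-i p) (ℤ.i≤j⇒0≤j-i q)))

lin₃ : ∀ {a b a′ b′ a″ b″ c d} → d - c ≡ (b - a) + (b′ - a′) + (b″ - a″) →
  a ≤ b → a′ ≤ b′ → a″ ≤ b″ → c ≤ d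
lin₃ eq p q r = ℤ.0≤i-j⇒j≤i (subst (0ℤ ≤_) (sym eq)
  (ℤ.+-mono-≤ (ℤ.+-mono-≤ (ℤ.i≤j⇒0≤j-i p) (ℤ.i≤j⇒0≤j-i q)) (ℤ.i≤j⇒0≤j-i r)))

*-nonneg : ∀ {i j} → 0ℤ ≤ i → 0ℤ ≤ j → 0ℤ ≤ i * j
*-nonneg {+ i} {+ j} _ _ = subst (0ℤ ≤_) (ℤ.pos-* i j) (ℤ.+≤+ ℕ.z≤n)

square-nonneg : ∀ i → 0ℤ ≤ i * i
square-nonneg i with ℤ.≤-total 0ℤ i
... | inj₁ 0≤i = *-nonneg 0≤i 0≤i
... | inj₂ i≤0 = subst (0ℤ ≤_) (eq i) (*-nonneg (ℤ.neg-mono-≤ i≤0) (ℤ.neg-mono-≤ i≤0))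
  where
  eq : ∀ i → - i * - i ≡ i * i
  eq = solve-∀

-- Decidable subsets of Fin n as Boolean functions

Sub : ℕ → Set
Sub n = Fin n → Bool

module _ {n : ℕ} where

  infixr 6 _∪ᵇ_
  infixr 7 _∩ᵇ_
  infix  4 _⊆ᵇ_

  _∪ᵇ_ _∩ᵇ_ : Sub n → Sub n → Sub n
  (X ∪ᵇ Y) v = X v ∨ Y v
  (X ∩ᵇ Y) v = X v ∧ Y v

  _⊆ᵇ_ : Sub n → Sub n → Set
  X ⊆ᵇ Y = ∀ v → X v ≡ true → Y v ≡ true

  singleton : Fin n → Sub n
  singleton v w = does (v Fin.≟ w)

  below : ℕ → Sub n
  below k v = does (toℕ v ℕ.<? k)

bool-ext : ∀ {x y} → (x ≡ true → y ≡ true) → (y ≡ true → x ≡ true) → x ≡ y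
bool-ext {false} {false} p q = refl
bool-ext {false} {true}  p q = q refl
bool-ext {true}  {false} p q = sym (p refl)
bool-ext {true}  {true}  p q = refl

∧-intro : ∀ {x y} → x ≡ true → y ≡ true → x ∧ y ≡ true
∧-intro refl refl = refl

∨-introˡ : ∀ {x y} → x ≡ true → x ∨ y ≡ true
∨-introˡ refl = refl

∨-introʳ : ∀ {x y} → y ≡ true → x ∨ y ≡ true
∨-introʳ {x} refl = Bool.∨-zeroʳ x

∨-elim : ∀ {x y} → x ∨ y ≡ true → x ≡ true ⊎ y ≡ true
∨-elim {true}  _ = inj₁ refl
∨-elim {false} e = inj₂ e

not-false : ∀ {x} → x ≡ false → not x ≡ true
not-false refl = refl

true≢false : ∀ {x} {A : Set} → x ≡ true → x ≡ false → A
true≢false refl ()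

≢true : ∀ {x} → ¬ (x ≡ true) → x ≡ false
≢true {false} _ = refl
≢true {true}  p = contradiction refl p

from-does : ∀ {P : Set} (d : Dec P) → does d ≡ true → P
from-does (yes p) _ = p

to-does : ∀ {P : Set} (d : Dec P) → P → does d ≡ true
to-does (yes _) p = refl
to-does (no ¬p) p = contradiction p ¬p

to-does-false : ∀ {P : Set} (d : Dec P) → ¬ P → does d ≡ false
to-does-false (yes p) ¬p = contradiction p ¬p
to-does-false (no _)  _  = refl

from-does-false : ∀ {P : Set} (d : Dec P) → does d ≡ false → ¬ P
from-does-false (no ¬p) _ = ¬p

module _ {n : ℕ} where

  singleton-self : (v : Fin n) → singleton v v ≡ true
  singleton-self v = to-does (v Fin.≟ v) refl

  singleton-≡ : (v w : Fin n) → singleton v w ≡ true → v ≡ w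
  singleton-≡ v w = from-does (v Fin.≟ w)

  ∩-insert : ∀ (D U : Sub n) v → U v ≡ true → ∀ w → ((D ∪ᵇ singleton v) ∩ᵇ U) w ≡ ((D ∩ᵇ U) ∪ᵇ singleton v) w
  ∩-insert D U v Uv w with singleton v w in e
  ... | false = trans (cong (_∧ U w) (Bool.∨-identityʳ (D w))) (sym (Bool.∨-identityʳ _))
  ... | true with refl ← singleton-≡ v w e =
    trans (cong (_∧ U v) (Bool.∨-zeroʳ (D v))) (trans Uv (sym (Bool.∨-zeroʳ _)))

  ∩-skip : ∀ (D U : Sub n) v → U v ≡ false → ∀ w → ((D ∪ᵇ singleton v) ∩ᵇ U) w ≡ (D ∩ᵇ U) w
  ∩-skip D U v ¬Uv w with singleton v w in e
  ... | false = cong (_∧ U w) (Bool.∨-identityʳ (D w))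
  ... | true with refl ← singleton-≡ v w e =
    trans (trans (cong ((D v ∨ true) ∧_) ¬Uv) (Bool.∧-zeroʳ _)) (sym (trans (cong (D v ∧_) ¬Uv) (Bool.∧-zeroʳ _)))

  any : Sub n → Bool
  any X = does (Fin.any? λ v → X v Bool.≟ true)

  any-intro : ∀ X v → X v ≡ true → any X ≡ true
  any-intro X v e = to-does (Fin.any? λ w → X w Bool.≟ true) (v , e)

  any-elim : ∀ X → any X ≡ true → ∃[ v ] X v ≡ true
  any-elim X = from-does (Fin.any? λ w → X w Bool.≟ true)

count : ∀ {n} → Sub n → ℕ
count {zero}  X = 0
count {suc n} X = (if X zero then 1 else 0) ℕ.+ count (X ∘ suc)

count-mono : ∀ {n} {X Y : Sub n} → X ⊆ᵇ Y → count X ℕ.≤ count Y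
count-mono {zero}  X⊆Y = ℕ.z≤n
count-mono {suc n} {X} {Y} X⊆Y with X zero in eX | Y zero in eY
... | false | _     = ℕ.≤-trans (count-mono (X⊆Y ∘ suc)) (ℕ.m≤n+m _ _)
... | true  | true  = ℕ.s≤s (count-mono (X⊆Y ∘ suc))
... | true  | false = true≢false (X⊆Y zero eX) eY

count-strict : ∀ {n} {X Y : Sub n} → X ⊆ᵇ Y → ∀ v → X v ≡ false → Y v ≡ true → count X ℕ.< count Y
count-strict {suc n} X⊆Y zero eX eY rewrite eX | eY = ℕ.s≤s (count-mono (X⊆Y ∘ suc))
count-strict {suc n} {X} {Y} X⊆Y (suc v) eX eY with X zero in e | Y zero in e′
... | false | false = count-strict (X⊆Y ∘ suc) v eX eY
... | false | true  = ℕ.m≤n⇒m≤1+n (count-strict (X⊆Y ∘ suc) v eX eY)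
... | true  | true  = ℕ.s≤s (count-strict (X⊆Y ∘ suc) v eX eY)
... | true  | false = true≢false (X⊆Y zero e) e′

count≤n : ∀ {n} (X : Sub n) → count X ℕ.≤ n
count≤n {zero}  X = ℕ.z≤n
count≤n {suc n} X with X zero
... | false = ℕ.m≤n⇒m≤1+n (count≤n (X ∘ suc))
... | true  = ℕ.s≤s (count≤n (X ∘ suc))

minimal : ∀ {n} (_≺_ : Fin n → Fin n → Bool) →
  (∀ v → v ≺ v ≡ false) → (∀ {u v w} → u ≺ v ≡ true → v ≺ w ≡ true → u ≺ w ≡ true) →
  (E : Sub n) → ∀ v → E v ≡ true → ∃[ u ] E u ≡ true × (∀ w → w ≺ u ≡ true → E w ≡ false)
minimal _≺_ irr tr E v Ev = go (count (smaller v)) v Ev ℕ.≤-refl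
  where
  smaller : _ → Sub _
  smaller v w = E w ∧ w ≺ v
  go : ∀ k v → E v ≡ true → count (smaller v) ℕ.≤ k →
    ∃[ u ] E u ≡ true × (∀ w → w ≺ u ≡ true → E w ≡ false)
  go k v Ev le with Fin.any? (λ w → smaller v w Bool.≟ true)
  ... | no none = v , Ev , λ w w≺v → ≢true λ Ew → none (w , ∧-intro Ew w≺v)
  ... | yes (w , s) = descend k le
    where
    lt : count (smaller w) ℕ.< count (smaller v)
    lt = count-strict
      (λ x e → ∧-intro (∧-trueˡ e) (tr (∧-trueʳ {E x} e) (∧-trueʳ {E w} s))) w
      (trans (cong (E w ∧_) (irr w)) (Bool.∧-zeroʳ _)) s
    descend : ∀ k → count (smaller v) ℕ.≤ k →
      ∃[ u ] E u ≡ true × (∀ w → w ≺ u ≡ true → E w ≡ false)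
    descend zero    le = ⊥-elim (ℕ.<⇒≱ lt (ℕ.≤-trans le ℕ.z≤n))
    descend (suc k) le = go k w (∧-trueˡ s) (ℕ.s≤s⁻¹ (ℕ.<-≤-trans lt le))

-- Induction along a strict total order, one initial segment at a time.
module _ {n : ℕ} (_≺_ : Fin n → Fin n → Bool)
  (irr : ∀ v → v ≺ v ≡ false) (tr : ∀ {u v w} → u ≺ v ≡ true → v ≺ w ≡ true → u ≺ w ≡ true)
  (total : ∀ u v → u ≡ v ⊎ (u ≺ v ≡ true ⊎ v ≺ u ≡ true)) where

  before : Fin n → Sub n
  before v x = x ≺ v

  sweep : (P : Sub n → Set) → (∀ {D E} → (∀ v → D v ≡ E v) → P D → P E) →
    P (λ _ → false) → (∀ v → P (before v) → P (before v ∪ᵇ singleton v)) → P (λ _ → true)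
  sweep P ext start next = go n (λ _ → false) (λ _ _ ()) start (ℕ.m≤m+n _ _)
    where
    go : ∀ k D → (∀ x y → D x ≡ true → D y ≡ false → x ≺ y ≡ true) → P D →
      n ℕ.≤ k ℕ.+ count D → P (λ _ → true)
    go k D initial PD le with Fin.any? (λ v → D v Bool.≟ false)
    ... | no full = ext (λ v → Bool.¬-not λ e → full (v , e)) PD
    ... | yes (v , ¬Dv)
      with u , Eu , least ← minimal _≺_ irr tr (not ∘ D) v (not-false ¬Dv) = advance k le
      where
      ¬Du : D u ≡ false
      ¬Du = not-true Eu
      D≡before : ∀ x → D x ≡ before u x
      D≡before x = bool-ext (λ Dx → initial x u Dx ¬Du)
        (λ x≺u → Bool.¬-not λ ¬Dx → true≢false (not-false ¬Dx) (least x x≺u))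
      D′ : Sub n
      D′ = D ∪ᵇ singleton u
      initial′ : ∀ x y → D′ x ≡ true → D′ y ≡ false → x ≺ y ≡ true
      initial′ x y Dx ¬Dy with ∨-elim {D x} Dx
      ... | inj₁ Dx′ = initial x y Dx′ (∨-falseˡ ¬Dy)
      ... | inj₂ ux with refl ← singleton-≡ u x ux | total x y
      ... | inj₁ refl = true≢false (singleton-self y) (∨-falseʳ {D y} ¬Dy)
      ... | inj₂ (inj₁ x≺y) = x≺y
      ... | inj₂ (inj₂ y≺x) = true≢false (not-false (∨-falseˡ ¬Dy)) (least y y≺x)
      grow : count D ℕ.< count D′
      grow = count-strict (λ _ → ∨-introˡ) u ¬Du (∨-introʳ {D u} (singleton-self u))
      advance : ∀ k → n ℕ.≤ k ℕ.+ count D → P (λ _ → true)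
      advance zero le = ⊥-elim (ℕ.<⇒≱ (ℕ.<-≤-trans grow (count≤n D′)) le)
      advance (suc k) le = go k D′ initial′
        (ext (λ x → cong (_∨ singleton u x) (sym (D≡before x)))
          (next u (ext D≡before PD)))
        (ℕ.≤-trans le (subst (ℕ._≤ k ℕ.+ count D′) (ℕ.+-suc k (count D)) (ℕ.+-monoʳ-≤ k grow)))

sum-mono : ∀ {n} {h k : Fin n → ℤ} → (∀ v → h v ≤ k v) → sum h ≤ sum k
sum-mono {zero}  le = ℤ.≤-refl
sum-mono {suc n} le = ℤ.+-mono-≤ (le zero) (sum-mono (le ∘ suc))

sum-const : ∀ {n} c → sum {n} (λ _ → c) ≡ + n * c
sum-const {zero}  c = refl
sum-const {suc n} c = trans (cong (ℤ._+_ c) (sum-const {n} c)) (sym (ℤ.suc-* (+ n) c))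

mask : Bool → ℤ → ℤ
mask b z = if b then z else 0ℤ

mask-zero : ∀ b → mask b 0ℤ ≡ 0ℤ
mask-zero false = refl
mask-zero true  = refl

sum-zero : ∀ {n} → sum {n} (λ _ → 0ℤ) ≡ 0ℤ
sum-zero {n} = trans (sum-const {n} 0ℤ) (ℤ.*-zeroʳ (+ n))

sum-single : ∀ {n} (v : Fin n) (h : Fin n → ℤ) → sum (λ w → mask (singleton v w) (h w)) ≡ h v
sum-single {suc n} zero    h = trans (cong (λ s → h zero + s) (sum-zero {n})) (ℤ.+-identityʳ _)
sum-single {suc n} (suc v) h = trans (ℤ.+-identityˡ _)
  (trans (sum-cong-≗ {n} λ w → refl) (sum-single v (h ∘ suc)))

module _ {n : ℕ} where

  sumOver : Sub n → (Fin n → ℤ) → ℤ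
  sumOver X h = sum λ v → mask (X v) (h v)

  sumOver-ext : ∀ {X Y} h → (∀ v → X v ≡ Y v) → sumOver X h ≡ sumOver Y h
  sumOver-ext h eq = sum-cong-≗ λ v → cong (λ b → mask b (h v)) (eq v)

  sumOver-cong : ∀ X {h k : Fin n → ℤ} → (∀ v → X v ≡ true → h v ≡ k v) → sumOver X h ≡ sumOver X k
  sumOver-cong X eq = sum-cong-≗ pointwise
    where
    pointwise : ∀ v → mask (X v) _ ≡ mask (X v) _
    pointwise v with X v in e
    ... | true  = eq v e
    ... | false = refl

  sumOver-+ : ∀ X h k → sumOver X (λ v → h v + k v) ≡ sumOver X h + sumOver X k
  sumOver-+ X h k = trans (sum-cong-≗ pointwise) (∑-distrib-+ {n} _ _)
    where
    pointwise : ∀ v → mask (X v) (h v + k v) ≡ mask (X v) (h v) + mask (X v) (k v)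
    pointwise v with X v
    ... | true  = refl
    ... | false = refl

  sumOver-* : ∀ X c h → sumOver X (λ v → c * h v) ≡ c * sumOver X h
  sumOver-* X c h = trans (sum-cong-≗ pointwise) (sym (*-distribˡ-sum {n} c (λ v → mask (X v) (h v))))
    where
    pointwise : ∀ v → mask (X v) (c * h v) ≡ c * mask (X v) (h v)
    pointwise v with X v
    ... | true  = refl
    ... | false = sym (ℤ.*-zeroʳ c)

  sumOver-mono : ∀ X {h k : Fin n → ℤ} → (∀ v → X v ≡ true → h v ≤ k v) → sumOver X h ≤ sumOver X k
  sumOver-mono X {h} {k} le = sum-mono pointwise
    where
    pointwise : ∀ v → mask (X v) (h v) ≤ mask (X v) (k v)
    pointwise v with X v in e
    ... | true  = le v e
    ... | false = ℤ.≤-refl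

  sumOver-insert : ∀ X v h → X v ≡ false → sumOver (X ∪ᵇ singleton v) h ≡ sumOver X h + h v
  sumOver-insert X v h ¬Xv = trans (sum-cong-≗ pointwise)
    (trans (∑-distrib-+ {n} _ _) (cong (ℤ._+_ (sumOver X h)) (sum-single v h)))
    where
    pointwise : ∀ w → mask (X w ∨ singleton v w) (h w) ≡ mask (X w) (h w) + mask (singleton v w) (h w)
    pointwise w with X w in e | singleton v w in e′
    ... | false | _     = sym (ℤ.+-identityˡ _)
    ... | true  | false = sym (ℤ.+-identityʳ _)
    ... | true  | true  with refl ← singleton-≡ v w e′ = true≢false e ¬Xv

  sumOver-empty : ∀ h → sumOver (λ _ → false) h ≡ 0ℤ
  sumOver-empty h = sum-zero {n}

  weight : ℤ → Sub n → ℤ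
  weight c X = sumOver X λ _ → c

  weight-modular : ∀ c X Y → weight c (X ∪ᵇ Y) + weight c (X ∩ᵇ Y) ≡ weight c X + weight c Y
  weight-modular c X Y = trans (sym (∑-distrib-+ {n} _ _)) (trans (sum-cong-≗ pointwise) (∑-distrib-+ {n} _ _))
    where
    pointwise : ∀ v → mask (X v ∨ Y v) c + mask (X v ∧ Y v) c ≡ mask (X v) c + mask (Y v) c
    pointwise v with X v | Y v
    ... | false | false = refl
    ... | false | true  = trans (ℤ.+-identityʳ c) (sym (ℤ.+-identityˡ c))
    ... | true  | false = refl
    ... | true  | true  = refl

  weight-mono : ∀ {c X Y} → 0ℤ ≤ c → X ⊆ᵇ Y → weight c X ≤ weight c Y
  weight-mono {c} {X} {Y} 0≤c X⊆Y = sum-mono pointwise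
    where
    pointwise : ∀ v → mask (X v) c ≤ mask (Y v) c
    pointwise v with X v in eX | Y v in eY
    ... | false | false = ℤ.≤-refl
    ... | false | true  = 0≤c
    ... | true  | true  = ℤ.≤-refl
    ... | true  | false = true≢false (X⊆Y v eX) eY

  weight-grow : ∀ {c X Y} → 0ℤ ≤ c → X ⊆ᵇ Y → ∀ v → X v ≡ false → Y v ≡ true → weight c X + c ≤ weight c Y
  weight-grow {c} {X} {Y} 0≤c X⊆Y v ¬Xv Yv =
    subst (_≤ weight c Y) (sumOver-insert X v (λ _ → c) ¬Xv)
      (weight-mono 0≤c λ w e → [ X⊆Y w , (λ e′ → subst (λ x → Y x ≡ true) (singleton-≡ v w e′) Yv) ]′ (∨-elim e))

  weight-bound : ∀ {c X} → 0ℤ ≤ c → weight c X ≤ + n * c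
  weight-bound {c} {X} 0≤c = subst (weight c X ≤_) (sum-const {n} c) (weight-mono {X = X} {Y = λ _ → true} 0≤c λ _ _ → refl)

  weight-nonneg : ∀ {c X} → 0ℤ ≤ c → 0ℤ ≤ weight c X
  weight-nonneg {c} {X} 0≤c = subst (_≤ weight c X) (sum-zero {n}) (weight-mono {X = λ _ → false} 0≤c λ _ ())

-- A ring family is stored as a preorder: R v w says that members
-- containing v contain w; members contain a and avoid b, so that a lies
-- below and b above every element.

record Order {n : ℕ} (a b : Fin n) (R : Fin n → Sub n) : Set where
  field
    reflexive  : ∀ v → R v v ≡ true
    transitive : ∀ {u v w} → R u v ≡ true → R v w ≡ true → R u w ≡ true
    bottom     : ∀ v → R v a ≡ true
    top        : ∀ v → R b v ≡ true
    proper     : R a b ≡ false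

record Ideal {n : ℕ} (a b : Fin n) (R : Fin n → Sub n) (X : Sub n) : Set where
  field
    closed : ∀ {v w} → X v ≡ true → R v w ≡ true → X w ≡ true
    has    : X a ≡ true
    avoids : X b ≡ false

module _ {n : ℕ} (a b : Fin n) (R : Fin n → Sub n) where

  strictDown : Fin n → Sub n
  strictDown v w = R v w ∧ not (R w v)

  live : Sub n
  live v = not (R a v) ∧ not (R v b)

  largest : Sub n
  largest v = not (R v b)

  largestWithout : Fin n → Sub n
  largestWithout v w = not (R w b) ∧ not (R w v)

record SubmodularOn {n : ℕ} (g : Sub n → ℤ) : Set where
  field
    cong-g     : ∀ {X Y} → (∀ v → X v ≡ Y v) → g X ≡ g Y
    submodular : ∀ X Y → g (X ∪ᵇ Y) + g (X ∩ᵇ Y) ≤ g X + g Y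

module Family {n : ℕ} {a b : Fin n} {R : Fin n → Sub n} (order : Order a b R) where

  open Order order
  open Ideal public

  IsIdeal : Sub n → Set
  IsIdeal = Ideal a b R

  live-above : ∀ {v} → live a b R v ≡ true → R a v ≡ false
  live-above e = not-true (∧-trueˡ e)

  live-below : ∀ {v} → live a b R v ≡ true → R v b ≡ false
  live-below {v} e = not-true (∧-trueʳ {not (R a v)} e)

  down-ideal : ∀ {v} → R v b ≡ false → IsIdeal (R v)
  down-ideal ¬vb = record { closed = transitive ; has = bottom _ ; avoids = ¬vb }

  largest-ideal : IsIdeal (largest a b R)
  largest-ideal = record
    { closed = λ {v} {w} e vw → not-false (≢true λ wb → true≢false (transitive vw wb) (not-true e))
    ; has    = not-false proper
    ; avoids = cong not (reflexive b)
    }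

  largestWithout-ideal : ∀ {v} → live a b R v ≡ true → IsIdeal (largestWithout a b R v)
  largestWithout-ideal {v} lv = record
    { closed = λ {u} {w} e uw → ∧-intro
        (closed largest-ideal (∧-trueˡ e) uw)
        (not-false (≢true λ wv → true≢false (transitive uw wv) (not-true (∧-trueʳ {not (R u b)} e))))
    ; has    = ∧-intro (not-false proper) (not-false (live-above lv))
    ; avoids = cong (λ x → not x ∧ not (R b v)) (reflexive b)
    }

  strictDown-ideal : ∀ {v} → live a b R v ≡ true → IsIdeal (strictDown a b R v)
  strictDown-ideal {v} lv = record
    { closed = λ {u} {w} e uw → ∧-intro (transitive (∧-trueˡ e) uw)
        (not-false (≢true λ wv → true≢false (transitive uw wv) (not-true (∧-trueʳ {R v u} e))))
    ; has    = ∧-intro (bottom v) (not-false (live-above lv))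
    ; avoids = cong (_∧ not (R b v)) (live-below lv)
    }

  ∪-ideal : ∀ {X Y} → IsIdeal X → IsIdeal Y → IsIdeal (X ∪ᵇ Y)
  ∪-ideal {X} I J = record
    { closed = λ {v} {w} e vw → [ (λ e′ → ∨-introˡ (closed I e′ vw)) , (λ e′ → ∨-introʳ {X w} (closed J e′ vw)) ]′ (∨-elim e)
    ; has    = ∨-introˡ (has I)
    ; avoids = cong₂ _∨_ (avoids I) (avoids J)
    }

  ∩-ideal : ∀ {X Y} → IsIdeal X → IsIdeal Y → IsIdeal (X ∩ᵇ Y)
  ∩-ideal {X} I J = record
    { closed = λ {v} e vw → ∧-intro (closed I (∧-trueˡ e) vw) (closed J (∧-trueʳ {X v} e) vw)
    ; has    = ∧-intro (has I) (has J)
    ; avoids = cong₂ _∧_ (avoids I) (avoids J)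
    }

  ideal-below : ∀ {X v} → IsIdeal X → X v ≡ true → R v b ≡ false
  ideal-below I Xv = ≢true λ vb → true≢false (closed I Xv vb) (avoids I)

  outside-live : ∀ {X v} → IsIdeal X → X v ≡ false → R v b ≡ false → live a b R v ≡ true
  outside-live I ¬Xv ¬vb =
    ∧-intro (not-false (≢true λ av → true≢false (closed I (has I) av) ¬Xv)) (not-false ¬vb)

  -- Between nested ideals one can pass by adding principal ideals whose
  -- strict part is already present.
  monotone : (h : Sub n → ℤ) → (∀ {X Y} → (∀ v → X v ≡ Y v) → h X ≡ h Y) →
    (∀ X v → IsIdeal X → X v ≡ false → R v b ≡ false → strictDown a b R v ⊆ᵇ X → h X ≤ h (X ∪ᵇ R v)) →
    ∀ {X Y} → IsIdeal X → IsIdeal Y → X ⊆ᵇ Y → h X ≤ h Y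
  monotone h h-cong step {X₀} {Y} IX₀ IY X₀⊆Y = go n X₀ IX₀ X₀⊆Y (ℕ.m≤m+n _ _)
    where
    go : ∀ k X → IsIdeal X → X ⊆ᵇ Y → n ℕ.≤ k ℕ.+ count X → h X ≤ h Y
    go k X IX X⊆Y le with Fin.any? (λ v → (Y v ∧ not (X v)) Bool.≟ true)
    ... | no none = ℤ.≤-reflexive (h-cong λ v →
      bool-ext (X⊆Y v) λ Yv → Bool.¬-not λ ¬Xv → none (v , ∧-intro Yv (not-false ¬Xv)))
    ... | yes (v , e)
      with u , Eu , least ← minimal (λ x y → strictDown a b R y x)
             (λ x → trans (cong (R x x ∧_) (cong not (reflexive x))) (Bool.∧-zeroʳ _))
             (λ {x} {y} {z} p q → ∧-intro (transitive (∧-trueˡ q) (∧-trueˡ p))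
               (not-false (≢true λ xz → true≢false (transitive xz (∧-trueˡ q)) (not-true (∧-trueʳ {R y x} p)))))
             (λ v → Y v ∧ not (X v)) v e = advance k le
      where
      Yu : Y u ≡ true
      Yu = ∧-trueˡ Eu
      ¬Xu : X u ≡ false
      ¬Xu = not-true (∧-trueʳ {Y u} Eu)
      ¬ub : R u b ≡ false
      ¬ub = ideal-below IY Yu
      covered : strictDown a b R u ⊆ᵇ X
      covered w s = Bool.¬-not λ ¬Xw →
        true≢false (∧-intro (closed IY Yu (∧-trueˡ s)) (not-false ¬Xw)) (least w s)
      X′⊆Y : (X ∪ᵇ R u) ⊆ᵇ Y
      X′⊆Y w e′ = [ X⊆Y w , closed IY Yu ]′ (∨-elim e′)
      grow : count X ℕ.< count (X ∪ᵇ R u)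
      grow = count-strict (λ _ → ∨-introˡ) u ¬Xu (∨-introʳ {X u} (reflexive u))
      advance : ∀ k → n ℕ.≤ k ℕ.+ count X → h X ≤ h Y
      advance zero le = ⊥-elim (ℕ.<⇒≱ (ℕ.<-≤-trans grow (count≤n (X ∪ᵇ R u))) le)
      advance (suc k) le = ℤ.≤-trans (step X u IX ¬Xu ¬ub covered)
        (go k (X ∪ᵇ R u) (∪-ideal IX (down-ideal ¬ub)) X′⊆Y
          (ℕ.≤-trans le (subst (ℕ._≤ k ℕ.+ count (X ∪ᵇ R u)) (ℕ.+-suc k (count X)) (ℕ.+-monoʳ-≤ k grow))))

  module Bounded {g : Sub n → ℤ} (sub : SubmodularOn g) {η : ℤ} (0≤η : 0ℤ ≤ η)
    (up : ∀ v → live a b R v ≡ true → g (R v) - g (strictDown a b R v) ≤ η) where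

    open SubmodularOn sub

    rise : ∀ {X Y} → IsIdeal X → IsIdeal Y → X ⊆ᵇ Y → g Y + weight η X ≤ g X + weight η Y
    rise {X} {Y} IX IY X⊆Y = lin₁ (eq (g X) (g Y) (weight η X) (weight η Y))
      (monotone (λ X → weight η X - g X) (λ e → cong₂ _-_ (sumOver-ext _ e) (cong-g e)) step IX IY X⊆Y)
      where
      eq : ∀ gx gy wx wy → (gx + wy) - (gy + wx) ≡ (wy - gy) - (wx - gx)
      eq = solve-∀
      combine : ∀ gx gv gs gu wx wu e → (wu - gu) - (wx - gx) ≡
        ((gv + gx) - (gu + gs)) + (e - (gv - gs)) + (wu - (wx + e))
      combine = solve-∀
      step : ∀ X v → IsIdeal X → X v ≡ false → R v b ≡ false → strictDown a b R v ⊆ᵇ X →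
        weight η X - g X ≤ weight η (X ∪ᵇ R v) - g (X ∪ᵇ R v)
      step X v IX ¬Xv ¬vb covered =
        lin₃ (combine (g X) (g (R v)) (g (strictDown a b R v)) (g (X ∪ᵇ R v)) (weight η X) (weight η (X ∪ᵇ R v)) η)
          (subst₂ (λ x y → x + y ≤ g (R v) + g X)
            (cong-g λ w → Bool.∨-comm (R v w) (X w)) (cong-g meet) (submodular (R v) X))
          (up v (outside-live IX ¬Xv ¬vb))
          (weight-grow 0≤η (λ _ → ∨-introˡ) v ¬Xv (∨-introʳ {X v} (reflexive v)))
        where
        meet : ∀ w → (R v ∩ᵇ X) w ≡ strictDown a b R v w
        meet w = bool-ext
          (λ e → ∧-intro (∧-trueˡ e)
            (not-false (≢true λ wv → true≢false (closed IX (∧-trueʳ {R v w} e) wv) ¬Xv)))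
          (λ e → ∧-intro (∧-trueˡ e) (covered w e))

    rise-bound : ∀ {X Y} → IsIdeal X → IsIdeal Y → X ⊆ᵇ Y → g Y ≤ g X + + n * η
    rise-bound {X} {Y} IX IY X⊆Y = lin₃ (combine (g X) (g Y) (weight η X) (weight η Y) (+ n * η))
      (rise IX IY X⊆Y) (weight-bound {X = Y} 0≤η) (weight-nonneg {X = X} 0≤η)
      where
      combine : ∀ gx gy wx wy e → (gx + e) - gy ≡
        ((gx + wy) - (gy + wx)) + (e - wy) + (wx - 0ℤ)
      combine = solve-∀

    module Penalised {C : ℤ} (0≤C : 0ℤ ≤ C)
      (down : ∀ v → live a b R v ≡ true →
        g (largestWithout a b R v) ≤ g (largestWithout a b R v ∪ᵇ R v) + C) where

      G : Sub n → ℤ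
      G X = g X + weight C X

      G-cong : ∀ {X Y} → (∀ v → X v ≡ Y v) → G X ≡ G Y
      G-cong e = cong₂ _+_ (cong-g e) (sumOver-ext _ e)

      G-submodular : ∀ X Y → G (X ∪ᵇ Y) + G (X ∩ᵇ Y) ≤ G X + G Y
      G-submodular X Y = lin₂
        (combine (g X) (g Y) (g (X ∪ᵇ Y)) (g (X ∩ᵇ Y)) (weight C X) (weight C Y) (weight C (X ∪ᵇ Y)) (weight C (X ∩ᵇ Y)))
        (submodular X Y) (ℤ.≤-reflexive (weight-modular C X Y))
        where
        combine : ∀ x y u i wx wy wu wi → ((x + wx) + (y + wy)) - ((u + wu) + (i + wi)) ≡
          ((x + y) - (u + i)) + ((wx + wy) - (wu + wi))
        combine = solve-∀

      G-mono : ∀ {X Y} → IsIdeal X → IsIdeal Y → X ⊆ᵇ Y → G X ≤ G Y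
      G-mono = monotone G G-cong step
        where
        combine : ∀ gx gt gu gtv wx wu c → (gu + wu) - (gx + wx) ≡
          ((gu + gt) - (gtv + gx)) + ((gtv + c) - gt) + (wu - (wx + c))
        combine = solve-∀
        step : ∀ X v → IsIdeal X → X v ≡ false → R v b ≡ false → strictDown a b R v ⊆ᵇ X →
          G X ≤ G (X ∪ᵇ R v)
        step X v IX ¬Xv ¬vb covered =
          lin₃ (combine (g X) (g Tᵥ) (g (X ∪ᵇ R v)) (g (Tᵥ ∪ᵇ R v)) (weight C X) (weight C (X ∪ᵇ R v)) C)
            (subst₂ (λ x y → x + y ≤ g (X ∪ᵇ R v) + g Tᵥ) (cong-g join) (cong-g meet) (submodular (X ∪ᵇ R v) Tᵥ))
            (down v (outside-live IX ¬Xv ¬vb))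
            (weight-grow 0≤C (λ _ → ∨-introˡ) v ¬Xv (∨-introʳ {X v} (reflexive v)))
          where
          Tᵥ : Sub n
          Tᵥ = largestWithout a b R v
          X⊆Tᵥ : X ⊆ᵇ Tᵥ
          X⊆Tᵥ w Xw = ∧-intro (not-false (ideal-below IX Xw))
            (not-false (≢true λ wv → true≢false (closed IX Xw wv) ¬Xv))
          join : ∀ w → ((X ∪ᵇ R v) ∪ᵇ Tᵥ) w ≡ (Tᵥ ∪ᵇ R v) w
          join w = bool-ext
            (λ e → [ (λ e′ → [ (λ Xw → ∨-introˡ (X⊆Tᵥ w Xw)) , ∨-introʳ {Tᵥ w} ]′ (∨-elim e′)) , ∨-introˡ ]′ (∨-elim e))
            (λ e → [ ∨-introʳ {X w ∨ R v w} , (λ e′ → ∨-introˡ (∨-introʳ {X w} e′)) ]′ (∨-elim e))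
          meet : ∀ w → ((X ∪ᵇ R v) ∩ᵇ Tᵥ) w ≡ X w
          meet w = bool-ext
            (λ e → [ (λ Xw → Xw)
                   , (λ vw → covered w (∧-intro vw (∧-trueʳ {not (R w b)} (∧-trueʳ {X w ∨ R v w} e)))) ]′ (∨-elim (∧-trueˡ e)))
            (λ Xw → ∧-intro (∨-introˡ Xw) (X⊆Tᵥ w Xw))

      diminishing : ∀ {X Y v} → IsIdeal X → IsIdeal Y → X ⊆ᵇ Y → R v b ≡ false →
        G (Y ∪ᵇ R v) - G Y ≤ G (X ∪ᵇ R v) - G X
      diminishing {X} {Y} {v} IX IY X⊆Y ¬vb =
        lin₂ (combine (G X) (G Y) (G (X ∪ᵇ R v)) (G (Y ∪ᵇ R v)) (G ((X ∪ᵇ R v) ∩ᵇ Y)))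
          (subst (λ x → x + G ((X ∪ᵇ R v) ∩ᵇ Y) ≤ G (X ∪ᵇ R v) + G Y) (G-cong join) (G-submodular (X ∪ᵇ R v) Y))
          (G-mono IX (∩-ideal (∪-ideal IX (down-ideal ¬vb)) IY) λ w Xw → ∧-intro (∨-introˡ Xw) (X⊆Y w Xw))
        where
        combine : ∀ x y xv yv i → (xv - x) - (yv - y) ≡ ((xv + y) - (yv + i)) + (i - x)
        combine = solve-∀
        join : ∀ w → ((X ∪ᵇ R v) ∪ᵇ Y) w ≡ (Y ∪ᵇ R v) w
        join w = bool-ext
          (λ e → [ (λ e′ → [ (λ Xw → ∨-introˡ (X⊆Y w Xw)) , ∨-introʳ {Y w} ]′ (∨-elim e′)) , ∨-introˡ ]′ (∨-elim e))
          (λ e → [ ∨-introʳ {X w ∨ R v w} , (λ e′ → ∨-introˡ (∨-introʳ {X w} e′)) ]′ (∨-elim e))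

-- η bounds every increase of g between ideals that differ by one class,
-- and C every decrease.
record Scaled {n : ℕ} (a b : Fin n) (R : Fin n → Sub n) (g : Sub n → ℤ) (η C : ℤ) : Set where
  field
    η-nonneg : 0ℤ ≤ η
    C-nonneg : 0ℤ ≤ C
    up       : ∀ v → live a b R v ≡ true → g (R v) - g (strictDown a b R v) ≤ η
    down     : ∀ v → live a b R v ≡ true →
      g (largestWithout a b R v) ≤ g (largestWithout a b R v ∪ᵇ R v) + C

record StrictTotal {n : ℕ} (_≺_ : Fin n → Fin n → Bool) : Set where
  field
    irreflexive : ∀ v → v ≺ v ≡ false
    transitive  : ∀ {u v w} → u ≺ v ≡ true → v ≺ w ≡ true → u ≺ w ≡ true
    total       : ∀ u v → u ≡ v ⊎ (u ≺ v ≡ true ⊎ v ≺ u ≡ true)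

module _ {n : ℕ} (b : Fin n) (R : Fin n → Sub n) (r : Fin n) where

  free : Sub n
  free v = not (R r v) ∧ not (R v b)

  closure : Sub n → Sub n
  closure D w = R r w ∨ any (λ x → (D x ∧ free x) ∧ R x w)

  module _ (g : Sub n → ℤ) (C : ℤ) (_≺_ : Fin n → Fin n → Bool) where

    greedyBase : Fin n → ℤ
    greedyBase v = mask (free v)
      (g (closure (λ x → x ≺ v) ∪ᵇ R v) + weight C (closure (λ x → x ≺ v) ∪ᵇ R v)
        - (g (closure (λ x → x ≺ v)) + weight C (closure (λ x → x ≺ v))) - C)

module Greedy {n : ℕ} {a b : Fin n} {R : Fin n → Sub n} (order : Order a b R)
  {g : Sub n → ℤ} (sub : SubmodularOn g) {η C : ℤ} (scaled : Scaled a b R g η C)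
  {r : Fin n} (¬rb : R r b ≡ false)
  {_≺_ : Fin n → Fin n → Bool} (strictTotal : StrictTotal _≺_) where

  open Order order using (reflexive)
  open SubmodularOn sub
  open Scaled scaled
  open Family order
  open Bounded sub η-nonneg up
  open Penalised C-nonneg down
  open StrictTotal strictTotal using (irreflexive; total) renaming (transitive to ≺-trans)

  private
    cl : Sub n → Sub n
    cl = closure b R r
    fr : Sub n
    fr = free b R r
    seg : Fin n → Sub n
    seg v x = x ≺ v
    gain : Fin n → ℤ
    gain v = G (cl (seg v) ∪ᵇ R v) - G (cl (seg v))
    base : Fin n → ℤ
    base = greedyBase b R r g C _≺_

  cl-ideal : ∀ D → IsIdeal (cl D)
  cl-ideal D = record
    { closed = λ {v} {w} e vw → [ (λ rv → ∨-introˡ (Order.transitive order rv vw))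
        , (λ e′ → let x , p = any-elim (λ x → (D x ∧ fr x) ∧ R x v) e′ in
            ∨-introʳ {R r w} (any-intro (λ x → (D x ∧ fr x) ∧ R x w) x
              (∧-intro (∧-trueˡ p) (Order.transitive order (∧-trueʳ {D x ∧ fr x} p) vw)))) ]′ (∨-elim e)
    ; has    = ∨-introˡ (Order.bottom order r)
    ; avoids = ≢true λ e → [ (λ rb → true≢false rb ¬rb)
        , (λ e′ → let x , p = any-elim (λ x → (D x ∧ fr x) ∧ R x b) e′ in
            true≢false (∧-trueʳ {D x ∧ fr x} p) (not-true (∧-trueʳ {not (R r x)} (∧-trueʳ {D x} (∧-trueˡ {D x ∧ fr x} p))))) ]′ (∨-elim e)
    }

  cl-root : ∀ D v → R r v ≡ true → cl D v ≡ true
  cl-root D v e = ∨-introˡ e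

  cl-member : ∀ D x w → D x ≡ true → fr x ≡ true → R x w ≡ true → cl D w ≡ true
  cl-member D x w Dx fx xw = ∨-introʳ {R r w} (any-intro _ x (∧-intro (∧-intro Dx fx) xw))

  cl-elim : ∀ D w → cl D w ≡ true →
    R r w ≡ true ⊎ ∃[ x ] D x ≡ true × fr x ≡ true × R x w ≡ true
  cl-elim D w e with ∨-elim e
  ... | inj₁ rw = inj₁ rw
  ... | inj₂ e′ with x , p ← any-elim _ e′ =
    inj₂ (x , ∧-trueˡ (∧-trueˡ p) , ∧-trueʳ {D x} (∧-trueˡ p) , ∧-trueʳ {D x ∧ fr x} p)

  cl-mono : ∀ {D E} → D ⊆ᵇ E → cl D ⊆ᵇ cl E
  cl-mono {D} {E} D⊆E w e with cl-elim D w e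
  ... | inj₁ rw = cl-root E w rw
  ... | inj₂ (x , Dx , fx , xw) = cl-member E x w (D⊆E x Dx) fx xw

  cl-cong : ∀ {D E} → (∀ v → D v ≡ E v) → ∀ v → cl D v ≡ cl E v
  cl-cong eq v = bool-ext (cl-mono (λ w e → trans (sym (eq w)) e) v) (cl-mono (λ w e → trans (eq w) e) v)

  cl-insert : ∀ D v → fr v ≡ true → ∀ w → cl (D ∪ᵇ singleton v) w ≡ (cl D ∪ᵇ R v) w
  cl-insert D v fv w = bool-ext to from
    where
    to : cl (D ∪ᵇ singleton v) w ≡ true → (cl D ∪ᵇ R v) w ≡ true
    to e with cl-elim (D ∪ᵇ singleton v) w e
    ... | inj₁ rw = ∨-introˡ (cl-root D w rw)
    ... | inj₂ (x , Dx , fx , xw) with ∨-elim {D x} Dx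
    ... | inj₁ Dx′ = ∨-introˡ (cl-member D x w Dx′ fx xw)
    ... | inj₂ vx with refl ← singleton-≡ v x vx = ∨-introʳ {cl D w} xw
    from : (cl D ∪ᵇ R v) w ≡ true → cl (D ∪ᵇ singleton v) w ≡ true
    from e = [ cl-mono {D} {D ∪ᵇ singleton v} (λ _ → ∨-introˡ) w
             , cl-member (D ∪ᵇ singleton v) v w (∨-introʳ {D v} (singleton-self v)) fv ]′ (∨-elim e)

  cl-skip : ∀ D v → fr v ≡ false → ∀ w → cl (D ∪ᵇ singleton v) w ≡ cl D w
  cl-skip D v ¬fv w = bool-ext to (cl-mono {D} {D ∪ᵇ singleton v} (λ _ → ∨-introˡ) w)
    where
    to : cl (D ∪ᵇ singleton v) w ≡ true → cl D w ≡ true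
    to e with cl-elim (D ∪ᵇ singleton v) w e
    ... | inj₁ rw = cl-root D w rw
    ... | inj₂ (x , Dx , fx , xw) with ∨-elim {D x} Dx
    ... | inj₁ Dx′ = cl-member D x w Dx′ fx xw
    ... | inj₂ vx with refl ← singleton-≡ v x vx = true≢false fx ¬fv

  free-below : ∀ {v} → fr v ≡ true → R v b ≡ false
  free-below {v} e = not-true (∧-trueʳ {not (R r v)} e)

  cl-ideal-fixed : ∀ {U} → IsIdeal U → U r ≡ true → ∀ v → cl U v ≡ U v
  cl-ideal-fixed {U} IU Ur v = bool-ext to from
    where
    to : cl U v ≡ true → U v ≡ true
    to e with cl-elim U v e
    ... | inj₁ rv = closed IU Ur rv
    ... | inj₂ (x , Ux , _ , xv) = closed IU Ux xv
    from : U v ≡ true → cl U v ≡ true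
    from Uv with R r v in e
    ... | true  = refl
    ... | false = any-intro (λ x → (U x ∧ fr x) ∧ R x v) v
      (∧-intro (∧-intro Uv (∧-intro (cong not e) (not-false (ideal-below IU Uv)))) (reflexive v))

  base-split : ∀ D → sumOver D base ≡ sumOver (D ∩ᵇ fr) gain - weight C (D ∩ᵇ fr)
  base-split D = begin
    sumOver D base ≡⟨ sum-cong-≗ pointwise ⟩
    sumOver (D ∩ᵇ fr) (λ v → gain v + - 1ℤ * C)
      ≡⟨ sumOver-+ (D ∩ᵇ fr) gain (λ _ → - 1ℤ * C) ⟩
    sumOver (D ∩ᵇ fr) gain + sumOver (D ∩ᵇ fr) (λ _ → - 1ℤ * C)
      ≡⟨ cong (ℤ._+_ (sumOver (D ∩ᵇ fr) gain)) (trans (sumOver-* (D ∩ᵇ fr) (- 1ℤ) (λ _ → C)) (ℤ.-1*i≡-i _)) ⟩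
    sumOver (D ∩ᵇ fr) gain - weight C (D ∩ᵇ fr) ∎
    where
    open ≡-Reasoning
    pointwise : ∀ v → mask (D v) (base v) ≡ mask (D v ∧ fr v) (gain v + - 1ℤ * C)
    pointwise v with D v | fr v
    ... | false | _     = refl
    ... | true  | false = refl
    ... | true  | true  = cong (ℤ._+_ (gain v)) (sym (ℤ.-1*i≡-i C))

  G-empty : G (cl (λ _ → false)) ≡ G (R r)
  G-empty = G-cong λ w → bool-ext (λ e → [ (λ rw → rw) , (λ { (_ , () , _) }) ]′ (cl-elim (λ _ → false) w e))
    (cl-root (λ _ → false) w)

  Telescopes : Sub n → Set
  Telescopes D = sumOver (D ∩ᵇ fr) gain ≡ G (cl D) - G (R r)

  telescopes-cong : ∀ {D E} → (∀ v → D v ≡ E v) → Telescopes D → Telescopes E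
  telescopes-cong eq t = trans (sumOver-ext gain λ v → cong (_∧ fr v) (sym (eq v)))
    (trans t (cong (_- G (R r)) (G-cong (cl-cong eq))))

  telescopes-empty : Telescopes (λ _ → false)
  telescopes-empty = trans (sumOver-empty gain) (sym (ℤ.i≡j⇒i-j≡0 G-empty))

  telescopes-next : ∀ v → Telescopes (seg v) → Telescopes (seg v ∪ᵇ singleton v)
  telescopes-next v t with fr v in fv
  ... | false = trans (sumOver-ext gain (∩-skip (seg v) fr v fv))
    (trans t (cong (_- G (R r)) (G-cong λ w → sym (cl-skip (seg v) v fv w))))
  ... | true = begin
    sumOver ((seg v ∪ᵇ singleton v) ∩ᵇ fr) gain
      ≡⟨ sumOver-ext gain (∩-insert (seg v) fr v fv) ⟩
    sumOver ((seg v ∩ᵇ fr) ∪ᵇ singleton v) gain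
      ≡⟨ sumOver-insert (seg v ∩ᵇ fr) v gain (cong (_∧ fr v) (irreflexive v)) ⟩
    sumOver (seg v ∩ᵇ fr) gain + gain v
      ≡⟨ cong (_+ gain v) t ⟩
    G (cl (seg v)) - G (R r) + gain v
      ≡⟨ rearrange (G (cl (seg v))) (G (R r)) (G (cl (seg v) ∪ᵇ R v)) ⟩
    G (cl (seg v) ∪ᵇ R v) - G (R r)
      ≡⟨ cong (_- G (R r)) (G-cong λ w → sym (cl-insert (seg v) v fv w)) ⟩
    G (cl (seg v ∪ᵇ singleton v)) - G (R r) ∎
    where
    open ≡-Reasoning
    rearrange : ∀ x y z → x - y + (z - x) ≡ z - y
    rearrange = solve-∀

  all-telescope : Telescopes (λ _ → true)
  all-telescope = sweep _≺_ irreflexive ≺-trans total Telescopes telescopes-cong telescopes-empty telescopes-next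

  Bounds : Sub n → Sub n → Set
  Bounds U D = sumOver ((D ∩ᵇ U) ∩ᵇ fr) gain ≤ G (cl (D ∩ᵇ U)) - G (R r)

  bounds-cong : ∀ U {D E} → (∀ v → D v ≡ E v) → Bounds U D → Bounds U E
  bounds-cong U {D} {E} eq = subst₂ _≤_ (sumOver-ext gain λ v → cong (λ x → (x ∧ U v) ∧ fr v) (eq v))
    (cong (_- G (R r)) (G-cong (cl-cong λ v → cong (_∧ U v) (eq v))))

  bounds-next : ∀ U v → Bounds U (seg v) → Bounds U (seg v ∪ᵇ singleton v)
  bounds-next U v t with U v in Uv
  ... | false = subst₂ _≤_
    (sumOver-ext gain λ w → cong (_∧ fr w) (sym (∩-skip (seg v) U v Uv w)))
    (cong (_- G (R r)) (G-cong (cl-cong λ w → sym (∩-skip (seg v) U v Uv w)))) t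
  ... | true with fr v in fv
  ... | false = subst₂ _≤_
    (sumOver-ext gain λ w → sym (trans (cong (_∧ fr w) (∩-insert (seg v) U v Uv w)) (∩-skip (seg v ∩ᵇ U) fr v fv w)))
    (cong (_- G (R r)) (G-cong λ w → sym (trans (cl-cong (∩-insert (seg v) U v Uv) w) (cl-skip (seg v ∩ᵇ U) v fv w)))) t
  ... | true = subst₂ _≤_
    (sym (trans
      (sumOver-ext gain λ w → trans (cong (_∧ fr w) (∩-insert (seg v) U v Uv w)) (∩-insert (seg v ∩ᵇ U) fr v fv w))
      (sumOver-insert ((seg v ∩ᵇ U) ∩ᵇ fr) v gain (cong (λ x → (x ∧ U v) ∧ fr v) (irreflexive v)))))
    (cong (_- G (R r)) (G-cong λ w → sym (trans (cl-cong (∩-insert (seg v) U v Uv) w) (cl-insert (seg v ∩ᵇ U) v fv w))))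
    (lin₂ (combine (sumOver ((seg v ∩ᵇ U) ∩ᵇ fr) gain) (gain v) (G (cl (seg v ∩ᵇ U))) (G (cl (seg v ∩ᵇ U) ∪ᵇ R v)) (G (R r)))
      t
      (diminishing (cl-ideal (seg v ∩ᵇ U)) (cl-ideal (seg v)) (cl-mono {seg v ∩ᵇ U} {seg v} λ w → ∧-trueˡ) (free-below fv)))
    where
    combine : ∀ s γ x y z → (y - z) - (s + γ) ≡ ((x - z) - s) + ((y - x) - γ)
    combine = solve-∀

  all-bounded : ∀ U → sumOver (U ∩ᵇ fr) gain ≤ G (cl U) - G (R r)
  all-bounded U = sweep _≺_ irreflexive ≺-trans total (Bounds U) (bounds-cong U)
    (subst₂ _≤_ (sym (sumOver-empty gain)) (sym (ℤ.i≡j⇒i-j≡0 G-empty)) ℤ.≤-refl) (bounds-next U)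

  root-free-disjoint : ∀ D w → (R r ∩ᵇ (D ∩ᵇ fr)) w ≡ false
  root-free-disjoint D w = ≢true λ e →
    true≢false (∧-trueˡ {R r w} e) (not-true (∧-trueˡ {not (R r w)} (∧-trueʳ {D w} (∧-trueʳ {R r w} e))))

  weight-root : ∀ D → weight C (R r ∪ᵇ (D ∩ᵇ fr)) ≡ weight C (R r) + weight C (D ∩ᵇ fr)
  weight-root D = begin
    weight C (R r ∪ᵇ (D ∩ᵇ fr))
      ≡⟨ sym (ℤ.+-identityʳ _) ⟩
    weight C (R r ∪ᵇ (D ∩ᵇ fr)) + 0ℤ
      ≡⟨ cong (ℤ._+_ (weight C (R r ∪ᵇ (D ∩ᵇ fr))))
           (sym (trans (sumOver-ext (λ _ → C) (root-free-disjoint D)) (sumOver-empty {n} (λ _ → C)))) ⟩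
    weight C (R r ∪ᵇ (D ∩ᵇ fr)) + weight C (R r ∩ᵇ (D ∩ᵇ fr))
      ≡⟨ weight-modular C (R r) (D ∩ᵇ fr) ⟩
    weight C (R r) + weight C (D ∩ᵇ fr) ∎
    where open ≡-Reasoning

  ideal-split : ∀ {U} → IsIdeal U → U r ≡ true → ∀ w → (R r ∪ᵇ (U ∩ᵇ fr)) w ≡ U w
  ideal-split {U} IU Ur w = bool-ext
    (λ e → [ closed IU Ur , ∧-trueˡ ]′ (∨-elim e))
    λ Uw → split Uw
    where
    split : U w ≡ true → (R r ∪ᵇ (U ∩ᵇ fr)) w ≡ true
    split Uw with R r w in e
    ... | true  = refl
    ... | false = ∧-intro Uw (not-false (ideal-below IU Uw))

  weight-ideal : ∀ {U} → IsIdeal U → U r ≡ true → weight C U ≡ weight C (R r) + weight C (U ∩ᵇ fr)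
  weight-ideal {U} IU Ur = trans (sumOver-ext (λ _ → C) λ w → sym (ideal-split IU Ur w)) (weight-root U)

  base-bounded : ∀ {U} → IsIdeal U → U r ≡ true → sumOver U base ≤ g U - g (R r)
  base-bounded {U} IU Ur = subst (_≤ g U - g (R r)) (sym (base-split U))
    (lin₂ (combine (sumOver (U ∩ᵇ fr) gain) (weight C (U ∩ᵇ fr)) (g U) (g (R r)) (weight C U) (weight C (R r)))
      (subst (λ x → sumOver (U ∩ᵇ fr) gain ≤ x - G (R r)) (G-cong (cl-ideal-fixed IU Ur)) (all-bounded U))
      (ℤ.≤-reflexive (weight-ideal IU Ur)))
    where
    combine : ∀ s w gu gr wu wr → (gu - gr) - (s - w) ≡ (((gu + wu) - (gr + wr)) - s) + ((wr + w) - wu)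
    combine = solve-∀

  base-total : sumOver (largest a b R) base ≡ g (largest a b R) - g (R r)
  base-total = begin
    sumOver T base
      ≡⟨ base-split T ⟩
    sumOver (T ∩ᵇ fr) gain - weight C (T ∩ᵇ fr)
      ≡⟨ cong (_- weight C (T ∩ᵇ fr)) (trans (sumOver-ext gain T-free) all-telescope) ⟩
    G (cl (λ _ → true)) - G (R r) - weight C (T ∩ᵇ fr)
      ≡⟨ cong (λ x → x - G (R r) - weight C (T ∩ᵇ fr)) (G-cong cl-all) ⟩
    G T - G (R r) - weight C (T ∩ᵇ fr)
      ≡⟨ cong (λ x → g T + x - G (R r) - weight C (T ∩ᵇ fr)) (weight-ideal largest-ideal (not-false ¬rb)) ⟩
    g T + (weight C (R r) + weight C (T ∩ᵇ fr)) - G (R r) - weight C (T ∩ᵇ fr)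
      ≡⟨ cancel (g T) (g (R r)) (weight C (R r)) (weight C (T ∩ᵇ fr)) ⟩
    g T - g (R r) ∎
    where
    open ≡-Reasoning
    T : Sub n
    T = largest a b R
    T-free : ∀ w → (T ∩ᵇ fr) w ≡ ((λ _ → true) ∩ᵇ fr) w
    T-free w = bool-ext (∧-trueʳ {T w}) λ fw → ∧-intro (not-false (free-below fw)) fw
    cl-all : ∀ w → cl (λ _ → true) w ≡ T w
    cl-all w = trans
      (bool-ext
        (λ e → [ cl-root T w
               , (λ { (x , _ , fx , xw) → cl-member T x w (not-false (free-below fx)) fx xw }) ]′ (cl-elim (λ _ → true) w e))
        (cl-mono {T} (λ _ _ → refl) w))
      (cl-ideal-fixed largest-ideal (not-false ¬rb) w)
    cancel : ∀ gt gr wr w → gt + (wr + w) - (gr + wr) - w ≡ gt - gr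
    cancel = solve-∀

  base-initial : ∀ {m} → (∀ {X} → IsIdeal X → X r ≡ true → m ≤ g X - g (R r)) →
    ∀ D → Telescopes D → m ≤ sumOver D base
  base-initial {m} low D t = subst (m ≤_) (sym (trans (base-split D) (cong (_- weight C (D ∩ᵇ fr)) t)))
    (lin₂ (combine m (g (cl D)) (g (R r)) (weight C (cl D)) (weight C (R r)) (weight C (D ∩ᵇ fr)))
      (low (cl-ideal D) (cl-root D r (reflexive r)))
      (subst (_≤ weight C (cl D)) (weight-root D) (weight-mono C-nonneg within)))
    where
    combine : ∀ m gd gr wd wr w → ((gd + wd) - (gr + wr) - w) - m ≡ ((gd - gr) - m) + (wd - (wr + w))
    combine = solve-∀
    within : (R r ∪ᵇ (D ∩ᵇ fr)) ⊆ᵇ cl D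
    within w e = [ cl-root D w , (λ p → cl-member D w w (∧-trueˡ p) (∧-trueʳ {D w} p) (reflexive w)) ]′ (∨-elim e)

  module _ {m Q : ℤ} (low : ∀ {X} → IsIdeal X → X r ≡ true → m ≤ g X - g (R r))
    (z : Fin n → ℤ) (antitone : ∀ x v → x ≺ v ≡ true → z v ≤ z x)
    (z-nonneg : ∀ v → 0ℤ ≤ z v) (z≤Q : ∀ v → z v ≤ Q) where

    -- The Lovász extension, evaluated one level at a time.
    Layered : Sub n → Set
    Layered D = Telescopes D × (∀ ζ → (∀ v → D v ≡ true → ζ ≤ z v) → ζ ≤ Q →
      (Q - ζ) * m ≤ sumOver D (λ v → base v * (z v - ζ)))

    low-nonpos : m ≤ 0ℤ
    low-nonpos = subst (m ≤_) (ℤ.i≡j⇒i-j≡0 {g (R r)} refl) (low (down-ideal ¬rb) (reflexive r))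

    layered-empty : Layered (λ _ → false)
    layered-empty = telescopes-empty , λ ζ _ ζ≤Q → subst ((Q - ζ) * m ≤_) (sym (sumOver-empty {n} (λ v → base v * (z v - ζ))))
      (lin₁ (combine (Q - ζ) m) (*-nonneg (ℤ.i≤j⇒0≤j-i ζ≤Q) (ℤ.i≤j⇒0≤j-i low-nonpos)))
      where
      combine : ∀ q m → 0ℤ - q * m ≡ q * (0ℤ - m) - 0ℤ
      combine = solve-∀

    layered-next : ∀ v → Layered (seg v) → Layered (seg v ∪ᵇ singleton v)
    layered-next v (t , layers) = t′ , layers′
      where
      D : Sub n
      D = seg v ∪ᵇ singleton v
      t′ : Telescopes D
      t′ = telescopes-next v t
      ¬segv : seg v v ≡ false
      ¬segv = irreflexive v
      layers′ : ∀ ζ → (∀ w → D w ≡ true → ζ ≤ z w) → ζ ≤ Q →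
        (Q - ζ) * m ≤ sumOver D (λ w → base w * (z w - ζ))
      layers′ ζ ζ≤ ζ≤Q = subst ((Q - ζ) * m ≤_) (sym shift)
        (lin₂ (combine Q ζ (z v) m (sumOver (seg v) (λ w → base w * (z w - z v))) (sumOver D base))
          (layers (z v) (antitone′) (z≤Q v))
          (*-nonneg (ℤ.i≤j⇒0≤j-i (ζ≤ v (∨-introʳ {seg v v} (singleton-self v)))) (ℤ.i≤j⇒0≤j-i (base-initial low D t′))))
        where
        antitone′ : ∀ w → seg v w ≡ true → z v ≤ z w
        antitone′ w = antitone w v
        combine : ∀ Q ζ zv m s σ → (s + (zv - ζ) * σ) - (Q - ζ) * m ≡
          (s - (Q - zv) * m) + ((zv - ζ) * (σ - m) - 0ℤ)
        combine = solve-∀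
        expand : ∀ β zw zv ζ → β * (zw - ζ) ≡ β * (zw - zv) + (zv - ζ) * β
        expand = solve-∀
        shift : sumOver D (λ w → base w * (z w - ζ)) ≡
          sumOver (seg v) (λ w → base w * (z w - z v)) + (z v - ζ) * sumOver D base
        shift = begin
          sumOver D (λ w → base w * (z w - ζ))
            ≡⟨ sumOver-cong D (λ w _ → expand (base w) (z w) (z v) ζ) ⟩
          sumOver D (λ w → base w * (z w - z v) + (z v - ζ) * base w)
            ≡⟨ sumOver-+ D _ _ ⟩
          sumOver D (λ w → base w * (z w - z v)) + sumOver D (λ w → (z v - ζ) * base w)
            ≡⟨ cong₂ _+_
                 (trans (sumOver-insert (seg v) v (λ w → base w * (z w - z v)) ¬segv)
                   (trans (cong (ℤ._+_ (sumOver (seg v) (λ w → base w * (z w - z v)))) (vanish (base v) (z v))) (ℤ.+-identityʳ (sumOver (seg v) (λ w → base w * (z w - z v))))))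
                 (sumOver-* D (z v - ζ) base) ⟩
          sumOver (seg v) (λ w → base w * (z w - z v)) + (z v - ζ) * sumOver D base ∎
          where
          open ≡-Reasoning
          vanish : ∀ β zv → β * (zv - zv) ≡ 0ℤ
          vanish = solve-∀

    base-value : Q * m ≤ sum (λ v → base v * z v)
    base-value = subst₂ _≤_ (cong (_* m) (ℤ.+-identityʳ Q))
      (sum-cong-≗ λ v → cong (ℤ._*_ (base v)) (ℤ.+-identityʳ (z v)))
      (proj₂ (sweep _≺_ irreflexive ≺-trans total Layered
        (λ {D} {E} eq → λ { (t , l) → telescopes-cong eq t , λ ζ ζ≤ ζ≤Q →
          subst ((Q - ζ) * m ≤_) (sumOver-ext _ eq) (l ζ (λ v Dv → ζ≤ v (trans (sym (eq v)) Dv)) ζ≤Q) })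
        layered-empty layered-next) 0ℤ (λ v _ → z-nonneg v) 0≤Q)
      where
      0≤Q : 0ℤ ≤ Q
      0≤Q = ℤ.≤-trans (z-nonneg r) (z≤Q r)

  base-lower : ∀ v → - C ≤ base v
  base-lower v with fr v in fv
  ... | false = ℤ.neg-mono-≤ C-nonneg
  ... | true  = lin₁ (combine (G (cl (seg v))) (G (cl (seg v) ∪ᵇ R v)) C)
    (G-mono (cl-ideal (seg v)) (∪-ideal (cl-ideal (seg v)) (down-ideal (free-below fv))) λ _ → ∨-introˡ)
    where
    combine : ∀ x y c → (y - x - c) - - c ≡ y - x
    combine = solve-∀

  base-upper : ∀ v → base v ≤ + n * η + + n * C
  base-upper v with fr v in fv
  ... | false = ℤ.+-mono-≤ {0ℤ} {_} {0ℤ} (*-nonneg {+ n} (ℤ.+≤+ ℕ.z≤n) η-nonneg) (*-nonneg {+ n} (ℤ.+≤+ ℕ.z≤n) C-nonneg)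
  ... | true  = ℤ.≤-trans (ℤ.i-j≤i _ C ⦃ ℤ.nonNegative C-nonneg ⦄)
    (lin₃ (combine (g (cl (seg v))) (g (cl (seg v) ∪ᵇ R v)) (weight C (cl (seg v))) (weight C (cl (seg v) ∪ᵇ R v)) (+ n * η) (+ n * C))
      (rise-bound (cl-ideal (seg v)) (∪-ideal (cl-ideal (seg v)) (down-ideal (free-below fv))) λ _ → ∨-introˡ)
      (weight-bound {X = cl (seg v) ∪ᵇ R v} C-nonneg) (weight-nonneg {X = cl (seg v)} C-nonneg))
    where
    combine : ∀ gx gy wx wy e c → (e + c) - ((gy + wy) - (gx + wx)) ≡
      ((gx + e) - gy) + (c - wy) + (wx - 0ℤ)
    combine = solve-∀

  base-unfree : ∀ v → fr v ≡ false → base v ≡ 0ℤ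
  base-unfree v ¬fv rewrite ¬fv = refl

precedes : ∀ {n} → (Fin n → ℤ) → Fin n → Fin n → Bool
precedes S x v =
  if does (+ toℕ x + 1ℤ ℤ.≤? + toℕ v) then does (S x ℤ.≤? S v) else does (S x + 1ℤ ℤ.≤? S v)

+1≤⇒< : ∀ {i j} → i + 1ℤ ≤ j → i < j
+1≤⇒< {i} p = ℤ.suc[i]≤j⇒i<j (subst (_≤ _) (ℤ.+-comm i 1ℤ) p)

<⇒+1≤ : ∀ {i j} → i < j → i + 1ℤ ≤ j
<⇒+1≤ {i} p = subst (_≤ _) (ℤ.+-comm 1ℤ i) (ℤ.i<j⇒suc[i]≤j p)

module _ {n : ℕ} (S : Fin n → ℤ) where

  Lex : Fin n → Fin n → Set
  Lex x v = S x < S v ⊎ (S x ≡ S v × toℕ x ℕ.< toℕ v)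

  precedes⇒lex : ∀ x v → precedes S x v ≡ true → Lex x v
  precedes⇒lex x v e with does (+ toℕ x + 1ℤ ℤ.≤? + toℕ v) in lt
  ... | false = inj₁ (+1≤⇒< (from-does (S x + 1ℤ ℤ.≤? S v) e))
  ... | true with ℤ.<-cmp (S x) (S v)
  ... | tri< p _ _ = inj₁ p
  ... | tri≈ _ p _ = inj₂ (p , ℤ.drop‿+<+ (+1≤⇒< (from-does (+ toℕ x + 1ℤ ℤ.≤? + toℕ v) lt)))
  ... | tri> _ _ p = contradiction (from-does (S x ℤ.≤? S v) e) (ℤ.<⇒≱ p)

  lex⇒precedes : ∀ x v → Lex x v → precedes S x v ≡ true
  lex⇒precedes x v l with does (+ toℕ x + 1ℤ ℤ.≤? + toℕ v) in lt | l
  ... | true  | inj₁ p = to-does (S x ℤ.≤? S v) (ℤ.<⇒≤ p)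
  ... | true  | inj₂ (p , _) = to-does (S x ℤ.≤? S v) (ℤ.≤-reflexive p)
  ... | false | inj₁ p = to-does (S x + 1ℤ ℤ.≤? S v) (<⇒+1≤ p)
  ... | false | inj₂ (_ , q) =
    contradiction (<⇒+1≤ (ℤ.+<+ q)) (from-does-false (+ toℕ x + 1ℤ ℤ.≤? + toℕ v) lt)

  precedes-strictTotal : StrictTotal (precedes S)
  precedes-strictTotal = record
    { irreflexive = λ v → ≢true λ e → irr v (precedes⇒lex v v e)
    ; transitive  = λ {u} {v} {w} p q → lex⇒precedes u w (tr (precedes⇒lex u v p) (precedes⇒lex v w q))
    ; total       = tot
    }
    where
    irr : ∀ v → ¬ Lex v v
    irr v (inj₁ p)       = ℤ.<-irrefl refl p
    irr v (inj₂ (_ , q)) = ℕ.<-irrefl refl q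
    tr : ∀ {u v w} → Lex u v → Lex v w → Lex u w
    tr (inj₁ p)        (inj₁ q)        = inj₁ (ℤ.<-trans p q)
    tr {u} (inj₁ p)       (inj₂ (q , _))  = inj₁ (subst (S u <_) q p)
    tr {w = w} (inj₂ (p , _)) (inj₁ q)    = inj₁ (subst (_< S w) (sym p) q)
    tr (inj₂ (p , p′)) (inj₂ (q , q′)) = inj₂ (trans p q , ℕ.<-trans p′ q′)
    tot : ∀ u v → u ≡ v ⊎ (precedes S u v ≡ true ⊎ precedes S v u ≡ true)
    tot u v with ℤ.<-cmp (S u) (S v) | ℕ.<-cmp (toℕ u) (toℕ v)
    ... | tri< p _ _ | _          = inj₂ (inj₁ (lex⇒precedes u v (inj₁ p)))
    ... | tri> _ _ p | _          = inj₂ (inj₂ (lex⇒precedes v u (inj₁ p)))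
    ... | tri≈ _ p _ | tri< q _ _ = inj₂ (inj₁ (lex⇒precedes u v (inj₂ (p , q))))
    ... | tri≈ _ p _ | tri> _ _ q = inj₂ (inj₂ (lex⇒precedes v u (inj₂ (sym p , q))))
    ... | tri≈ _ _ _ | tri≈ _ q _ = inj₁ (Fin.toℕ-injective q)

  precedes⇒≤ : ∀ x v → precedes S x v ≡ true → S x ≤ S v
  precedes⇒≤ x v e with precedes⇒lex x v e
  ... | inj₁ p       = ℤ.<⇒≤ p
  ... | inj₂ (p , _) = ℤ.≤-reflexive p

-- The potential is ψ x = min {2 y x + y² : 0 ≤ y ≤ Q}, a concave function
-- whose derivative is twice the minimising y, which is clip x.
module Potential {Q : ℤ} (0≤Q : 0ℤ ≤ Q) where

  clip : ℤ → ℤ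
  clip x = 0ℤ ℤ.⊔ (Q ℤ.⊓ (- x))

  clip-nonneg : ∀ x → 0ℤ ≤ clip x
  clip-nonneg x = ℤ.i≤i⊔j 0ℤ _

  clip≤Q : ∀ x → clip x ≤ Q
  clip≤Q x = ℤ.⊔-lub 0≤Q (ℤ.i⊓j≤i Q (- x))

  clip-antitone : ∀ {x y} → x ≤ y → clip y ≤ clip x
  clip-antitone x≤y = ℤ.⊔-monoʳ-≤ 0ℤ (ℤ.⊓-monoʳ-≤ Q (ℤ.neg-mono-≤ x≤y))

  clip-optimal : ∀ x y → 0ℤ ≤ y → y ≤ Q → 0ℤ ≤ (clip x + x) * (y - clip x)
  clip-optimal x y 0≤y y≤Q with ℤ.≤-total Q (- x)
  ... | inj₁ Q≤-x
    rewrite ℤ.i≤j⇒i⊓j≡i Q≤-x | ℤ.i≤j⇒i⊔j≡j 0≤Q =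
    subst (0ℤ ≤_) (eq Q x y) (*-nonneg (ℤ.i≤j⇒0≤j-i Q≤-x) (ℤ.i≤j⇒0≤j-i y≤Q))
    where
    eq : ∀ Q x y → (- x - Q) * (Q - y) ≡ (Q + x) * (y - Q)
    eq = solve-∀
  ... | inj₂ -x≤Q rewrite ℤ.i≥j⇒i⊓j≡j -x≤Q with ℤ.≤-total 0ℤ (- x)
  ... | inj₁ 0≤-x rewrite ℤ.i≤j⇒i⊔j≡j 0≤-x = ℤ.≤-reflexive (eq x y)
    where
    eq : ∀ x y → 0ℤ ≡ (- x + x) * (y - - x)
    eq = solve-∀
  ... | inj₂ -x≤0 rewrite ℤ.i≥j⇒i⊔j≡i -x≤0 =
    subst (0ℤ ≤_) (eq x y) (*-nonneg (ℤ.i≤j⇒0≤j-i -x≤0) 0≤y)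
    where
    eq : ∀ x y → (0ℤ - - x) * y ≡ (0ℤ + x) * (y - 0ℤ)
    eq = solve-∀

  ψ : ℤ → ℤ
  ψ x = + 2 * clip x * x + clip x * clip x

  ψ-upper : ∀ x y → 0ℤ ≤ y → y ≤ Q → ψ x ≤ + 2 * y * x + y * y
  ψ-upper x y 0≤y y≤Q = lin₂ (eq (clip x) x y)
    (*-nonneg {+ 2} (ℤ.+≤+ ℕ.z≤n) (clip-optimal x y 0≤y y≤Q)) (square-nonneg (y - clip x))
    where
    eq : ∀ z x y → (+ 2 * y * x + y * y) - (+ 2 * z * x + z * z) ≡
      (+ 2 * ((z + x) * (y - z)) - 0ℤ) + ((y - z) * (y - z) - 0ℤ)
    eq = solve-∀

  ψ-step : ∀ x s → ψ x + + 2 * (s * clip x) ≤ ψ (x + s) + s * s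
  ψ-step x s = lin₂ (eq (clip x) (clip (x + s)) x s)
    (*-nonneg {+ 2} (ℤ.+≤+ ℕ.z≤n) (clip-optimal x (clip (x + s)) (clip-nonneg (x + s)) (clip≤Q (x + s))))
    (square-nonneg (clip (x + s) - clip x + s))
    where
    eq : ∀ z z′ x s → (+ 2 * z′ * (x + s) + z′ * z′ + s * s) - (+ 2 * z * x + z * z + + 2 * (s * z)) ≡
      (+ 2 * ((z + x) * (z′ - z)) - 0ℤ) + ((z′ - z + s) * (z′ - z + s) - 0ℤ)
    eq = solve-∀

  ψ-zero : ψ 0ℤ ≡ 0ℤ
  ψ-zero rewrite ℤ.i≥j⇒i⊓j≡j 0≤Q = refl

square-mono : ∀ {x d} → - d ≤ x → x ≤ d → x * x ≤ d * d
square-mono {x} {d} l u = lin₁ (eq d x) (*-nonneg (ℤ.i≤j⇒0≤j-i l) (ℤ.i≤j⇒0≤j-i u))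
  where
  eq : ∀ d x → d * d - x * x ≡ (x - - d) * (d - x) - 0ℤ
  eq = solve-∀

suc-* : ∀ t x → + suc t * x ≡ + t * x + x
suc-* t x = trans (ℤ.suc-* (+ t) x) (ℤ.+-comm x (+ t * x))

module Iteration {n : ℕ} {a b : Fin n} {R : Fin n → Sub n} (order : Order a b R)
  {g : Sub n → ℤ} (sub : SubmodularOn g) {η C : ℤ} (scaled : Scaled a b R g η C)
  {Q D : ℤ} (0≤Q : 0ℤ ≤ Q) (C≤D : C ≤ D) (rise≤D : + n * η + + n * C ≤ D) where

  open Family order
  open Potential 0≤Q

  baseAt : Fin n → (Fin n → ℤ) → Fin n → ℤ
  baseAt r S = greedyBase b R r g C (precedes S)

  -- S is the sum of t greedy bases for the root r.
  record Accumulated (r : Fin n) (t : ℕ) (S : Fin n → ℤ) : Set where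
    field
      sum-below : ∀ {U} → IsIdeal U → U r ≡ true → sumOver U S ≤ + t * (g U - g (R r))
      sum-total : sumOver (largest a b R) S ≡ + t * (g (largest a b R) - g (R r))
      potential : ∀ {m} → (∀ {X} → IsIdeal X → X r ≡ true → m ≤ g X - g (R r)) →
        + t * (+ 2 * (Q * m) - + n * (D * D)) ≤ sum (λ v → ψ (S v))
      unfree    : ∀ v → free b R r v ≡ false → S v ≡ 0ℤ
  open Accumulated

  accumulated-zero : ∀ r → Accumulated r 0 (λ _ → 0ℤ)
  accumulated-zero r = record
    { sum-below = λ {U} _ _ → ℤ.≤-reflexive (none U)
    ; sum-total = none (largest a b R)
    ; potential = λ _ → ℤ.≤-reflexive (sym (trans (sum-cong-≗ {n} λ v → ψ-zero) (sum-zero {n})))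
    ; unfree    = λ _ _ → refl
    }
    where
    none : ∀ U → sumOver U (λ _ → 0ℤ) ≡ 0ℤ
    none U = trans (sum-cong-≗ λ v → mask-zero (U v)) (sum-zero {n})

  accumulated-suc : ∀ {r t S} → R r b ≡ false → Accumulated r t S →
    Accumulated r (suc t) (λ v → S v + baseAt r S v)
  accumulated-suc {r} {t} {S} ¬rb A = record
    { sum-below = λ {U} I Ur → subst₂ _≤_ (sym (sumOver-+ U S base)) (sym (suc-* t (g U - g (R r))))
        (ℤ.+-mono-≤ (sum-below A I Ur) (base-bounded I Ur))
    ; sum-total = trans (sumOver-+ (largest a b R) S base)
        (trans (cong₂ _+_ (sum-total A) base-total) (sym (suc-* t _)))
    ; potential = λ {m} low →
        lin₃ (combine (+ t * (+ 2 * (Q * m) - + n * (D * D))) (Q * m) (+ n * (D * D)) _ (sum (λ v → ψ (S v)))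
               (sum (λ v → base v * clip (S v))) (sum (λ v → ψ (S v + base v)))
               (suc-* t (+ 2 * (Q * m) - + n * (D * D))))
          (potential A low) (advance m low) step
    ; unfree    = λ v e → cong₂ _+_ (unfree A v e) (base-unfree v e)
    }
    where
    open Greedy order sub scaled ¬rb (precedes-strictTotal S)
    base : Fin n → ℤ
    base = baseAt r S
    combine : ∀ p qm d p′ ψ₀ β ψ₁ → p′ ≡ p + (+ 2 * qm - d) →
      ψ₁ - p′ ≡ (ψ₀ - p) + ((+ 2 * β) - (+ 2 * qm)) + ((ψ₁ + d) - (ψ₀ + + 2 * β))
    combine p qm d _ ψ₀ β ψ₁ refl = eq p qm d ψ₀ β ψ₁
      where
      eq : ∀ p qm d ψ₀ β ψ₁ → ψ₁ - (p + (+ 2 * qm - d)) ≡ (ψ₀ - p) + ((+ 2 * β) - (+ 2 * qm)) + ((ψ₁ + d) - (ψ₀ + + 2 * β))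
      eq = solve-∀
    advance : ∀ m → (∀ {X} → IsIdeal X → X r ≡ true → m ≤ g X - g (R r)) →
      + 2 * (Q * m) ≤ + 2 * sum (λ v → base v * clip (S v))
    advance m low = ℤ.*-monoˡ-≤-nonNeg (+ 2) (base-value {m} {Q} low (λ v → clip (S v))
      (λ x v e → clip-antitone (precedes⇒≤ S x v e)) (λ v → clip-nonneg (S v)) (λ v → clip≤Q (S v)))
    step : sum (λ v → ψ (S v)) + + 2 * sum (λ v → base v * clip (S v))
      ≤ sum (λ v → ψ (S v + base v)) + + n * (D * D)
    step = subst₂ _≤_
      (trans (∑-distrib-+ {n} _ _) (cong (ℤ._+_ (sum (λ v → ψ (S v))))
        (sumOver-* (λ _ → true) (+ 2) (λ v → base v * clip (S v)))))
      (trans (∑-distrib-+ {n} _ _) (cong (ℤ._+_ (sum (λ v → ψ (S v + base v)))) (sum-const {n} (D * D))))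
      (sum-mono λ v → ℤ.≤-trans (ψ-step (S v) (base v))
        (ℤ.+-monoʳ-≤ (ψ (S v + base v)) (square-mono
          (ℤ.≤-trans (ℤ.neg-mono-≤ C≤D) (base-lower v)) (ℤ.≤-trans (base-upper v) rise≤D))))

  sumOver-lower : ∀ (U : Sub n) {S Γ} → 0ℤ ≤ Γ → (∀ v → - Γ ≤ S v) → - (+ n * Γ) ≤ sumOver U S
  sumOver-lower U {S} {Γ} 0≤Γ low = ℤ.≤-trans
    (subst (- (+ n * Γ) ≤_) flip (ℤ.neg-mono-≤ (weight-bound {X = U} 0≤Γ)))
    (sumOver-mono U λ v _ → low v)
    where
    flip : - weight Γ U ≡ sumOver U (λ _ → - Γ)
    flip = trans (sym (ℤ.-1*i≡-i (weight Γ U))) (trans (sym (sumOver-* U (- 1ℤ) (λ _ → Γ))) (sumOver-cong U λ _ _ → ℤ.-1*i≡-i Γ))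

  sumOver-upper : ∀ (U : Sub n) {S Γ} → 0ℤ ≤ Γ → (∀ v → S v ≤ Γ) → sumOver U S ≤ + n * Γ
  sumOver-upper U 0≤Γ up = ℤ.≤-trans (sumOver-mono U λ v _ → up v) (weight-bound {X = U} 0≤Γ)

  module Conclusions {N : ℕ} {Γ : ℤ} (0<Q : 0ℤ < Q)
    (precise : + N * (+ n * (D * D)) + + n * (Q * Q) ≤ + 2 * (Q * Γ)) where

    module _ {X* : Sub n} (X*-ideal : IsIdeal X*) (X*-minimal : ∀ {X} → IsIdeal X → g X* ≤ g X)
      {r : Fin n} (X*r : X* r ≡ true) {S : Fin n → ℤ} (A : Accumulated r N S) where

      private
        m : ℤ
        m = g X* - g (R r)

      dual-gap : ∀ Y → + N * (+ 2 * (Q * m) - + n * (D * D)) ≤ + 2 * (Q * sumOver Y S) + + n * (Q * Q)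
      dual-gap Y = ℤ.≤-trans (potential A λ IX _ → ℤ.+-monoˡ-≤ (- g (R r)) (X*-minimal IX))
        (ℤ.≤-trans (sum-mono {k = λ v → + 2 * (Q * mask (Y v) (S v)) + Q * Q} pointwise) (ℤ.≤-reflexive total))
        where
        pointwise : ∀ v → ψ (S v) ≤ + 2 * (Q * mask (Y v) (S v)) + Q * Q
        pointwise v with Y v
        ... | true  = subst (ψ (S v) ≤_) (eq Q (S v)) (ψ-upper (S v) Q 0≤Q ℤ.≤-refl)
          where
          eq : ∀ Q x → + 2 * Q * x + Q * Q ≡ + 2 * (Q * x) + Q * Q
          eq = solve-∀
        ... | false = ℤ.≤-trans (ψ-upper (S v) 0ℤ ℤ.≤-refl 0≤Q) (lin₁ (eq Q (S v)) (square-nonneg Q))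
          where
          eq : ∀ Q x → (+ 2 * (Q * 0ℤ) + Q * Q) - (+ 2 * 0ℤ * x + 0ℤ * 0ℤ) ≡ Q * Q - 0ℤ
          eq = solve-∀
        total : sum (λ v → + 2 * (Q * mask (Y v) (S v)) + Q * Q) ≡ + 2 * (Q * sumOver Y S) + + n * (Q * Q)
        total = trans (∑-distrib-+ {n} _ _) (cong₂ _+_
          (trans (sumOver-* (λ _ → true) (+ 2) (λ v → Q * mask (Y v) (S v)))
            (cong (ℤ._*_ (+ 2)) (sumOver-* (λ _ → true) Q (λ v → mask (Y v) (S v)))))
          (sum-const {n} (Q * Q)))

      private
        cancel : ∀ {x y} → + 2 * (Q * x) ≤ + 2 * (Q * y) → x ≤ y
        cancel {x} {y} p = ℤ.*-cancelˡ-≤-pos x y Q ⦃ ℤ.positive 0<Q ⦄ (ℤ.*-cancelˡ-≤-pos _ _ (+ 2) p)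

      outside-lower : ∀ w → X* w ≡ false → - Γ ≤ S w
      outside-lower w ¬X*w = cancel (lin₃
        (combine (+ N) (+ n) D Q Γ m (sumOver X* S) (S w))
        precise
        (subst (λ x → + N * (+ 2 * (Q * m) - + n * (D * D)) ≤ + 2 * (Q * x) + + n * (Q * Q))
          (sumOver-insert X* w S ¬X*w) (dual-gap (X* ∪ᵇ singleton w)))
        (scale-2Q (sum-below A X*-ideal X*r)))
        where
        scale-2Q : ∀ {x y} → x ≤ y → + 2 * (Q * x) ≤ + 2 * (Q * y)
        scale-2Q p = ℤ.*-monoˡ-≤-nonNeg (+ 2) (ℤ.*-monoˡ-≤-nonNeg Q ⦃ ℤ.nonNegative 0≤Q ⦄ p)
        combine : ∀ N n D Q Γ m s w → + 2 * (Q * w) - + 2 * (Q * - Γ) ≡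
          (+ 2 * (Q * Γ) - (N * (n * (D * D)) + n * (Q * Q)))
          + (+ 2 * (Q * (s + w)) + n * (Q * Q) - N * (+ 2 * (Q * m) - n * (D * D)))
          + (+ 2 * (Q * (N * m)) - + 2 * (Q * s))
        combine = solve-∀

      inside-upper : ∀ w → X* w ≡ true → S w ≤ Γ
      inside-upper w X*w = cancel (lin₃
        (combine (+ N) (+ n) D Q Γ m (sumOver Y S) (S w))
        precise
        (dual-gap Y)
        (scale-2Q (subst (_≤ + N * m) split (sum-below A X*-ideal X*r))))
        where
        Y : Sub n
        Y v = X* v ∧ not (singleton w v)
        split : sumOver X* S ≡ sumOver Y S + S w
        split = trans (sumOver-ext S restore) (sumOver-insert Y w S
          (trans (cong (λ x → X* w ∧ not x) (singleton-self w)) (Bool.∧-zeroʳ _)))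
          where
          restore : ∀ v → X* v ≡ (Y ∪ᵇ singleton w) v
          restore v with singleton w v in e
          ... | false = sym (trans (Bool.∨-identityʳ _) (Bool.∧-identityʳ _))
          ... | true with refl ← singleton-≡ w v e = trans X*w (sym (Bool.∨-zeroʳ _))
        scale-2Q : ∀ {x y} → x ≤ y → + 2 * (Q * x) ≤ + 2 * (Q * y)
        scale-2Q p = ℤ.*-monoˡ-≤-nonNeg (+ 2) (ℤ.*-monoˡ-≤-nonNeg Q ⦃ ℤ.nonNegative 0≤Q ⦄ p)
        combine : ∀ N n D Q Γ m s w → + 2 * (Q * Γ) - + 2 * (Q * w) ≡
          (+ 2 * (Q * Γ) - (N * (n * (D * D)) + n * (Q * Q)))
          + (+ 2 * (Q * s) + n * (Q * Q) - N * (+ 2 * (Q * m) - n * (D * D)))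
          + (+ 2 * (Q * (N * m)) - + 2 * (Q * (s + w)))
        combine = solve-∀

  some-large : ∀ {N Γ u Sₐ Sᵤ} → 0ℤ ≤ Γ → + 3 * (+ n * Γ) < + N * η →
    live a b R u ≡ true → g (R u) - g (strictDown a b R u) ≡ η →
    Accumulated a N Sₐ → Accumulated u N Sᵤ →
    (∀ v → - Γ ≤ Sₐ v) → (∀ v → Sₐ v ≤ Γ) → (∀ v → - Γ ≤ Sᵤ v) → ⊥
  some-large {N} {Γ} {u} {Sₐ} {Sᵤ} 0≤Γ many lu attained Aₐ Aᵤ lowₐ highₐ lowᵤ =
    ℤ.<⇒≱ many (lin₃ (combine (+ N) (+ n) Γ (g (R u)) (g (strictDown a b R u)) η (g (R a)) (g (largest a b R)) attained)
      (ℤ.≤-trans (sumOver-lower (strictDown a b R u) 0≤Γ lowₐ)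
        (sum-below Aₐ (strictDown-ideal lu) (has (strictDown-ideal lu))))
      (subst (_≤ + n * Γ) (sum-total Aₐ) (sumOver-upper (largest a b R) 0≤Γ highₐ))
      (subst (- (+ n * Γ) ≤_) (sum-total Aᵤ) (sumOver-lower (largest a b R) 0≤Γ lowᵤ)))
    where
    combine : ∀ N n Γ gu gs e ga gt → gu - gs ≡ e → + 3 * (n * Γ) - N * e ≡
      (N * (gs - ga) - - (n * Γ)) + (n * Γ - N * (gt - ga)) + (N * (gt - gu) - - (n * Γ))
    combine N n Γ gu gs _ ga gt refl = eq N n Γ gu gs ga gt
      where
      eq : ∀ N n Γ gu gs ga gt → + 3 * (n * Γ) - N * (gu - gs) ≡
        (N * (gs - ga) - - (n * Γ)) + (n * Γ - N * (gt - ga)) + (N * (gt - gu) - - (n * Γ))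
      eq = solve-∀

tabulate-∪ : ∀ {n} (X Y : Sub n) → tabulate X ∪ tabulate Y ≡ tabulate (X ∪ᵇ Y)
tabulate-∪ {zero}  X Y = refl
tabulate-∪ {suc n} X Y = cong ((X zero ∨ Y zero) ∷_) (tabulate-∪ (X ∘ suc) (Y ∘ suc))

tabulate-∩ : ∀ {n} (X Y : Sub n) → tabulate X ∩ tabulate Y ≡ tabulate (X ∩ᵇ Y)
tabulate-∩ {zero}  X Y = refl
tabulate-∩ {suc n} X Y = cong ((X zero ∧ Y zero) ∷_) (tabulate-∩ (X ∘ suc) (Y ∘ suc))

onSub : ∀ {n} {A : Set} → (Subset n → A) → Sub n → A
onSub f X = f (tabulate X)

submodularOn : ∀ {n} {f : Subset n → ℤ} → Submodular f → SubmodularOn (onSub f)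
submodularOn {f = f} sm = record
  { cong-g     = λ eq → cong f (tabulate-cong eq)
  ; submodular = λ X Y → subst₂ (λ x y → f x + f y ≤ f (tabulate X) + f (tabulate Y))
      (tabulate-∪ X Y) (tabulate-∩ X Y) (sm (tabulate X) (tabulate Y))
  }

argmin : ∀ {n} (f : Vec Bool n → ℤ) (P : Vec Bool n → Bool) →
  (∀ X → P X ≡ false) ⊎ ∃[ X ] P X ≡ true × (∀ Y → P Y ≡ true → f X ≤ f Y)
argmin {zero} f P with P [] in e
... | false = inj₁ λ { [] → e }
... | true  = inj₂ ([] , e , λ { [] _ → ℤ.≤-refl })
argmin {suc n} f P with argmin (f ∘ (false ∷_)) (P ∘ (false ∷_)) | argmin (f ∘ (true ∷_)) (P ∘ (true ∷_))
... | inj₁ p | inj₁ q = inj₁ λ { (false ∷ X) → p X ; (true ∷ X) → q X }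
... | inj₁ p | inj₂ (X , PX , min) = inj₂ (true ∷ X , PX ,
  λ { (false ∷ Y) PY → true≢false PY (p Y) ; (true ∷ Y) PY → min Y PY })
... | inj₂ (X , PX , min) | inj₁ q = inj₂ (false ∷ X , PX ,
  λ { (false ∷ Y) PY → min Y PY ; (true ∷ Y) PY → true≢false PY (q Y) })
... | inj₂ (X , PX , min) | inj₂ (X′ , PX′ , min′) with ℤ.≤-total (f (false ∷ X)) (f (true ∷ X′))
... | inj₁ le = inj₂ (false ∷ X , PX ,
  λ { (false ∷ Y) PY → min Y PY ; (true ∷ Y) PY → ℤ.≤-trans le (min′ Y PY) })
... | inj₂ le = inj₂ (true ∷ X′ , PX′ ,
  λ { (false ∷ Y) PY → ℤ.≤-trans le (min Y PY) ; (true ∷ Y) PY → min′ Y PY })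

Separates : ∀ {n} (a a′ c b : Fin n) → Sub n → Set
Separates a a′ c b X = X a ≡ true × X a′ ≡ true × X c ≡ false × X b ≡ false

module CrossingFamily {n : ℕ} {F : Pred (Subset n) 0ℓ} (crossing : Crossing F) where

  crossing-∪ : ∀ {X Y} a c → F (tabulate X) → F (tabulate Y) → X a ≡ true → Y a ≡ true →
    X c ≡ false → Y c ≡ false → F (tabulate (X ∪ᵇ Y)) × F (tabulate (X ∩ᵇ Y))
  crossing-∪ {X} {Y} a c FX FY Xa Ya ¬Xc ¬Yc =
    subst₂ (λ x y → F x × F y) (tabulate-∪ X Y) (tabulate-∩ X Y)
      (crossing (tabulate X) (tabulate Y) FX FY meet join)
    where
    meet : ¬ tabulate X ∩ tabulate Y ≡ _
    meet e = true≢false (∧-intro Xa Ya)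
      (trans (sym (lookup∘tabulate (X ∩ᵇ Y) a))
        (trans (cong (λ Z → lookup Z a) (trans (sym (tabulate-∩ X Y)) e)) (lookup-replicate a false)))
    join : ¬ tabulate X ∪ tabulate Y ≡ _
    join e = true≢false top (cong₂ _∨_ ¬Xc ¬Yc)
      where
      top : (X ∪ᵇ Y) c ≡ true
      top = trans (sym (lookup∘tabulate (X ∪ᵇ Y) c))
        (trans (cong (λ Z → lookup Z c) (trans (sym (tabulate-∪ X Y)) e)) (lookup-replicate c true))

  -- Y is the union over a′ ∈ Y of the intersections over b ∉ Y of the
  -- sets separating {a, a′} from {c, b}; all of these contain a and avoid c.
  module _ (Y : Sub n) {a c : Fin n} (Ya : Y a ≡ true) (¬Yc : Y c ≡ false)
    (separators : ∀ a′ b → Y a′ ≡ true → Y b ≡ false → ∃[ X ] F (tabulate X) × Separates a a′ c b X) where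

    intersect : ∀ a′ → Y a′ ≡ true → ∀ bs →
      ∃[ A ] F (tabulate A) × (A a ≡ true × A a′ ≡ true × A c ≡ false) ×
        (∀ {b} → b ∈ bs → Y b ≡ false → A b ≡ false)
    intersect a′ Ya′ [] with A , FA , Aa , Aa′ , ¬Ac , _ ← separators a′ c Ya′ ¬Yc =
      A , FA , (Aa , Aa′ , ¬Ac) , λ ()
    intersect a′ Ya′ (b ∷ bs) with A , FA , (Aa , Aa′ , ¬Ac) , avoid ← intersect a′ Ya′ bs | Y b in eb
    ... | true = A , FA , (Aa , Aa′ , ¬Ac) ,
      λ { (here refl) ¬Yb → true≢false eb ¬Yb ; (there b∈) ¬Yb → avoid b∈ ¬Yb }
    ... | false with X , FX , Xa , Xa′ , ¬Xc , ¬Xb ← separators a′ b Ya′ eb =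
      A ∩ᵇ X , proj₂ (crossing-∪ a c FA FX Aa Xa ¬Ac ¬Xc) ,
      (∧-intro Aa Xa , ∧-intro Aa′ Xa′ , cong (_∧ X c) ¬Ac) ,
      λ { (here refl) _ → trans (cong (A b ∧_) ¬Xb) (Bool.∧-zeroʳ _)
        ; (there {_} {xs} b∈) ¬Yb → cong (_∧ X _) (avoid b∈ ¬Yb) }

    unite : ∀ as → ∃[ B ] F (tabulate B) × (B a ≡ true × B c ≡ false × B ⊆ᵇ Y) ×
      (∀ {a′} → a′ ∈ as → Y a′ ≡ true → B a′ ≡ true)
    unite [] with A , FA , (Aa , _ , ¬Ac) , avoid ← intersect a Ya (allFin n) =
      A , FA , (Aa , ¬Ac , λ v Av → Bool.¬-not λ ¬Yv → true≢false Av (avoid (∈-allFin v) ¬Yv)) , λ ()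
    unite (a′ ∷ as) with B , FB , (Ba , ¬Bc , B⊆Y) , cover ← unite as | Y a′ in ea
    ... | false = B , FB , (Ba , ¬Bc , B⊆Y) ,
      λ { (here refl) Ya′ → true≢false Ya′ ea ; (there a∈) Ya′ → cover a∈ Ya′ }
    ... | true with A , FA , (Aa , Aa′ , ¬Ac) , avoid ← intersect a′ ea (allFin n) =
      B ∪ᵇ A , proj₁ (crossing-∪ a c FB FA Ba Aa ¬Bc ¬Ac) ,
      (∨-introˡ Ba , cong₂ _∨_ ¬Bc ¬Ac , λ v e → [ B⊆Y v
        , (λ Av → Bool.¬-not λ ¬Yv → true≢false Av (avoid (∈-allFin v) ¬Yv)) ]′ (∨-elim e)) ,
      λ { (here refl) _ → ∨-introʳ {B a′} Aa′ ; (there a∈) Ya′ → ∨-introˡ (cover a∈ Ya′) }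

    separable⇒member : F (tabulate Y)
    separable⇒member with B , FB , (_ , _ , B⊆Y) , cover ← unite (allFin n) =
      subst F (tabulate-cong λ v → bool-ext (B⊆Y v) (cover (∈-allFin v))) FB

intersecting⇒crossing : ∀ {n} {F : Pred (Subset n) 0ℓ} → Intersecting F ⊎ Crossing F → Crossing F
intersecting⇒crossing (inj₁ intersecting) X Y FX FY meet _ = intersecting X Y FX FY meet
intersecting⇒crossing (inj₂ crossing) = crossing

-- Refinement of the ring family by one implication

addArc : ∀ {n} → Fin n → Fin n → (Fin n → Sub n) → Fin n → Sub n
addArc p q R v w = R v w ∨ (R v p ∧ R q w)

pairs : ∀ {m n} → (Fin m → Sub n) → ℕ
pairs {zero}  R = 0
pairs {suc m} R = count (R zero) ℕ.+ pairs (R ∘ suc)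

pairs-mono : ∀ {m n} {R R′ : Fin m → Sub n} → (∀ v → R v ⊆ᵇ R′ v) → pairs R ℕ.≤ pairs R′
pairs-mono {zero}  le = ℕ.z≤n
pairs-mono {suc m} le = ℕ.+-mono-≤ (count-mono (le zero)) (pairs-mono (le ∘ suc))

pairs-strict : ∀ {m n} {R R′ : Fin m → Sub n} → (∀ v → R v ⊆ᵇ R′ v) →
  ∀ p q → R p q ≡ false → R′ p q ≡ true → pairs R ℕ.< pairs R′
pairs-strict {suc m} le zero    q ¬pq pq = ℕ.+-mono-<-≤ (count-strict (le zero) q ¬pq pq) (pairs-mono (le ∘ suc))
pairs-strict {suc m} le (suc p) q ¬pq pq = ℕ.+-mono-≤-< (count-mono (le zero)) (pairs-strict (le ∘ suc) p q ¬pq pq)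

pairs-bound : ∀ {m n} (R : Fin m → Sub n) → pairs R ℕ.≤ m ℕ.* n
pairs-bound {zero}  R = ℕ.z≤n
pairs-bound {suc m} R = ℕ.+-mono-≤ (count≤n (R zero)) (pairs-bound (R ∘ suc))

-- X* is a fixed minimiser of the original problem; every refinement of
-- the family keeps it.
record Refinement {n : ℕ} (a b : Fin n) (g : Sub n → ℤ) (X* : Sub n) (R : Fin n → Sub n) : Set where
  field
    order     : Order a b R
    X*-ideal  : Ideal a b R X*
    X*-least  : ∀ {X} → Ideal a b R X → g X* ≤ g X

module _ {n : ℕ} {a b : Fin n} {g : Sub n → ℤ} {X* : Sub n} {R : Fin n → Sub n}
  (refinement : Refinement a b g X* R) where

  open Refinement refinement
  open Order order
  open Family order

  addArc-refinement : ∀ {p q} → (X* p ≡ true → X* q ≡ true) → Refinement a b g X* (addArc p q R)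
  addArc-refinement {p} {q} valid = record
    { order = record
      { reflexive  = λ v → ∨-introˡ (reflexive v)
      ; transitive = tr
      ; bottom     = λ v → ∨-introˡ (bottom v)
      ; top        = λ v → ∨-introˡ (top v)
      ; proper     = ≢true λ e → true≢false (kept (has X*-ideal) e) (avoids X*-ideal)
      }
    ; X*-ideal = record { closed = kept ; has = has X*-ideal ; avoids = avoids X*-ideal }
    ; X*-least = λ I → X*-least (record { closed = λ Xv vw → closed I Xv (∨-introˡ vw) ; has = has I ; avoids = avoids I })
    }
    where
    kept : ∀ {v w} → X* v ≡ true → addArc p q R v w ≡ true → X* w ≡ true
    kept {v} X*v e = [ closed X*-ideal X*v
      , (λ e′ → closed X*-ideal (valid (closed X*-ideal X*v (∧-trueˡ e′))) (∧-trueʳ {R v p} e′)) ]′ (∨-elim e)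
    tr : ∀ {u v w} → addArc p q R u v ≡ true → addArc p q R v w ≡ true → addArc p q R u w ≡ true
    tr {u} {v} {w} e₁ e₂ with ∨-elim {R u v} e₁ | ∨-elim {R v w} e₂
    ... | inj₁ uv | inj₁ vw = ∨-introˡ (transitive uv vw)
    ... | inj₁ uv | inj₂ e  = ∨-introʳ {R u w} (∧-intro (transitive uv (∧-trueˡ e)) (∧-trueʳ {R v p} e))
    ... | inj₂ e  | inj₁ vw = ∨-introʳ {R u w} (∧-intro (∧-trueˡ e) (transitive (∧-trueʳ {R u p} e) vw))
    ... | inj₂ e  | inj₂ e′ = ∨-introʳ {R u w} (∧-intro (∧-trueˡ e) (∧-trueʳ {R v p} e′))

  addArc-grows : ∀ {p q} → R p q ≡ false → pairs R ℕ.< pairs (addArc p q R)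
  addArc-grows {p} {q} ¬pq = pairs-strict {R = R} {R′ = addArc p q R} (λ v w e → ∨-introˡ e) p q ¬pq
    (∨-introʳ {R p q} (∧-intro (reflexive p) (reflexive q)))

  addArc-idle : ∀ {p q} → R p q ≡ true → ∀ v w → addArc p q R v w ≡ R v w
  addArc-idle {p} {q} pq v w = bool-ext
    (λ e → [ (λ vw → vw) , (λ e′ → transitive (transitive (∧-trueˡ e′) pq) (∧-trueʳ {R v p} e′)) ]′ (∨-elim e))
    ∨-introˡ

  module _ (sub : SubmodularOn g) where

    largest-minimal : (∀ v → live a b R v ≡ true → g (R v) - g (strictDown a b R v) ≤ 0ℤ) →
      g (largest a b R) ≤ g X*
    largest-minimal descent = subst₂ _≤_
      (trans (cong (ℤ._+_ (g (largest a b R))) (none X*)) (ℤ.+-identityʳ _))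
      (trans (cong (ℤ._+_ (g X*)) (none (largest a b R))) (ℤ.+-identityʳ _))
      (rise X*-ideal largest-ideal λ v X*v → not-false (ideal-below X*-ideal X*v))
      where
      open Bounded sub ℤ.≤-refl descent
      none : ∀ X → weight 0ℤ X ≡ 0ℤ
      none X = trans (sum-cong-≗ λ v → mask-zero (X v)) (sum-zero {n})

    module _ {η : ℤ} (0≤η : 0ℤ ≤ η)
      (up : ∀ v → live a b R v ≡ true → g (R v) - g (strictDown a b R v) ≤ η) where

      open Bounded sub 0≤η up

      steep⇒member : ∀ {C v} → + n * η ≤ C → live a b R v ≡ true →
        g (largestWithout a b R v ∪ᵇ R v) + C < g (largestWithout a b R v) → X* v ≡ true
      steep⇒member {C} {v} nη≤C lv steep = Bool.¬-not λ ¬X*v → ℤ.<⇒≱ steep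
        (ℤ.≤-trans
          (rise-bound X*-ideal (largestWithout-ideal lv) λ w X*w → ∧-intro
            (not-false (ideal-below X*-ideal X*w))
            (not-false (≢true λ wv → true≢false (closed X*-ideal X*w wv) ¬X*v)))
          (ℤ.+-mono-≤ (X*-least (∪-ideal (largestWithout-ideal lv) (down-ideal (live-below lv)))) nη≤C))

-- Array 9 holds the truth table of conjunction, so Boolean combinations
-- of matrix entries are expressions; array 8 holds the identity matrix
-- and array 1 the preorder R.

neg : Expr → Expr
neg e = lit 1ℤ ⊖ e

and or : Expr → Expr → Expr
and d e = arr 9 d e
or d e  = d ⊕ e ⊖ and d e

rel idn : ℕ → ℕ → Expr
rel i j = arr 1 (reg i) (reg j)
idn i j = arr 8 (reg i) (reg j)

entry : ℕ → ℕ → Expr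
entry A i = arr A (lit 0ℤ) (reg i)

fill fill₂ : ℕ → Expr → Prog
fill A e  = loop 18 0 (put A (lit 0ℤ) (reg 18) e)
fill₂ A e = loop 19 0 (loop 18 0 (put A (reg 19) (reg 18) e))

nest : ℕ → ℕ → Prog → Prog
nest i zero    p = p
nest i (suc k) p = loop i 3 (nest (suc i) k p)

bit : Bool → ℤ
bit x = mask x 1ℤ

bit-positive : ∀ x → does (1ℤ ℤ.≤? bit x) ≡ x
bit-positive false = refl
bit-positive true  = refl

bit-nonzero : ∀ x → not (does (bit x ℤ.≟ 0ℤ)) ≡ x
bit-nonzero false = refl
bit-nonzero true  = refl

column-≟ : ∀ {n} (v w : Fin n) → does (+ toℕ v ℤ.≟ + toℕ w) ≡ singleton v w
column-≟ v w = bool-ext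
  (λ e → to-does (v Fin.≟ w) (Fin.toℕ-injective (ℤ.+-injective (from-does (+ toℕ v ℤ.≟ + toℕ w) e))))
  (λ e → to-does (+ toℕ v ℤ.≟ + toℕ w) (cong (λ u → + toℕ u) (singleton-≡ v w e)))

<-suc-split : ∀ {n} {v w : Fin n} → toℕ w ℕ.< suc (toℕ v) → toℕ w ℕ.< toℕ v ⊎ v ≡ w
<-suc-split {v = v} {w} lt with ℕ.m≤n⇒m<n∨m≡n (ℕ.s≤s⁻¹ lt)
... | inj₁ p = inj₁ p
... | inj₂ e = inj₂ (Fin.toℕ-injective (sym e))

if-then : ∀ {A : Set} {x} {p q : A} → x ≡ true → (if x then p else q) ≡ p
if-then refl = refl

if-else : ∀ {A : Set} {x} {p q : A} → x ≡ false → (if x then p else q) ≡ q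
if-else refl = refl

module Specifications {n : ℕ} (f : Subset n → ℤ) {F : Pred (Subset n) 0ℓ} (F? : Decidable F) where

  open Semantics f F? public

  g : Sub n → ℤ
  g = onSub f

  Holds : State → ℕ → Fin n → Set
  Holds σ i v = regs σ i ≡ + toℕ v

  cell : State → ℕ → ℤ → Fin n → ℤ
  cell σ A k w = arrs σ A k (+ toℕ w)

  Row : State → ℕ → Sub n → Set
  Row σ A X = ∀ w → cell σ A 0ℤ w ≡ bit (X w)

  Matrix : State → ℕ → (Fin n → Sub n) → Set
  Matrix σ A R = ∀ v w → cell σ A (+ toℕ v) w ≡ bit (R v w)

  record Tables (σ : State) : Set where
    field
      conjunction : ∀ x y → arrs σ 9 (bit x) (bit y) ≡ bit (x ∧ y)
      identity    : Matrix σ 8 singleton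
  open Tables public

  tables-frame : ∀ {p σ τ} → stores 8 p ≡ false → stores 9 p ≡ false → Frame p σ τ → Tables σ → Tables τ
  tables-frame s₈ s₉ fr t = record
    { conjunction = λ x y → trans (onArr fr 9 s₉ _ _) (conjunction t x y)
    ; identity    = λ v w → trans (onArr fr 8 s₈ _ _) (identity t v w)
    }

  holds-frame : ∀ {p σ τ} i {v} → writes i p ≡ false → Frame p σ τ → Holds σ i v → Holds τ i v
  holds-frame i w fr h = trans (onReg fr i w) h

  row-frame : ∀ {p σ τ} A {X} → stores A p ≡ false → Frame p σ τ → Row σ A X → Row τ A X
  row-frame A s fr row w = trans (onArr fr A s _ _) (row w)

  matrix-frame : ∀ {p σ τ} A {R} → stores A p ≡ false → Frame p σ τ → Matrix σ A R → Matrix τ A R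
  matrix-frame A s fr m v w = trans (onArr fr A s _ _) (m v w)

  record IsBit (e : Expr) (σ : State) (x : Bool) : Set where
    constructor isBit
    field evaluates : eval e σ ≡ bit x
  open IsBit public

  neg-bit : ∀ {e σ x} → IsBit e σ x → IsBit (neg e) σ (not x)
  neg-bit {x = x} p = isBit (trans (cong (ℤ._-_ 1ℤ) (evaluates p)) (arith x))
    where
    arith : ∀ x → 1ℤ - bit x ≡ bit (not x)
    arith false = refl
    arith true  = refl

  and-bit : ∀ {d e σ x y} → Tables σ → IsBit d σ x → IsBit e σ y → IsBit (and d e) σ (x ∧ y)
  and-bit {σ = σ} {x} {y} t p q = isBit (trans (cong₂ (arrs σ 9) (evaluates p) (evaluates q)) (conjunction t x y))

  or-bit : ∀ {d e σ x y} → Tables σ → IsBit d σ x → IsBit e σ y → IsBit (or d e) σ (x ∨ y)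
  or-bit {x = x} {y} t p q =
    isBit (trans (cong₂ _-_ (cong₂ _+_ (evaluates p) (evaluates q)) (evaluates (and-bit t p q))) (arith x y))
    where
    arith : ∀ x y → bit x + bit y - bit (x ∧ y) ≡ bit (x ∨ y)
    arith false false = refl
    arith false true  = refl
    arith true  false = refl
    arith true  true  = refl

  matrix-bit : ∀ {σ A d e v w} R → Matrix σ A R → eval d σ ≡ + toℕ v → eval e σ ≡ + toℕ w →
    IsBit (arr A d e) σ (R v w)
  matrix-bit {σ} {A} {v = v} {w} R m p q = isBit (trans (cong₂ (arrs σ A) p q) (m v w))

  entry-cell : ∀ {σ A i w} → Holds σ i w → eval (entry A i) σ ≡ cell σ A 0ℤ w
  entry-cell {σ} {A} h = cong (arrs σ A 0ℤ) h

  branch-bit : ∀ e p q σ {x} → IsBit e σ x → ⟪ branch (lit 1ℤ) e p q ⟫ σ ≡ (if x then ⟪ p ⟫ σ else ⟪ q ⟫ σ)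
  branch-bit e p q σ {x} b =
    cong (λ y → if y then ⟪ p ⟫ σ else ⟪ q ⟫ σ) (trans (cong (λ z → does (1ℤ ℤ.≤? z)) (evaluates b)) (bit-positive x))

  branch-leq : ∀ d e p q σ {y z} → eval d σ ≡ y → eval e σ ≡ z →
    ⟪ branch d e p q ⟫ σ ≡ (if does (y ℤ.≤? z) then ⟪ p ⟫ σ else ⟪ q ⟫ σ)
  branch-leq d e p q σ refl refl = refl

  row-set : ∀ {σ A X} → Row σ A X → rowSet n A 0ℤ σ ≡ tabulate X
  row-set {X = X} row = tabulate-cong λ w →
    trans (cong (λ z → not (does (z ℤ.≟ 0ℤ))) (row w)) (bit-nonzero (X w))

  row-value : ∀ {σ A X} → Row σ A X → f (rowSet n A 0ℤ σ) ≡ g X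
  row-value {σ} {A} row = cong f (row-set {σ} {A} row)

  write-cell : ∀ A k v z σ w → cell (writeArr A k (+ toℕ v) z σ) A k w ≡
    (if singleton v w then z else cell σ A k w)
  write-cell A k v z σ w rewrite ≡ᵇ-refl A | to-does (k ℤ.≟ k) refl | column-≟ v w = refl

  write-hit : ∀ A k v z σ → cell (writeArr A k (+ toℕ v) z σ) A k v ≡ z
  write-hit A k v z σ = trans (write-cell A k v z σ v) (if-then (singleton-self v))

  write-miss : ∀ A k v z σ w → ¬ v ≡ w → cell (writeArr A k (+ toℕ v) z σ) A k w ≡ cell σ A k w
  write-miss A k v z σ w v≢w = trans (write-cell A k v z σ w) (if-else (to-does-false (v Fin.≟ w) v≢w))

  write-other-row : ∀ A k l j z σ w → ¬ k ≡ l → cell (writeArr A k j z σ) A l w ≡ cell σ A l w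
  write-other-row A k l j z σ w k≢l rewrite ≡ᵇ-refl A | to-does-false (k ℤ.≟ l) k≢l = refl

  fill-row : ∀ A d e σ k (h : Fin n → ℤ) →
    (∀ w τ → Frame (loop 18 0 (put A d (reg 18) e)) σ τ → Holds τ 18 w →
      cell τ A k w ≡ cell σ A k w → (∀ l → ¬ k ≡ l → ∀ w → cell τ A l w ≡ cell σ A l w) →
      eval d τ ≡ k × eval e τ ≡ h w) →
    (∀ w → cell (⟪ loop 18 0 (put A d (reg 18) e) ⟫ σ) A k w ≡ h w) ×
    (∀ l → ¬ k ≡ l → ∀ w → cell (⟪ loop 18 0 (put A d (reg 18) e) ⟫ σ) A l w ≡ cell σ A l w)
  fill-row A d e σ k h computes =
    let done , _ , other = loop-rule-Fin {18} {put A d (reg 18) e} {σ} Inv refl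
          ((λ w ()) , (λ w _ → refl) , λ l _ w → refl) next
    in (λ w → done w (Fin.toℕ<n w)) , other
    where
    Inv : ℕ → State → Set
    Inv j τ = (∀ w → toℕ w ℕ.< j → cell τ A k w ≡ h w) ×
              (∀ w → j ℕ.≤ toℕ w → cell τ A k w ≡ cell σ A k w) ×
              (∀ l → ¬ k ≡ l → ∀ w → cell τ A l w ≡ cell σ A l w)
    next : ∀ v τ z → Frame (loop 18 0 (put A d (reg 18) e)) σ τ → Holds τ 18 v → Inv (toℕ v) τ →
      Inv (suc (toℕ v)) (writeReg 18 z (⟪ put A d (reg 18) e ⟫ τ))
    next v τ z fr hv (done , todo , other)
      with ed , ee ← computes v τ fr hv (todo v ℕ.≤-refl) other
      rewrite ed | hv | ee =
      (λ w lt → [ (λ lt′ → trans (write-miss A k v (h v) τ w (λ { refl → ℕ.<-irrefl refl lt′ })) (done w lt′))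
                , (λ { refl → write-hit A k v (h v) τ }) ]′ (<-suc-split lt)) ,
      (λ w le → trans (write-miss A k v (h v) τ w (λ { refl → ℕ.<-irrefl refl le })) (todo w (ℕ.<⇒≤ le))) ,
      (λ l k≢l w → trans (write-other-row A k l (+ toℕ v) (h v) τ w k≢l) (other l k≢l w))

  fill-spec : ∀ A e σ (h : Fin n → ℤ) →
    (∀ w τ → Frame (fill A e) σ τ → Holds τ 18 w → cell τ A 0ℤ w ≡ cell σ A 0ℤ w → eval e τ ≡ h w) →
    ∀ w → cell (⟪ fill A e ⟫ σ) A 0ℤ w ≡ h w
  fill-spec A e σ h computes = proj₁ (fill-row A (lit 0ℤ) e σ 0ℤ h λ w τ fr hw same _ → refl , computes w τ fr hw same)

  fill₂-spec : ∀ A e σ (h : Fin n → Fin n → ℤ) →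
    (∀ v w τ → Frame (fill₂ A e) σ τ → Holds τ 19 v → Holds τ 18 w →
      cell τ A (+ toℕ v) w ≡ cell σ A (+ toℕ v) w → eval e τ ≡ h v w) →
    ∀ v w → cell (⟪ fill₂ A e ⟫ σ) A (+ toℕ v) w ≡ h v w
  fill₂-spec A e σ h computes =
    let done , _ = loop-rule-Fin {19} {row} {σ} Inv refl ((λ v ()) , λ v _ w → refl) next
    in λ v w → done v (Fin.toℕ<n v) w
    where
    row : Prog
    row = loop 18 0 (put A (reg 19) (reg 18) e)
    Inv : ℕ → State → Set
    Inv j τ = (∀ v → toℕ v ℕ.< j → ∀ w → cell τ A (+ toℕ v) w ≡ h v w) ×
              (∀ v → j ℕ.≤ toℕ v → ∀ w → cell τ A (+ toℕ v) w ≡ cell σ A (+ toℕ v) w)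
    chain : ∀ {τ₀ τ} → Frame (loop 19 0 row) σ τ₀ → Frame row τ₀ τ → Frame (loop 19 0 row) σ τ
    chain fr fr′ = frame
      (λ x s → trans (onReg fr′ x (∨-falseʳ {does (19 ℕ.≟ x)} s)) (onReg fr x s))
      (λ a s k l → trans (onArr fr′ a s k l) (onArr fr a s k l))
    next : ∀ v τ z → Frame (loop 19 0 row) σ τ → Holds τ 19 v → Inv (toℕ v) τ →
      Inv (suc (toℕ v)) (writeReg 19 z (⟪ row ⟫ τ))
    next v τ z fr hv (done , todo) =
      (λ u lt w → [ (λ lt′ → trans (other (+ toℕ u) (λ e → ℕ.<-irrefl (sym (ℤ.+-injective e)) lt′) w) (done u lt′ w))
                  , (λ { refl → filled w }) ]′ (<-suc-split lt)) ,
      (λ u le w → trans (other (+ toℕ u) (λ e → ℕ.<-irrefl (ℤ.+-injective e) le) w) (todo u (ℕ.<⇒≤ le) w))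
      where
      both = fill-row A (reg 19) e τ (+ toℕ v) (h v) λ w τ′ fr′ hw same _ →
        let hv′ = trans (onReg fr′ 19 refl) hv in
        hv′ , computes v w τ′ (chain fr fr′) hv′ hw (trans same (todo v ℕ.≤-refl w))
      filled = proj₁ both
      other = proj₂ both

  nest-spec : ∀ {p} (P : ℕ → State → Set) →
    (∀ j z t σ → P t σ → P t (writeReg (100 ℕ.+ j) z σ)) →
    (∀ t σ → P t σ → P (suc t) (⟪ p ⟫ σ)) →
    ∀ i k → wellFormed (nest (100 ℕ.+ i) k p) ≡ true → ∀ t σ → P t σ →
    P (t ℕ.+ (n ℕ.+ 3) ℕ.^ k) (⟪ nest (100 ℕ.+ i) k p ⟫ σ)
  nest-spec {p} P counter step i zero wf t σ Pσ =
    subst (λ s → P s (⟪ p ⟫ σ)) (ℕ.+-comm 1 t) (step t σ Pσ)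
  nest-spec {p} P counter step i (suc k) wf t σ Pσ =
    loop-rule {100 ℕ.+ i} {3} {nest (100 ℕ.+ suc i) k p} (λ j τ → P (t ℕ.+ j ℕ.* (n ℕ.+ 3) ℕ.^ k) τ)
      (not-true (∧-trueˡ wf))
      (counter i 0ℤ _ _ (subst (λ s → P s σ) (sym (ℕ.+-identityʳ t)) Pσ))
      λ j τ z _ _ _ Pτ → counter i z _ _
        (subst (λ s → P s (⟪ nest (100 ℕ.+ suc i) k p ⟫ τ)) (rearrange t j ((n ℕ.+ 3) ℕ.^ k))
          (nest-spec P counter step (suc i) k (∧-trueʳ {not (writes (100 ℕ.+ i) (nest (100 ℕ.+ suc i) k p))} wf) _ τ Pτ))
    where
    rearrange : ∀ t j m → t ℕ.+ j ℕ.* m ℕ.+ m ≡ t ℕ.+ suc j ℕ.* m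
    rearrange = solve-∀ℕ

-- Registers: 0 n; 1, 2 the elements a, a′ to be contained and 3, 4 the
-- elements c, b to be avoided; 10 η; 11 C; 12 Γ; 13, 14 the arc found;
-- 15 the root; 16 – 19 indices; 20 – 23 and 26 temporaries; 24 whether a
-- candidate has been recorded; 25 its value; from 100 on, counters.
-- Arrays: 0 the best candidate; 1 the preorder; 2 the accumulated greedy
-- bases; 3 the set being queried; 4 the current greedy base; 5 the next
-- preorder; 8, 9 the identity matrix and the conjunction table.

query : Expr → ℕ → Prog
query e x = fill 3 e ⨟ value x 3 (lit 0ℤ)

liveAt freeAt : ℕ → Expr
liveAt i = and (neg (rel 1 i)) (neg (rel i 4))
freeAt i = and (neg (rel 15 i)) (neg (rel i 4))

riseTest riseLive riseBody rises : Prog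
riseTest = branch (reg 10 ⊕ lit 1ℤ) (reg 20 ⊖ reg 21) (set 10 (reg 20 ⊖ reg 21)) nop
riseLive =
  query (rel 16 18) 20 ⨟
  query (and (rel 16 18) (neg (rel 18 16))) 21 ⨟
  riseTest
riseBody = branch (lit 1ℤ) (liveAt 16) riseLive nop
rises = set 10 (lit 0ℤ) ⨟ loop 16 0 riseBody

fallTest fallLive fallBody falls : Prog
fallTest = branch (reg 21 ⊕ reg 11 ⊕ lit 1ℤ) (reg 20) (set 13 (reg 1) ⨟ set 14 (reg 16)) nop
fallLive =
  query (and (neg (rel 18 4)) (neg (rel 18 16))) 20 ⨟
  query (or (entry 3 18) (rel 16 18)) 21 ⨟
  fallTest
fallBody = branch (lit 1ℤ) (liveAt 16) fallLive nop
falls = loop 16 0 fallBody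

flagTest prefixBody prefixSet countBody greedyStep greedy pass accumulate : Prog
flagTest = branch (reg 17 ⊕ lit 1ℤ) (reg 16)
  (branch (entry 2 17) (entry 2 16) (set 23 (lit 1ℤ)) (set 23 (lit 0ℤ)))
  (branch (entry 2 17 ⊕ lit 1ℤ) (entry 2 16) (set 23 (lit 1ℤ)) (set 23 (lit 0ℤ)))
prefixBody = flagTest ⨟
  branch (lit 1ℤ) (and (reg 23) (freeAt 17)) (fill 3 (or (entry 3 18) (rel 17 18))) nop
prefixSet = fill 3 (rel 15 18) ⨟ loop 17 0 prefixBody
countBody = branch (lit 1ℤ) (and (rel 16 18) (neg (entry 3 18))) (set 22 (reg 22 ⊕ reg 11)) nop
greedyStep =
  prefixSet ⨟
  value 20 3 (lit 0ℤ) ⨟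
  (set 22 (lit 0ℤ) ⨟ loop 18 0 countBody) ⨟
  query (or (entry 3 18) (rel 16 18)) 21 ⨟
  put 4 (lit 0ℤ) (reg 16) (reg 21 ⊕ reg 22 ⊖ reg 20 ⊖ reg 11)
greedy = branch (lit 1ℤ) (freeAt 16) greedyStep (put 4 (lit 0ℤ) (reg 16) (lit 0ℤ))
pass = loop 16 0 greedy ⨟ fill 2 (entry 2 18 ⊕ entry 4 18)
accumulate = fill 2 (lit 0ℤ) ⨟ nest 100 14 pass

scanBody scan searchBody search : Prog
scanBody =
  branch (entry 2 16 ⊕ reg 12 ⊕ lit 1ℤ) (lit 0ℤ) (set 13 (reg 15) ⨟ set 14 (reg 16)) nop ⨟
  branch (lit 1ℤ) (idn 1 15)
    (branch (reg 12 ⊕ lit 1ℤ) (entry 2 16) (set 13 (reg 16) ⨟ set 14 (reg 4)) nop)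
    nop
scan = loop 16 0 scanBody
searchBody = branch (lit 1ℤ) (neg (rel 15 4)) (accumulate ⨟ scan) nop
search = loop 15 0 searchBody

amplify : ℕ → ℕ → Prog
amplify x k = set x (lit 0ℤ) ⨟ nest 100 k (set x (reg x ⊕ reg 10))

aim findArc refine update phase initialise minimise : Prog
aim = set 13 (reg 1) ⨟ set 14 (reg 1)
findArc = falls ⨟ branch (lit 1ℤ) (rel 13 14) search nop
refine = branch (lit 1ℤ) (reg 10) findArc nop
update =
  fill₂ 5 (or (rel 19 18) (and (rel 19 13) (rel 14 18))) ⨟
  fill₂ 1 (arr 5 (reg 19) (reg 18))
phase = rises ⨟ amplify 11 1 ⨟ amplify 12 12 ⨟ aim ⨟ refine ⨟ update
initialise =
  fill₂ 1 (or (idn 19 18) (or (or (idn 19 4) (idn 19 3)) (or (idn 18 1) (idn 18 2))))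
minimise = initialise ⨟ nest 120 2 phase ⨟ fill 3 (neg (rel 18 4))

accept candidate separate tuples identityTable prelude algorithm : Prog
trial : Bool → Prog
accept = fill 0 (entry 3 18) ⨟ set 25 (reg 20) ⨟ set 24 (lit 1ℤ)
candidate =
  member 26 3 (lit 0ℤ) ⨟
  value 20 3 (lit 0ℤ) ⨟
  branch (lit 1ℤ) (reg 26) nop
    (branch (lit 1ℤ) (reg 24) (branch (reg 20 ⊕ lit 1ℤ) (reg 25) accept nop) accept)
separate =
  branch (lit 1ℤ) (or (or (idn 1 3) (idn 1 4)) (or (idn 2 3) (idn 2 4))) nop (minimise ⨟ candidate)
tuples = loop 1 0 (loop 2 0 (loop 3 0 (loop 4 0 separate)))
identityTable = loop 16 0 (put 8 (reg 16) (reg 16) (lit 1ℤ))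
prelude = put 9 (lit 1ℤ) (lit 1ℤ) (lit 1ℤ) ⨟ identityTable
trial y = fill 3 (lit (bit y)) ⨟ candidate
algorithm = prelude ⨟ trial false ⨟ trial true ⨟ tuples

algorithm-wellFormed : wellFormed algorithm ≡ true
algorithm-wellFormed = refl

algorithm-keeps-n : writes 0 algorithm ≡ false
algorithm-keeps-n = refl

touches : Prog → Bool
touches p = stores 1 p ∨ (stores 8 p ∨ (stores 9 p ∨ (writes 1 p ∨ writes 4 p)))

data Max (P : ℤ → Set) (M : ℤ) : Set where
  zero-max : M ≡ 0ℤ → Max P M
  attained : P M → Max P M

module Gaps {n : ℕ} (f : Subset n → ℤ) {F : Pred (Subset n) 0ℓ} (F? : Decidable F) (a b : Fin n) where

  open Specifications f F? public

  record Env (R : Fin n → Sub n) (σ : State) : Set where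
    field
      tables : Tables σ
      stored : Matrix σ 1 R
      at-a   : Holds σ 1 a
      at-b   : Holds σ 4 b
  open Env public

  env-frame : ∀ {p σ τ R} → touches p ≡ false → Frame p σ τ → Env R σ → Env R τ
  env-frame {p} {R = R} t fr e = record
    { tables = tables-frame (∨-falseˡ t₈) (∨-falseˡ t₉) fr (tables e)
    ; stored = matrix-frame 1 {R} (∨-falseˡ t) fr (stored e)
    ; at-a   = holds-frame 1 (∨-falseˡ t₁) fr (at-a e)
    ; at-b   = holds-frame 4 (∨-falseʳ {writes 1 p} t₁) fr (at-b e)
    }
    where
    t₈ = ∨-falseʳ {stores 1 p} t
    t₉ = ∨-falseʳ {stores 8 p} t₈
    t₁ = ∨-falseʳ {stores 9 p} t₉

  rel-bit : ∀ {R σ i j v w} → Env R σ → Holds σ i v → Holds σ j w → IsBit (rel i j) σ (R v w)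
  rel-bit {R} e = matrix-bit R (stored e)

  not-both-bit : ∀ {R σ i j k l u v w x} → Env R σ → Holds σ i u → Holds σ j v → Holds σ k w → Holds σ l x →
    IsBit (and (neg (rel i j)) (neg (rel k l))) σ (not (R u v) ∧ not (R w x))
  not-both-bit e hu hv hw hx = and-bit (tables e) (neg-bit (rel-bit e hu hv)) (neg-bit (rel-bit e hw hx))

  live-bit : ∀ {R σ i v} → Env R σ → Holds σ i v → IsBit (liveAt i) σ (live a b R v)
  live-bit e h = not-both-bit e (at-a e) h h (at-b e)

  query-spec : ∀ e x σ X →
    (∀ w τ → Frame (fill 3 e) σ τ → Holds τ 18 w → cell τ 3 0ℤ w ≡ cell σ 3 0ℤ w → IsBit e τ (X w)) →
    Row (⟪ query e x ⟫ σ) 3 X × regs (⟪ query e x ⟫ σ) x ≡ g X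
  query-spec e x σ X bits = row , trans (writeReg-same x _ (⟪ fill 3 e ⟫ σ)) (row-value {⟪ fill 3 e ⟫ σ} {3} {X} row)
    where
    row : Row (⟪ fill 3 e ⟫ σ) 3 X
    row = fill-spec 3 e σ (bit ∘ X) λ w τ fr hw same → evaluates (bits w τ fr hw same)

  module _ {R : Fin n → Sub n} where

    gap : Fin n → ℤ
    gap v = g (R v) - g (strictDown a b R v)

    riseBody-spec : ∀ v σ → Env R σ → Holds σ 16 v → regs (⟪ riseBody ⟫ σ) 10 ≡
      (if live a b R v then (if does (regs σ 10 + 1ℤ ℤ.≤? gap v) then gap v else regs σ 10) else regs σ 10)
    riseBody-spec v σ e h = trans (cong (λ s → regs s 10) (branch-bit (liveAt 16) riseLive nop σ (live-bit e h))) body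
      where
      σ₁ σ₂ : State
      σ₁ = ⟪ query (rel 16 18) 20 ⟫ σ
      σ₂ = ⟪ query (and (rel 16 18) (neg (rel 18 16))) 21 ⟫ σ₁
      first : regs σ₂ 20 ≡ g (R v)
      first = trans (regs-frame (query (and (rel 16 18) (neg (rel 18 16))) 21) σ₁ 20 refl)
        (proj₂ (query-spec (rel 16 18) 20 σ (R v) λ w τ fr hw _ →
          rel-bit (env-frame refl fr e) (holds-frame 16 refl fr h) hw))
      second : regs σ₂ 21 ≡ g (strictDown a b R v)
      second = proj₂ (query-spec (and (rel 16 18) (neg (rel 18 16))) 21 σ₁ (strictDown a b R v) λ w τ fr hw _ →
        let e′ = env-frame refl fr (env-frame refl (frame-run (query (rel 16 18) 20) σ) e)
            h′ = holds-frame 16 refl fr (holds-frame 16 refl (frame-run (query (rel 16 18) 20) σ) h)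
        in and-bit (tables e′)
             (rel-bit e′ h′ hw) (neg-bit (rel-bit e′ hw h′)))
      kept : regs σ₂ 10 ≡ regs σ 10
      kept = regs-frame (query (rel 16 18) 20 ⨟ query (and (rel 16 18) (neg (rel 18 16))) 21) σ 10 refl
      body : regs (if live a b R v then ⟪ riseTest ⟫ σ₂ else σ) 10 ≡
        (if live a b R v then (if does (regs σ 10 + 1ℤ ℤ.≤? gap v) then gap v else regs σ 10) else regs σ 10)
      body with live a b R v
      ... | false = refl
      ... | true = trans (cong (λ s → regs s 10) (branch-leq (reg 10 ⊕ lit 1ℤ) (reg 20 ⊖ reg 21) (set 10 (reg 20 ⊖ reg 21)) nop σ₂
              (cong (_+ 1ℤ) kept) (cong₂ _-_ first second))) last
        where
        last : regs (if does (regs σ 10 + 1ℤ ℤ.≤? gap v) then ⟪ set 10 (reg 20 ⊖ reg 21) ⟫ σ₂ else σ₂) 10 ≡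
          (if does (regs σ 10 + 1ℤ ℤ.≤? gap v) then gap v else regs σ 10)
        last with does (regs σ 10 + 1ℤ ℤ.≤? gap v)
        ... | true  = cong₂ _-_ first second
        ... | false = kept

    RisesTo : ℕ → ℤ → Set
    RisesTo k η = 0ℤ ≤ η × (∀ v → toℕ v ℕ.< k → live a b R v ≡ true → gap v ≤ η) ×
      Max (λ y → ∃[ u ] live a b R u ≡ true × gap u ≡ y) η

    rises-step : ∀ v η → RisesTo (toℕ v) η → RisesTo (suc (toℕ v))
      (if live a b R v then (if does (η + 1ℤ ℤ.≤? gap v) then gap v else η) else η)
    rises-step v η (0≤η , bound , max) with live a b R v in lv
    ... | false = 0≤η ,
      (λ w lt lw → [ (λ lt′ → bound w lt′ lw) , (λ { refl → true≢false lw lv }) ]′ (<-suc-split lt)) , max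
    ... | true with does (η + 1ℤ ℤ.≤? gap v) in le
    ... | true =
      let η≤gap = ℤ.<⇒≤ (+1≤⇒< (from-does (η + 1ℤ ℤ.≤? gap v) le)) in
      ℤ.≤-trans 0≤η η≤gap ,
      (λ w lt lw → [ (λ lt′ → ℤ.≤-trans (bound w lt′ lw) η≤gap) , (λ { refl → ℤ.≤-refl }) ]′ (<-suc-split lt)) ,
      attained (v , lv , refl)
    ... | false = 0≤η ,
      (λ w lt lw → [ (λ lt′ → bound w lt′ lw)
                   , (λ { refl → ℤ.≮⇒≥ (from-does-false (η + 1ℤ ℤ.≤? gap v) le ∘ <⇒+1≤) }) ]′ (<-suc-split lt)) , max

    rises-spec : ∀ σ → Env R σ → RisesTo n (regs (⟪ rises ⟫ σ) 10)
    rises-spec σ e = loop-rule-Fin {16} {riseBody} {σ′} (λ k τ → RisesTo k (regs τ 10)) refl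
      (ℤ.≤-refl , (λ v ()) , zero-max refl)
      λ v τ z fr h inv → subst (RisesTo (suc (toℕ v)))
        (sym (riseBody-spec v τ (env-frame {loop 16 0 riseBody} refl fr e′) h)) (rises-step v (regs τ 10) inv)
      where
      σ′ : State
      σ′ = ⟪ set 10 (lit 0ℤ) ⟫ σ
      e′ : Env R σ′
      e′ = env-frame {set 10 (lit 0ℤ)} refl (frame-run (set 10 (lit 0ℤ)) σ) e

module _ {n : ℕ} where

  below-suc : (v w : Fin n) → below (suc (toℕ v)) w ≡ (below (toℕ v) ∪ᵇ singleton v) w
  below-suc v w = bool-ext
    (λ e → [ (λ lt → ∨-introˡ (to-does (toℕ w ℕ.<? toℕ v) lt))
           , (λ { refl → ∨-introʳ {below (toℕ v) v} (singleton-self v) }) ]′ (<-suc-split (from-does (toℕ w ℕ.<? suc (toℕ v)) e)))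
    (λ e → to-does (toℕ w ℕ.<? suc (toℕ v))
      ([ (λ e′ → ℕ.m≤n⇒m≤1+n (from-does (toℕ w ℕ.<? toℕ v) e′))
       , (λ e′ → ℕ.s≤s (ℕ.≤-reflexive (cong toℕ (sym (singleton-≡ v w e′))))) ]′ (∨-elim e)))

  below-n : (w : Fin n) → below n w ≡ true
  below-n w = to-does (toℕ w ℕ.<? n) (Fin.toℕ<n w)

  below-self : (v : Fin n) → below (toℕ v) v ≡ false
  below-self v = to-does-false (toℕ v ℕ.<? toℕ v) (ℕ.<-irrefl refl)

  any-cong : ∀ {X Y : Sub n} → (∀ v → X v ≡ Y v) → any X ≡ any Y
  any-cong {X} {Y} eq = bool-ext
    (λ e → let v , p = any-elim X e in any-intro Y v (trans (sym (eq v)) p))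
    (λ e → let v , p = any-elim Y e in any-intro X v (trans (eq v) p))

  any-below-suc : ∀ (P : Sub n) v →
    any (λ x → below (suc (toℕ v)) x ∧ P x) ≡ any (λ x → below (toℕ v) x ∧ P x) ∨ P v
  any-below-suc P v = trans (any-cong λ x → cong (_∧ P x) (below-suc v x)) (bool-ext to from)
    where
    to : any (λ x → (below (toℕ v) x ∨ singleton v x) ∧ P x) ≡ true → any (λ x → below (toℕ v) x ∧ P x) ∨ P v ≡ true
    to e with x , p ← any-elim (λ x → (below (toℕ v) x ∨ singleton v x) ∧ P x) e
      with ∨-elim {below (toℕ v) x} (∧-trueˡ p)
    ... | inj₁ lt = ∨-introˡ (any-intro (λ x → below (toℕ v) x ∧ P x) x
      (∧-intro lt (∧-trueʳ {below (toℕ v) x ∨ singleton v x} p)))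
    ... | inj₂ vx with refl ← singleton-≡ v x vx =
      ∨-introʳ {any λ x → below (toℕ v) x ∧ P x} (∧-trueʳ {below (toℕ v) x ∨ singleton v x} p)
    from : any (λ x → below (toℕ v) x ∧ P x) ∨ P v ≡ true → any (λ x → (below (toℕ v) x ∨ singleton v x) ∧ P x) ≡ true
    from e with ∨-elim e
    ... | inj₁ e′ with x , p ← any-elim (λ x → below (toℕ v) x ∧ P x) e′ =
      any-intro (λ x → (below (toℕ v) x ∨ singleton v x) ∧ P x) x
        (∧-intro (∨-introˡ {below (toℕ v) x} (∧-trueˡ p)) (∧-trueʳ {below (toℕ v) x} p))
    ... | inj₂ Pv = any-intro (λ x → (below (toℕ v) x ∨ singleton v x) ∧ P x) v
      (∧-intro (∨-introʳ {below (toℕ v) v} (singleton-self v)) Pv)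

  any-below-zero : ∀ (P : Sub n) → any (λ x → below 0 x ∧ P x) ≡ false
  any-below-zero P = ≢true λ e → case proj₂ (any-elim (λ x → below 0 x ∧ P x) e) of λ ()

  any-below-n : ∀ (P : Sub n) → any (λ x → below n x ∧ P x) ≡ any P
  any-below-n P = any-cong λ x → cong (_∧ P x) (below-n x)

  weight-below-suc : ∀ c (E : Sub n) v →
    weight c (below (suc (toℕ v)) ∩ᵇ E) ≡ (if E v then weight c (below (toℕ v) ∩ᵇ E) + c else weight c (below (toℕ v) ∩ᵇ E))
  weight-below-suc c E v with E v in Ev
  ... | true = trans
    (sumOver-ext (λ _ → c) λ w → trans (cong (_∧ E w) (below-suc v w)) (∩-insert (below (toℕ v)) E v Ev w))
    (sumOver-insert (below (toℕ v) ∩ᵇ E) v (λ _ → c) (cong (_∧ E v) (below-self v)))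
  ... | false = sumOver-ext (λ _ → c) λ w →
    trans (cong (_∧ E w) (below-suc v w)) (∩-skip (below (toℕ v)) E v Ev w)

  weight-below-zero : ∀ c (E : Sub n) → weight c (below 0 ∩ᵇ E) ≡ 0ℤ
  weight-below-zero c E = trans (sumOver-ext (λ _ → c) λ w → cong (_∧ E w) (to-does-false (toℕ w ℕ.<? 0) (λ ())))
    (sumOver-empty {n} λ _ → c)

  weight-below-n : ∀ c (E : Sub n) → weight c (below n ∩ᵇ E) ≡ weight c E
  weight-below-n c E = sumOver-ext (λ _ → c) λ w → cong (_∧ E w) (below-n w)

  weight-∪ : ∀ c (X Y : Sub n) → weight c (X ∪ᵇ Y) ≡ weight c X + weight c (λ w → Y w ∧ not (X w))
  weight-∪ c X Y = begin
    weight c (X ∪ᵇ Y)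
      ≡⟨ sumOver-ext (λ _ → c) join ⟩
    weight c (X ∪ᵇ E)
      ≡⟨ sym (ℤ.+-identityʳ _) ⟩
    weight c (X ∪ᵇ E) + 0ℤ
      ≡⟨ cong (ℤ._+_ (weight c (X ∪ᵇ E))) (sym (trans (sumOver-ext (λ _ → c) meet) (sumOver-empty {n} λ _ → c))) ⟩
    weight c (X ∪ᵇ E) + weight c (X ∩ᵇ E)
      ≡⟨ weight-modular c X E ⟩
    weight c X + weight c E ∎
    where
    open ≡-Reasoning
    E : Sub n
    E w = Y w ∧ not (X w)
    join : ∀ w → (X ∪ᵇ Y) w ≡ (X ∪ᵇ E) w
    join w with X w
    ... | true  = refl
    ... | false = sym (Bool.∧-identityʳ _)
    meet : ∀ w → (X ∩ᵇ E) w ≡ false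
    meet w with X w
    ... | true  = Bool.∧-zeroʳ _
    ... | false = refl

module Verdicts {n : ℕ} (f : Subset n → ℤ) {F : Pred (Subset n) 0ℓ} (F? : Decidable F) (a b : Fin n) where

  open Gaps f F? a b public

  entry-bit : ∀ {σ A i w x} → Holds σ i w → cell σ A 0ℤ w ≡ bit x → IsBit (entry A i) σ x
  entry-bit {σ} {A} {i} h c = isBit (trans (entry-cell {σ} {A} {i} h) c)

  record Verdict (R : Fin n → Sub n) (X* : Sub n) (Clear : Set) (σ : State) : Set where
    constructor verdict
    field
      {source target} : Fin n
      at-source : Holds σ 13 source
      at-target : Holds σ 14 target
      outcome   : (R source target ≡ true × Clear) ⊎
                  (R source target ≡ false × (X* source ≡ true → X* target ≡ true))
  open Verdict public

  verdict-map : ∀ {R X* A B σ τ} → regs τ 13 ≡ regs σ 13 → regs τ 14 ≡ regs σ 14 → (A → B) →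
    Verdict R X* A σ → Verdict R X* B τ
  verdict-map e₁ e₂ h (verdict hp hq (inj₁ (old , clear))) = verdict (trans e₁ hp) (trans e₂ hq) (inj₁ (old , h clear))
  verdict-map e₁ e₂ h (verdict hp hq (inj₂ new)) = verdict (trans e₁ hp) (trans e₂ hq) (inj₂ new)

  module _ {R : Fin n → Sub n} where

    module _ {C : ℤ} where

      steep : Fin n → Bool
      steep v = live a b R v ∧
        does (g (largestWithout a b R v ∪ᵇ R v) + C + 1ℤ ℤ.≤? g (largestWithout a b R v))

      fallBody-spec : ∀ v σ → Env R σ → Holds σ 16 v → regs σ 11 ≡ C →
        regs (⟪ fallBody ⟫ σ) 13 ≡ (if steep v then + toℕ a else regs σ 13) ×
        regs (⟪ fallBody ⟫ σ) 14 ≡ (if steep v then + toℕ v else regs σ 14)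
      fallBody-spec v σ e h c =
        trans (cong (λ s → regs s 13) whole) (proj₁ (cases (live a b R v) (does (g (T ∪ᵇ R v) + C + 1ℤ ℤ.≤? g T)))) ,
        trans (cong (λ s → regs s 14) whole) (proj₂ (cases (live a b R v) (does (g (T ∪ᵇ R v) + C + 1ℤ ℤ.≤? g T))))
        where
        T : Sub n
        T = largestWithout a b R v
        σ₁ σ₂ : State
        σ₁ = ⟪ query (and (neg (rel 18 4)) (neg (rel 18 16))) 20 ⟫ σ
        σ₂ = ⟪ query (or (entry 3 18) (rel 16 18)) 21 ⟫ σ₁
        fr₁ : Frame (query (and (neg (rel 18 4)) (neg (rel 18 16))) 20) σ σ₁
        fr₁ = frame-run _ σ
        found : Prog
        found = set 13 (reg 1) ⨟ set 14 (reg 16)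
        first : Row σ₁ 3 T × regs σ₁ 20 ≡ g T
        first = query-spec (and (neg (rel 18 4)) (neg (rel 18 16))) 20 σ T λ w τ fr hw _ →
          let e′ = env-frame refl fr e in not-both-bit e′ hw (at-b e′) hw (holds-frame 16 refl fr h)
        second : regs σ₂ 21 ≡ g (T ∪ᵇ R v)
        second = proj₂ (query-spec (or (entry 3 18) (rel 16 18)) 21 σ₁ (T ∪ᵇ R v) λ w τ fr hw same →
          let e′ = env-frame refl fr (env-frame refl fr₁ e) in
          or-bit (tables e′) (entry-bit hw (trans same (proj₁ first w)))
            (rel-bit e′ (holds-frame 16 refl fr (holds-frame 16 refl fr₁ h)) hw))
        fr : Frame (query (and (neg (rel 18 4)) (neg (rel 18 16))) 20 ⨟ query (or (entry 3 18) (rel 16 18)) 21) σ σ₂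
        fr = frame-run _ σ
        at-20 : regs σ₂ 20 ≡ g T
        at-20 = trans (regs-frame (query (or (entry 3 18) (rel 16 18)) 21) σ₁ 20 refl) (proj₂ first)
        whole : ⟪ fallBody ⟫ σ ≡ (if live a b R v then
          (if does (g (T ∪ᵇ R v) + C + 1ℤ ℤ.≤? g T) then ⟪ found ⟫ σ₂ else σ₂) else σ)
        whole = trans (branch-bit (liveAt 16) fallLive nop σ (live-bit e h))
          (cong (λ s → if live a b R v then s else σ)
            (branch-leq (reg 21 ⊕ reg 11 ⊕ lit 1ℤ) (reg 20) found nop σ₂
              (cong (_+ 1ℤ) (cong₂ _+_ second (trans (onReg fr 11 refl) c))) at-20))
        cases : ∀ x y →
          regs (if x then (if y then ⟪ found ⟫ σ₂ else σ₂) else σ) 13 ≡ (if x ∧ y then + toℕ a else regs σ 13) ×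
          regs (if x then (if y then ⟪ found ⟫ σ₂ else σ₂) else σ) 14 ≡ (if x ∧ y then + toℕ v else regs σ 14)
        cases false _     = refl , refl
        cases true  false = onReg fr 13 refl , onReg fr 14 refl
        cases true  true  = trans (onReg fr 1 refl) (at-a e) , trans (onReg fr 16 refl) h

      Falls : ℕ → Set
      Falls k = ∀ v → toℕ v ℕ.< k → live a b R v ≡ true →
        g (largestWithout a b R v) ≤ g (largestWithout a b R v ∪ᵇ R v) + C

      falls-spec : ∀ {X* η} (ref : Refinement a b g X* R) → SubmodularOn g → 0ℤ ≤ η →
        (∀ v → live a b R v ≡ true → gap {R} v ≤ η) → + n * η ≤ C →
        ∀ σ → Env R σ → regs σ 11 ≡ C → Holds σ 13 a → Holds σ 14 a →
        Verdict R X* (Falls n) (⟪ falls ⟫ σ)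
      falls-spec {X*} {η} ref sub 0≤η up nη≤C σ e c hp hq =
        loop-rule-Fin {16} {fallBody} {σ} (λ k τ → Verdict R X* (Falls k) τ) refl
          (verdict {source = a} {a} hp hq (inj₁ (Order.reflexive (Refinement.order ref) a , λ v ()))) next
        where
        next : ∀ v τ z → Frame falls σ τ → Holds τ 16 v → Verdict R X* (Falls (toℕ v)) τ →
          Verdict R X* (Falls (suc (toℕ v))) (writeReg 16 z (⟪ fallBody ⟫ τ))
        next v τ z fr h old with r₁ , r₂ ← fallBody-spec v τ (env-frame refl fr e) h (trans (onReg fr 11 refl) c)
          with steep v in st
        ... | true = verdict r₁ r₂ (inj₂
          ( Family.live-above (Refinement.order ref) (∧-trueˡ st)
          , λ _ → steep⇒member ref sub 0≤η up nη≤C (∧-trueˡ st)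
              (+1≤⇒< (from-does (_ ℤ.≤? _) (∧-trueʳ {live a b R v} st)))))
        ... | false = verdict-map r₁ r₂ (λ clear w lt lw →
          [ (λ lt′ → clear w lt′ lw)
          , (λ { refl → ℤ.≮⇒≥ λ steeper → from-does-false (_ ℤ.≤? _) (trans (sym (cong (_∧ _) lw)) st) (<⇒+1≤ steeper) })
          ]′ (<-suc-split lt)) old

module GreedyPass {n : ℕ} (f : Subset n → ℤ) {F : Pred (Subset n) 0ℓ} (F? : Decidable F) (a b : Fin n) where

  open Verdicts f F? a b public

  flagTest-spec : ∀ x v S σ → Holds σ 17 x → Holds σ 16 v → (∀ w → cell σ 2 0ℤ w ≡ S w) →
    regs (⟪ flagTest ⟫ σ) 23 ≡ bit (precedes S x v)
  flagTest-spec x v S σ hx hv s = trans (cong (λ τ → regs τ 23) (trans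
      (branch-leq (reg 17 ⊕ lit 1ℤ) (reg 16) (branch (entry 2 17) (entry 2 16) on off) (branch (entry 2 17 ⊕ lit 1ℤ) (entry 2 16) on off) σ (cong (_+ 1ℤ) hx) hv)
      (cong₂ (if_then_else_ (does (+ toℕ x + 1ℤ ℤ.≤? + toℕ v)))
        (branch-leq (entry 2 17) (entry 2 16) on off σ at-x at-v)
        (branch-leq (entry 2 17 ⊕ lit 1ℤ) (entry 2 16) on off σ (cong (_+ 1ℤ) at-x) at-v))))
    (cases (does (+ toℕ x + 1ℤ ℤ.≤? + toℕ v)) (does (S x ℤ.≤? S v)) (does (S x + 1ℤ ℤ.≤? S v)))
    where
    at-x : eval (entry 2 17) σ ≡ S x
    at-x = trans (entry-cell {σ} {2} {17} hx) (s x)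
    at-v : eval (entry 2 16) σ ≡ S v
    at-v = trans (entry-cell {σ} {2} {16} hv) (s v)
    on off : Prog
    on  = set 23 (lit 1ℤ)
    off = set 23 (lit 0ℤ)
    cases : ∀ c d e → regs (if c then (if d then ⟪ on ⟫ σ else ⟪ off ⟫ σ) else (if e then ⟪ on ⟫ σ else ⟪ off ⟫ σ)) 23 ≡
      bit (if c then d else e)
    cases true  true  e     = refl
    cases true  false e     = refl
    cases false d     true  = refl
    cases false d     false = refl

  module _ {R : Fin n → Sub n} {r : Fin n} where

    free-bit : ∀ {σ i v} → Env R σ → Holds σ 15 r → Holds σ i v → IsBit (freeAt i) σ (free b R r v)
    free-bit e hr h = not-both-bit e hr h h (at-b e)

    prefixBody-spec : ∀ x v S Z σ → Env R σ → Holds σ 15 r → Holds σ 17 x → Holds σ 16 v →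
      (∀ w → cell σ 2 0ℤ w ≡ S w) → Row σ 3 Z →
      Row (⟪ prefixBody ⟫ σ) 3 (λ w → Z w ∨ ((precedes S x v ∧ free b R r x) ∧ R x w))
    prefixBody-spec x v S Z σ e hr hx hv s row =
      subst (λ τ → Row τ 3 (λ w → Z w ∨ ((precedes S x v ∧ free b R r x) ∧ R x w)))
        (sym (branch-bit (and (reg 23) (freeAt 17)) joining nop σ₁
          (and-bit (tables e₁) (isBit (flagTest-spec x v S σ hx hv s))
            (free-bit e₁ (holds-frame 15 refl fr hr) hx₁))))
        (cases (precedes S x v ∧ free b R r x))
      where
      joining : Prog
      joining = fill 3 (or (entry 3 18) (rel 17 18))
      σ₁ : State
      σ₁ = ⟪ flagTest ⟫ σ
      fr : Frame flagTest σ σ₁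
      fr = frame-run flagTest σ
      e₁ : Env R σ₁
      e₁ = env-frame refl fr e
      hx₁ : Holds σ₁ 17 x
      hx₁ = holds-frame 17 refl fr hx
      row₁ : Row σ₁ 3 Z
      row₁ = row-frame 3 {Z} refl fr row
      cases : ∀ y → Row (if y then ⟪ joining ⟫ σ₁ else σ₁) 3 (λ w → Z w ∨ (y ∧ R x w))
      cases true = fill-spec 3 (or (entry 3 18) (rel 17 18)) σ₁ _ λ w τ fr′ hw same →
        let e′ = env-frame refl fr′ e₁ in
        evaluates (or-bit (tables e′) (entry-bit hw (trans same (row₁ w))) (rel-bit e′ (holds-frame 17 refl fr′ hx₁) hw))
      cases false w = trans (row₁ w) (cong bit (sym (Bool.∨-identityʳ (Z w))))

    prefixSet-spec : ∀ v S σ → Env R σ → Holds σ 15 r → Holds σ 16 v → (∀ w → cell σ 2 0ℤ w ≡ S w) →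
      Row (⟪ prefixSet ⟫ σ) 3 (closure b R r (λ x → precedes S x v))
    prefixSet-spec v S σ e hr hv s w =
      trans (loop-rule-Fin {17} {prefixBody} {σ₁} (λ k τ → Row τ 3 (stage k)) refl start next w)
        (cong (λ y → bit (R r w ∨ y)) (any-below-n (adds w)))
      where
      σ₁ : State
      σ₁ = ⟪ fill 3 (rel 15 18) ⟫ σ
      fr : Frame (fill 3 (rel 15 18)) σ σ₁
      fr = frame-run (fill 3 (rel 15 18)) σ
      adds : Fin n → Sub n
      adds w x = (precedes S x v ∧ free b R r x) ∧ R x w
      stage : ℕ → Sub n
      stage k w = R r w ∨ any (λ x → below k x ∧ adds w x)
      start : Row σ₁ 3 (stage 0)
      start w = trans
        (fill-spec 3 (rel 15 18) σ (bit ∘ R r) (λ w τ fr′ hw _ →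
          evaluates (rel-bit (env-frame refl fr′ e) (holds-frame 15 refl fr′ hr) hw)) w)
        (cong bit (sym (trans (cong (R r w ∨_) (any-below-zero (adds w))) (Bool.∨-identityʳ (R r w)))))
      next : ∀ x τ z → Frame (loop 17 0 prefixBody) σ₁ τ → Holds τ 17 x → Row τ 3 (stage (toℕ x)) →
        Row (writeReg 17 z (⟪ prefixBody ⟫ τ)) 3 (stage (suc (toℕ x)))
      next x τ z fr′ hx row w = trans
        (prefixBody-spec x v S (stage (toℕ x)) τ (env-frame refl fr′ (env-frame refl fr e))
          (holds-frame 15 refl fr′ (holds-frame 15 refl fr hr)) hx
          (holds-frame 16 refl fr′ (holds-frame 16 refl fr hv))
          (λ w → trans (onArr fr′ 2 refl _ _) (trans (onArr fr 2 refl _ _) (s w))) row w)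
        (cong bit (trans (Bool.∨-assoc (R r w) _ _)
          (cong (R r w ∨_) (sym (any-below-suc (adds w) x)))))

    counting-spec : ∀ v Z C σ → Env R σ → Holds σ 16 v → Row σ 3 Z → regs σ 11 ≡ C →
      regs (⟪ set 22 (lit 0ℤ) ⨟ loop 18 0 countBody ⟫ σ) 22 ≡ weight C (λ w → R v w ∧ not (Z w))
    counting-spec v Z C σ e hv row c = trans
      (loop-rule-Fin {18} {countBody} {σ₁} (λ k τ → regs τ 22 ≡ weight C (below k ∩ᵇ E)) refl
        (sym (weight-below-zero C E)) next)
      (weight-below-n C E)
      where
      σ₁ : State
      σ₁ = ⟪ set 22 (lit 0ℤ) ⟫ σ
      E : Sub n
      E w = R v w ∧ not (Z w)
      next : ∀ w τ z → Frame (loop 18 0 countBody) σ₁ τ → Holds τ 18 w → regs τ 22 ≡ weight C (below (toℕ w) ∩ᵇ E) →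
        regs (⟪ countBody ⟫ τ) 22 ≡ weight C (below (suc (toℕ w)) ∩ᵇ E)
      next w τ z fr hw acc = trans
        (cong (λ s → regs s 22) (branch-bit (and (rel 16 18) (neg (entry 3 18))) (set 22 (reg 22 ⊕ reg 11)) nop τ
          (and-bit (tables e′) (rel-bit e′ (trans (onReg fr 16 refl) hv) hw)
            (neg-bit (entry-bit hw (trans (onArr fr 3 refl _ _) (row w)))))))
        (trans (cases (E w)) (sym (weight-below-suc C E w)))
        where
        e′ : Env R τ
        e′ = env-frame refl fr (env-frame refl (frame-run (set 22 (lit 0ℤ)) σ) e)
        cases : ∀ y → regs (if y then ⟪ set 22 (reg 22 ⊕ reg 11) ⟫ τ else τ) 22 ≡
          (if y then weight C (below (toℕ w) ∩ᵇ E) + C else weight C (below (toℕ w) ∩ᵇ E))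
        cases true  = cong₂ _+_ acc (trans (onReg fr 11 refl) c)
        cases false = acc

    module _ {C : ℤ} where

      base : (Fin n → ℤ) → Fin n → ℤ
      base S = greedyBase b R r g C (precedes S)

      step-value : (Fin n → ℤ) → Fin n → ℤ
      step-value S v = g (I ∪ᵇ R v) + weight C (I ∪ᵇ R v) - (g I + weight C I) - C
        where
        I : Sub n
        I = closure b R r (λ x → precedes S x v)

      greedyStep-spec : ∀ v S σ → Env R σ → Holds σ 15 r → Holds σ 16 v → regs σ 11 ≡ C →
        (∀ w → cell σ 2 0ℤ w ≡ S w) →
        ∀ w → cell (⟪ greedyStep ⟫ σ) 4 0ℤ w ≡ (if singleton v w then step-value S v else cell σ 4 0ℤ w)
      greedyStep-spec v S σ e hr hv c s w = trans
        (trans (cong (λ z → cell (writeArr 4 0ℤ z (eval (reg 21 ⊕ reg 22 ⊖ reg 20 ⊖ reg 11) σ₄) σ₄) 4 0ℤ w) hv₄)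
          (write-cell 4 0ℤ v _ σ₄ w))
        (cong₂ (if_then_else_ (singleton v w)) final
          (arrs-frame (prefixSet ⨟ value 20 3 (lit 0ℤ) ⨟ counting ⨟ joined) σ 4 refl 0ℤ (+ toℕ w)))
        where
        I : Sub n
        I = closure b R r (λ x → precedes S x v)
        counting joined : Prog
        counting = set 22 (lit 0ℤ) ⨟ loop 18 0 countBody
        joined = query (or (entry 3 18) (rel 16 18)) 21
        σ₁ σ₂ σ₃ σ₄ : State
        σ₁ = ⟪ prefixSet ⟫ σ
        σ₂ = ⟪ value 20 3 (lit 0ℤ) ⟫ σ₁
        σ₃ = ⟪ counting ⟫ σ₂
        σ₄ = ⟪ joined ⟫ σ₃
        fr₂ : Frame (prefixSet ⨟ value 20 3 (lit 0ℤ)) σ σ₂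
        fr₂ = frame-run (prefixSet ⨟ value 20 3 (lit 0ℤ)) σ
        fr₃ : Frame (prefixSet ⨟ value 20 3 (lit 0ℤ) ⨟ counting) σ σ₃
        fr₃ = frame-run (prefixSet ⨟ value 20 3 (lit 0ℤ) ⨟ counting) σ
        fr₄ : Frame (prefixSet ⨟ value 20 3 (lit 0ℤ) ⨟ counting ⨟ joined) σ σ₄
        fr₄ = frame-run (prefixSet ⨟ value 20 3 (lit 0ℤ) ⨟ counting ⨟ joined) σ
        row₁ : Row σ₁ 3 I
        row₁ = prefixSet-spec v S σ e hr hv s
        row₃ : Row σ₃ 3 I
        row₃ w = trans (arrs-frame counting σ₂ 3 refl 0ℤ (+ toℕ w)) (row₁ w)
        hv₄ : Holds σ₄ 16 v
        hv₄ = holds-frame 16 refl fr₄ hv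
        at-20 : regs σ₄ 20 ≡ g I
        at-20 = trans (regs-frame (counting ⨟ joined) σ₂ 20 refl) (row-value {σ₁} {3} {I} row₁)
        at-22 : regs σ₄ 22 ≡ weight C (λ w → R v w ∧ not (I w))
        at-22 = trans (regs-frame joined σ₃ 22 refl)
          (counting-spec v I C σ₂ (env-frame refl fr₂ e) (holds-frame 16 refl fr₂ hv) row₁ (trans (onReg fr₂ 11 refl) c))
        at-21 : regs σ₄ 21 ≡ g (I ∪ᵇ R v)
        at-21 = proj₂ (query-spec (or (entry 3 18) (rel 16 18)) 21 σ₃ (I ∪ᵇ R v) λ w τ fr hw same →
          let e′ = env-frame refl fr (env-frame refl fr₃ e) in
          or-bit (tables e′) (entry-bit hw (trans same (row₃ w)))
            (rel-bit e′ (holds-frame 16 refl fr (holds-frame 16 refl fr₃ hv)) hw))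
        rearrange : ∀ gu wd gi wi c → gu + wd - gi - c ≡ gu + (wi + wd) - (gi + wi) - c
        rearrange = solve-∀
        final : regs σ₄ 21 + regs σ₄ 22 - regs σ₄ 20 - regs σ₄ 11 ≡ step-value S v
        final = trans (cong₂ _-_ (cong₂ _-_ (cong₂ _+_ at-21 at-22) at-20) (trans (onReg fr₄ 11 refl) c))
          (trans (rearrange (g (I ∪ᵇ R v)) (weight C (λ w → R v w ∧ not (I w))) (g I) (weight C I) C)
            (cong (λ y → g (I ∪ᵇ R v) + y - (g I + weight C I) - C) (sym (weight-∪ C I (R v)))))

      greedy-spec : ∀ v S σ → Env R σ → Holds σ 15 r → Holds σ 16 v → regs σ 11 ≡ C →
        (∀ w → cell σ 2 0ℤ w ≡ S w) →
        ∀ w → cell (⟪ greedy ⟫ σ) 4 0ℤ w ≡ (if singleton v w then base S v else cell σ 4 0ℤ w)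
      greedy-spec v S σ e hr hv c s w = trans
        (cong (λ τ → cell τ 4 0ℤ w) (branch-bit (freeAt 16) greedyStep reset σ (free-bit e hr hv)))
        (cases (free b R r v))
        where
        reset : Prog
        reset = put 4 (lit 0ℤ) (reg 16) (lit 0ℤ)
        cases : ∀ y → cell (if y then ⟪ greedyStep ⟫ σ else ⟪ reset ⟫ σ) 4 0ℤ w ≡
          (if singleton v w then mask y (step-value S v) else cell σ 4 0ℤ w)
        cases true  = greedyStep-spec v S σ e hr hv c s w
        cases false = trans (cong (λ z → cell (writeArr 4 0ℤ z 0ℤ σ) 4 0ℤ w) hv) (write-cell 4 0ℤ v 0ℤ σ w)

      pass-spec : ∀ S σ → Env R σ → Holds σ 15 r → regs σ 11 ≡ C → (∀ w → cell σ 2 0ℤ w ≡ S w) →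
        ∀ w → cell (⟪ pass ⟫ σ) 2 0ℤ w ≡ S w + base S w
      pass-spec S σ e hr c s = fill-spec 2 (entry 2 18 ⊕ entry 4 18) σ₁ _ λ w τ fr hw same →
        cong₂ _+_ (trans (entry-cell {τ} {2} {18} hw) (trans same (trans (arrs-frame (loop 16 0 greedy) σ 2 refl _ _) (s w))))
          (trans (entry-cell {τ} {4} {18} hw) (trans (onArr fr 4 refl _ _) (filled w (Fin.toℕ<n w))))
        where
        σ₁ : State
        σ₁ = ⟪ loop 16 0 greedy ⟫ σ
        filled : ∀ w → toℕ w ℕ.< n → cell σ₁ 4 0ℤ w ≡ base S w
        filled = loop-rule-Fin {16} {greedy} {σ} (λ k τ → ∀ w → toℕ w ℕ.< k → cell τ 4 0ℤ w ≡ base S w) refl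
          (λ w ()) next
          where
          next : ∀ v τ z → Frame (loop 16 0 greedy) σ τ → Holds τ 16 v →
            (∀ w → toℕ w ℕ.< toℕ v → cell τ 4 0ℤ w ≡ base S w) →
            ∀ w → toℕ w ℕ.< suc (toℕ v) → cell (⟪ greedy ⟫ τ) 4 0ℤ w ≡ base S w
          next v τ z fr hv old w lt = trans
            (greedy-spec v S τ (env-frame refl fr e) (holds-frame 15 refl fr hr) hv (trans (onReg fr 11 refl) c)
              (λ w → trans (onArr fr 2 refl _ _) (s w)) w)
            (choose (<-suc-split lt))
            where
            choose : toℕ w ℕ.< toℕ v ⊎ v ≡ w → (if singleton v w then base S v else cell τ 4 0ℤ w) ≡ base S w
            choose (inj₁ lt′)  = trans (if-else (to-does-false (v Fin.≟ w) λ { refl → ℕ.<-irrefl refl lt′ })) (old w lt′)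
            choose (inj₂ refl) = if-then (singleton-self v)

-- With k = n + 3, the choices C = k η, D = k² η, Q = k⁷ η, Γ = k¹² η and
-- N = k¹⁴ satisfy all the inequalities that the analysis needs.
module Parameters (n : ℕ) {η : ℤ} (0<η : 0ℤ < η) where

  private
    k h : ℕ
    k = n ℕ.+ 3
    h = ℤ.∣ η ∣

    η≡ : + h ≡ η
    η≡ = ℤ.0≤i⇒+∣i∣≡i (ℤ.<⇒≤ 0<η)

    0<h : 0 ℕ.< h
    0<h = ℤ.drop‿+<+ (subst (0ℤ <_) (sym η≡) 0<η)

    n≤k : n ℕ.≤ k
    n≤k = ℕ.m≤m+n n 3

    1≤k : 1 ℕ.≤ k
    1≤k = ℕ.≤-trans (ℕ.s≤s ℕ.z≤n) (ℕ.m≤n+m 3 n)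

    0<k^ : ∀ e → 0 ℕ.< k ℕ.^ e
    0<k^ zero    = ℕ.s≤s ℕ.z≤n
    0<k^ (suc e) = ℕ.*-mono-≤ 1≤k (0<k^ e)

    level≡ : ∀ e → + (k ℕ.^ e ℕ.* h) ≡ + (k ℕ.^ e) * η
    level≡ e = trans (ℤ.pos-* (k ℕ.^ e) h) (cong (+ (k ℕ.^ e) *_) η≡)

  opaque
    level : ℕ → ℤ
    level e = + ((n ℕ.+ 3) ℕ.^ e) * η

    level-def : ∀ e → level e ≡ + ((n ℕ.+ 3) ℕ.^ e) * η
    level-def e = refl

    rounds : ℕ
    rounds = (n ℕ.+ 3) ℕ.^ 14

    rounds-def : rounds ≡ (n ℕ.+ 3) ℕ.^ 14
    rounds-def = refl

    level-positive : ∀ e → 0ℤ < level e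
    level-positive e = subst (0ℤ <_) (level≡ e) (ℤ.+<+ (ℕ.*-mono-≤ (0<k^ e) 0<h))

    nη≤C : + n * η ≤ level 1
    nη≤C = subst₂ _≤_ (trans (ℤ.pos-* n h) (cong (+ n *_) η≡)) (level≡ 1)
      (ℤ.+≤+ (ℕ.*-monoˡ-≤ h (subst (n ℕ.≤_) (sym (ℕ.*-identityʳ k)) n≤k)))

    C≤D : level 1 ≤ level 2
    C≤D = subst₂ _≤_ (level≡ 1) (level≡ 2) (ℤ.+≤+ (ℕ.*-monoˡ-≤ h (ℕ.*-monoʳ-≤ k (ℕ.*-mono-≤ 1≤k (ℕ.≤-refl {1})))))

    rise≤D : + n * η + + n * level 1 ≤ level 2
    rise≤D = subst₂ _≤_ left (level≡ 2) (ℤ.+≤+ (ℕ.≤-trans (ℕ.m≤m+n _ (h ℕ.* (2 ℕ.* n ℕ.+ 9))) (ℕ.≤-reflexive (sym (expand n h)))))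
      where
      left : + (n ℕ.* h ℕ.+ n ℕ.* (k ℕ.^ 1 ℕ.* h)) ≡ + n * η + + n * level 1
      left = trans (ℤ.pos-+ (n ℕ.* h) (n ℕ.* (k ℕ.^ 1 ℕ.* h)))
        (cong₂ _+_ (trans (ℤ.pos-* n h) (cong (+ n *_) η≡)) (trans (ℤ.pos-* n (k ℕ.^ 1 ℕ.* h)) (cong (+ n *_) (level≡ 1))))
      expand : ∀ n h → (n ℕ.+ 3) ℕ.* ((n ℕ.+ 3) ℕ.* 1) ℕ.* h ≡ n ℕ.* h ℕ.+ n ℕ.* ((n ℕ.+ 3) ℕ.* 1 ℕ.* h) ℕ.+ h ℕ.* (2 ℕ.* n ℕ.+ 9)
      expand = solve-∀ℕ

    private
      split : ∀ d e → + (k ℕ.^ (d ℕ.+ e)) ≡ + (k ℕ.^ d) * + (k ℕ.^ e)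
      split d e = trans (cong +_ (ℕ.^-distribˡ-+-* k d e)) (ℤ.pos-* (k ℕ.^ d) (k ℕ.^ e))

      slack : + n * (+ (k ℕ.^ 2) * + (k ℕ.^ 2)) + + n ≤ + 2 * + (k ℕ.^ 5)
      slack = subst₂ _≤_ left (ℤ.pos-* 2 (k ℕ.^ 5)) (ℤ.+≤+ (subst (n ℕ.* (k ℕ.^ 4) ℕ.+ n ℕ.≤_) (sym (double (k ℕ.^ 5)))
        (ℕ.+-mono-≤ (ℕ.*-monoˡ-≤ (k ℕ.^ 4) n≤k)
          (ℕ.≤-trans n≤k (subst (ℕ._≤ k ℕ.^ 5) (ℕ.*-identityʳ k) (ℕ.*-monoʳ-≤ k (0<k^ 4)))))))
        where
        double : ∀ x → 2 ℕ.* x ≡ x ℕ.+ x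
        double = solve-∀ℕ
        left : + (n ℕ.* (k ℕ.^ 4) ℕ.+ n) ≡ + n * (+ (k ℕ.^ 2) * + (k ℕ.^ 2)) + + n
        left = trans (ℤ.pos-+ (n ℕ.* (k ℕ.^ 4)) n)
          (cong (_+ + n) (trans (ℤ.pos-* n (k ℕ.^ 4)) (cong (+ n *_) (split 2 2))))

    precise : + rounds * (+ n * (level 2 * level 2)) + + n * (level 7 * level 7) ≤ + 2 * (level 7 * level 12)
    precise = subst₂ _≤_ (left (+ n) (+ (k ℕ.^ 7)) (+ (k ℕ.^ 2)) η (split 7 7)) (right (+ (k ℕ.^ 7)) (+ (k ℕ.^ 5)) η (split 7 5))
      (ℤ.*-monoˡ-≤-nonNeg (x * x * (η * η)) ⦃ ℤ.nonNegative (*-nonneg (square-nonneg x) (square-nonneg η)) ⦄ slack)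
      where
      x : ℤ
      x = + (k ℕ.^ 7)
      left : ∀ n x y η {N} → N ≡ x * x → x * x * (η * η) * (n * (y * y) + n) ≡
        N * (n * ((y * η) * (y * η))) + n * ((x * η) * (x * η))
      left n x y η refl = eq n x y η
        where
        eq : ∀ n x y η → x * x * (η * η) * (n * (y * y) + n) ≡
          x * x * (n * ((y * η) * (y * η))) + n * ((x * η) * (x * η))
        eq = solve-∀
      right : ∀ x y η {G} → G ≡ x * y → x * x * (η * η) * (+ 2 * y) ≡ + 2 * ((x * η) * (G * η))
      right x y η refl = eq x y η
        where
        eq : ∀ x y η → x * x * (η * η) * (+ 2 * y) ≡ + 2 * ((x * η) * (x * y * η))
        eq = solve-∀

    many : + 3 * (+ n * level 12) < + rounds * η
    many = subst₂ _<_ (left (+ n) (+ (k ℕ.^ 12)) η) (right (+ (k ℕ.^ 12)) (+ (k ℕ.^ 2)) η (split 12 2))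
      (ℤ.*-monoˡ-<-pos (level 12) ⦃ ℤ.positive (level-positive 12) ⦄ few)
      where
      few : + 3 * + n < + (k ℕ.^ 2)
      few = subst (_< + (k ℕ.^ 2)) (ℤ.pos-* 3 n)
        (ℤ.+<+ (ℕ.≤-trans (ℕ.m≤m+n _ (n ℕ.* n ℕ.+ 3 ℕ.* n ℕ.+ 8)) (ℕ.≤-reflexive (sym (expand n)))))
        where
        expand : ∀ n → (n ℕ.+ 3) ℕ.* ((n ℕ.+ 3) ℕ.* 1) ≡ suc (3 ℕ.* n) ℕ.+ (n ℕ.* n ℕ.+ 3 ℕ.* n ℕ.+ 8)
        expand = solve-∀ℕ
      left : ∀ n x η → x * η * (+ 3 * n) ≡ + 3 * (n * (x * η))
      left = solve-∀
      right : ∀ x y η {N} → N ≡ x * y → x * η * y ≡ N * η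
      right x y η refl = eq x y η
        where
        eq : ∀ x y η → x * η * y ≡ x * y * η
        eq = solve-∀

module ArcSearch {n : ℕ} (f : Subset n → ℤ) {F : Pred (Subset n) 0ℓ} (F? : Decidable F) (sub : SubmodularOn (onSub f))
  (a b : Fin n) where

  open GreedyPass f F? a b public

  env-counter : ∀ {R} j z σ → Env R σ → Env R (writeReg (100 ℕ.+ j) z σ)
  env-counter j z σ = env-frame refl (frame-run (set (100 ℕ.+ j) (lit z)) σ)

  module _ {R : Fin n → Sub n} {X* : Sub n} (ref : Refinement a b g X* R) {η : ℤ} (0<η : 0ℤ < η)
    (up : ∀ v → live a b R v ≡ true → gap {R} v ≤ η) where

    open Parameters n 0<η
    open Refinement ref
    open Family order

    private
      0≤η : 0ℤ ≤ η
      0≤η = ℤ.<⇒≤ 0<η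

    module _ (falls≤C : Falls {R} {level 1} n) where

      scaled : Scaled a b R g η (level 1)
      scaled = record
        { η-nonneg = 0≤η
        ; C-nonneg = ℤ.<⇒≤ (level-positive 1)
        ; up       = up
        ; down     = λ v → falls≤C v (Fin.toℕ<n v)
        }

      open Iteration order sub scaled (ℤ.<⇒≤ (level-positive 7)) C≤D rise≤D

      accumulate-spec : ∀ r σ → R r b ≡ false → Env R σ → Holds σ 15 r → regs σ 11 ≡ level 1 →
        ∃[ S ] (∀ w → cell (⟪ accumulate ⟫ σ) 2 0ℤ w ≡ S w) × Accumulated r rounds S
      accumulate-spec r σ ¬rb e hr c =
        let _ , _ , _ , S , s , A = nest-spec {pass} P counter step 0 14 refl 0 σ₁
              ( env-frame refl fr e , holds-frame 15 refl fr hr , trans (onReg fr 11 refl) c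
              , (λ _ → 0ℤ) , fill-spec 2 (lit 0ℤ) σ (λ _ → 0ℤ) (λ _ _ _ _ _ → refl) , accumulated-zero r )
        in S , s , subst (λ t → Accumulated r t S) (sym rounds-def) A
        where
        σ₁ : State
        σ₁ = ⟪ fill 2 (lit 0ℤ) ⟫ σ
        fr : Frame (fill 2 (lit 0ℤ)) σ σ₁
        fr = frame-run (fill 2 (lit 0ℤ)) σ
        P : ℕ → State → Set
        P t τ = Env R τ × Holds τ 15 r × regs τ 11 ≡ level 1 ×
          ∃[ S ] (∀ w → cell τ 2 0ℤ w ≡ S w) × Accumulated r t S
        counter : ∀ j z t τ → P t τ → P t (writeReg (100 ℕ.+ j) z τ)
        counter j z t τ (e , rest) = env-counter j z τ e , rest
        step : ∀ t τ → P t τ → P (suc t) (⟪ pass ⟫ τ)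
        step t τ (e , hr , c , S , s , A) =
          let fr = frame-run pass τ in
          env-frame refl fr e , holds-frame 15 refl fr hr , trans (onReg fr 11 refl) c ,
          (λ v → S v + baseAt r S v) , pass-spec S τ e hr c s , accumulated-suc ¬rb A

      module _ {r : Fin n} (¬rb : R r b ≡ false) {S : Fin n → ℤ} (A : Accumulated r rounds S) where

        open Accumulated A using (unfree)
        open Conclusions {rounds} {level 12} (level-positive 7) precise

        low high : Fin n → Bool
        low w  = does (S w + level 12 + 1ℤ ℤ.≤? 0ℤ)
        high w = singleton a r ∧ does (level 12 + 1ℤ ℤ.≤? S w)

        scanBody-spec : ∀ w σ → Env R σ → Holds σ 15 r → Holds σ 16 w → regs σ 12 ≡ level 12 →
          (∀ w → cell σ 2 0ℤ w ≡ S w) →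
          regs (⟪ scanBody ⟫ σ) 13 ≡ (if high w then + toℕ w else (if low w then + toℕ r else regs σ 13)) ×
          regs (⟪ scanBody ⟫ σ) 14 ≡ (if high w then + toℕ b else (if low w then + toℕ w else regs σ 14))
        scanBody-spec w σ e hr hw γ s =
          trans (cong (λ τ → regs τ 13) whole) (proj₁ (cases (low w) (singleton a r) (does (level 12 + 1ℤ ℤ.≤? S w)))) ,
          trans (cong (λ τ → regs τ 14) whole) (proj₂ (cases (low w) (singleton a r) (does (level 12 + 1ℤ ℤ.≤? S w))))
          where
          lower raise test : Prog
          lower = set 13 (reg 15) ⨟ set 14 (reg 16)
          raise = set 13 (reg 16) ⨟ set 14 (reg 4)
          test  = branch (entry 2 16 ⊕ reg 12 ⊕ lit 1ℤ) (lit 0ℤ) lower nop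
          σ₁ : State
          σ₁ = ⟪ test ⟫ σ
          fr : Frame test σ σ₁
          fr = frame-run test σ
          e₁ : Env R σ₁
          e₁ = env-frame refl fr e
          at-w : ∀ τ → Holds τ 16 w → (∀ w → cell τ 2 0ℤ w ≡ S w) → eval (entry 2 16) τ ≡ S w
          at-w τ h s = trans (entry-cell {τ} {2} {16} h) (s w)
          whole : ⟪ scanBody ⟫ σ ≡ (if singleton a r then (if does (level 12 + 1ℤ ℤ.≤? S w) then ⟪ raise ⟫ σ₁ else σ₁) else σ₁)
          whole = trans
            (branch-bit (idn 1 15) (branch (reg 12 ⊕ lit 1ℤ) (entry 2 16) raise nop) nop σ₁
              (matrix-bit singleton (identity (tables e₁)) (at-a e₁) (trans (onReg fr 15 refl) hr)))
            (cong (λ τ → if singleton a r then τ else σ₁)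
              (branch-leq (reg 12 ⊕ lit 1ℤ) (entry 2 16) raise nop σ₁ (cong (_+ 1ℤ) (trans (onReg fr 12 refl) γ))
                (at-w σ₁ (trans (onReg fr 16 refl) hw) λ w → trans (onArr fr 2 refl _ _) (s w))))
          σ₁≡ : σ₁ ≡ (if low w then ⟪ lower ⟫ σ else σ)
          σ₁≡ = branch-leq (entry 2 16 ⊕ reg 12 ⊕ lit 1ℤ) (lit 0ℤ) lower nop σ
            (cong (_+ 1ℤ) (cong₂ _+_ (at-w σ hw s) γ)) refl
          lows : ∀ x →
            regs (if x then ⟪ lower ⟫ σ else σ) 13 ≡ (if x then + toℕ r else regs σ 13) ×
            regs (if x then ⟪ lower ⟫ σ else σ) 14 ≡ (if x then + toℕ w else regs σ 14)
          lows true  = hr , hw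
          lows false = refl , refl
          first : regs σ₁ 13 ≡ (if low w then + toℕ r else regs σ 13) × regs σ₁ 14 ≡ (if low w then + toℕ w else regs σ 14)
          first = trans (cong (λ τ → regs τ 13) σ₁≡) (proj₁ (lows (low w))) ,
                  trans (cong (λ τ → regs τ 14) σ₁≡) (proj₂ (lows (low w)))
          cases : ∀ x y z →
            regs (if y then (if z then ⟪ raise ⟫ σ₁ else σ₁) else σ₁) 13 ≡
              (if y ∧ z then + toℕ w else (if low w then + toℕ r else regs σ 13)) ×
            regs (if y then (if z then ⟪ raise ⟫ σ₁ else σ₁) else σ₁) 14 ≡
              (if y ∧ z then + toℕ b else (if low w then + toℕ w else regs σ 14))
          cases x false z     = first
          cases x true  false = first
          cases x true  true  = trans (onReg fr 16 refl) hw , trans (onReg fr 4 refl) (at-b e)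

        Flat : ℕ → Set
        Flat k = ∀ w → toℕ w ℕ.< k → - level 12 ≤ S w × (r ≡ a → S w ≤ level 12)

        nonzero-free : ∀ w → ¬ S w ≡ 0ℤ → free b R r w ≡ true
        nonzero-free w nonzero = Bool.¬-not λ ¬fr → nonzero (unfree w ¬fr)

        low⇒< : ∀ w → low w ≡ true → S w < - level 12
        low⇒< w e = +1≤⇒< (lin₁ (eq (S w) (level 12)) (from-does (S w + level 12 + 1ℤ ℤ.≤? 0ℤ) e))
          where
          eq : ∀ s γ → - γ - (s + 1ℤ) ≡ 0ℤ - (s + γ + 1ℤ)
          eq = solve-∀

        ¬low⇒≤ : ∀ w → low w ≡ false → - level 12 ≤ S w
        ¬low⇒≤ w e = ℤ.≮⇒≥ λ lt → from-does-false (S w + level 12 + 1ℤ ℤ.≤? 0ℤ) e (lin₁ (eq (S w) (level 12)) (<⇒+1≤ lt))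
          where
          eq : ∀ s γ → 0ℤ - (s + γ + 1ℤ) ≡ - γ - (s + 1ℤ)
          eq = solve-∀

        scan-spec : ∀ {Before} σ → Env R σ → Holds σ 15 r → regs σ 12 ≡ level 12 →
          (∀ w → cell σ 2 0ℤ w ≡ S w) → Verdict R X* Before σ →
          Verdict R X* (Before × Flat n) (⟪ scan ⟫ σ)
        scan-spec {Before} σ e hr γ s old =
          loop-rule-Fin {16} {scanBody} {σ} (λ k τ → Verdict R X* (Before × Flat k) τ) refl
            (verdict-map {σ = σ} refl refl (λ before → before , λ w ()) old) next
          where
          0≤Γ : 0ℤ ≤ level 12
          0≤Γ = ℤ.<⇒≤ (level-positive 12)
          next : ∀ w τ z → Frame scan σ τ → Holds τ 16 w → Verdict R X* (Before × Flat (toℕ w)) τ →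
            Verdict R X* (Before × Flat (suc (toℕ w))) (writeReg 16 z (⟪ scanBody ⟫ τ))
          next w τ z fr hw current
            = cases (high w) (low w) refl refl r₁r₂
            where
            r₁r₂ = scanBody-spec w τ (env-frame refl fr e) (holds-frame 15 refl fr hr) hw
              (trans (onReg fr 12 refl) γ) (λ w → trans (onArr fr 2 refl _ _) (s w))
            cases : ∀ x y → high w ≡ x → low w ≡ y →
              regs (⟪ scanBody ⟫ τ) 13 ≡ (if x then + toℕ w else (if y then + toℕ r else regs τ 13)) ×
              regs (⟪ scanBody ⟫ τ) 14 ≡ (if x then + toℕ b else (if y then + toℕ w else regs τ 14)) →
              Verdict R X* (Before × Flat (suc (toℕ w))) (writeReg 16 z (⟪ scanBody ⟫ τ))
            cases true _ hi _ (r₁ , r₂) = verdict r₁ r₂ (inj₂ (¬wb , λ X*w → ⊥-elim (ℤ.<⇒≱ above (below′ X*w))))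
              where
              above : level 12 < S w
              above = +1≤⇒< (from-does (level 12 + 1ℤ ℤ.≤? S w) (∧-trueʳ {singleton a r} hi))
              ¬wb : R w b ≡ false
              ¬wb = not-true (∧-trueʳ {not (R r w)} (nonzero-free w λ zero′ → ℤ.<⇒≱ above (subst (_≤ level 12) (sym zero′) 0≤Γ)))
              below′ : X* w ≡ true → S w ≤ level 12
              below′ X*w = inside-upper X*-ideal X*-least
                (subst (λ x → X* x ≡ true) (singleton-≡ a r (∧-trueˡ hi)) (has X*-ideal)) A w X*w
            cases false true _ lo (r₁ , r₂) = verdict r₁ r₂ (inj₂ (¬rw , λ X*r → Bool.¬-not λ ¬X*w →
                ℤ.<⇒≱ (low⇒< w lo) (outside-lower X*-ideal X*-least X*r A w ¬X*w)))
              where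
              ¬rw : R r w ≡ false
              ¬rw = not-true (∧-trueˡ (nonzero-free w λ zero′ →
                ℤ.<⇒≱ (low⇒< w lo) (subst (- level 12 ≤_) (sym zero′) (ℤ.neg-mono-≤ 0≤Γ))))
            cases false false hi lo (r₁ , r₂) = verdict-map r₁ r₂ (λ { (before , flat) → before , λ w′ lt →
              [ flat w′
              , (λ { refl → ¬low⇒≤ w lo , λ { refl →
                  ℤ.≮⇒≥ λ gt → from-does-false (level 12 + 1ℤ ℤ.≤? S w)
                    (trans (sym (cong (_∧ does (level 12 + 1ℤ ℤ.≤? S w)) (singleton-self a))) hi) (<⇒+1≤ gt) } })
              ]′ (<-suc-split lt) }) current

      Searched : ℕ → Set
      Searched k = ∀ r → toℕ r ℕ.< k → R r b ≡ false →
        ∃[ S ] Accumulated r rounds S × (∀ w → - level 12 ≤ S w × (r ≡ a → S w ≤ level 12))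

      searchBody-spec : ∀ r σ → Env R σ → Holds σ 15 r → regs σ 11 ≡ level 1 → regs σ 12 ≡ level 12 →
        Verdict R X* (Searched (toℕ r)) σ → Verdict R X* (Searched (suc (toℕ r))) (⟪ searchBody ⟫ σ)
      searchBody-spec r σ e hr c γ old = subst (Verdict R X* (Searched (suc (toℕ r))))
        (sym (branch-bit (neg (rel 15 4)) (accumulate ⨟ scan) nop σ (neg-bit (rel-bit e hr (at-b e)))))
        (cases (not (R r b)) refl)
        where
        extend : (R r b ≡ false → ∃[ S ] Accumulated r rounds S × (∀ w → - level 12 ≤ S w × (r ≡ a → S w ≤ level 12))) →
          Searched (toℕ r) → Searched (suc (toℕ r))
        extend new searched r′ lt ¬r′b = [ (λ lt′ → searched r′ lt′ ¬r′b) , (λ { refl → new ¬r′b }) ]′ (<-suc-split lt)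
        cases : ∀ y → not (R r b) ≡ y →
          Verdict R X* (Searched (suc (toℕ r))) (if y then ⟪ accumulate ⨟ scan ⟫ σ else σ)
        cases false rb = verdict-map {σ = σ} refl refl (extend λ ¬rb → true≢false (not-false ¬rb) rb) old
        cases true  e′ = let S , s , A = accumulate-spec r σ (not-true e′) e hr c in
          verdict-map {σ = ⟪ accumulate ⨟ scan ⟫ σ} refl refl
            (λ { (searched , flat) → extend (λ _ → S , A , λ w → flat w (Fin.toℕ<n w)) searched })
            (scan-spec (not-true e′) A (⟪ accumulate ⟫ σ) (env-frame refl fr e) (holds-frame 15 refl fr hr)
              (trans (onReg fr 12 refl) γ) s (verdict-map {σ = σ} (onReg fr 13 refl) (onReg fr 14 refl) (λ x → x) old))
          where
          fr : Frame accumulate σ (⟪ accumulate ⟫ σ)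
          fr = frame-run accumulate σ

      search-spec : ∀ σ → Env R σ → regs σ 11 ≡ level 1 → regs σ 12 ≡ level 12 →
        Verdict R X* ⊤ σ → Verdict R X* (Searched n) (⟪ search ⟫ σ)
      search-spec σ e c γ old = loop-rule-Fin {15} {searchBody} {σ} (λ k τ → Verdict R X* (Searched k) τ) refl
        (verdict-map {σ = σ} refl refl (λ _ r ()) old)
        λ r τ z fr hr current → verdict-map {σ = ⟪ searchBody ⟫ τ} refl refl (λ x → x)
          (searchBody-spec r τ (env-frame refl fr e) hr (trans (onReg fr 11 refl) c) (trans (onReg fr 12 refl) γ) current)

      searched-absurd : ∀ u → live a b R u ≡ true → gap {R} u ≡ η → ¬ Searched n
      searched-absurd u lu attains searched =
        let Sₐ , Aₐ , flatₐ = searched a (Fin.toℕ<n a) (Order.proper order)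
            Sᵤ , Aᵤ , flatᵤ = searched u (Fin.toℕ<n u) (live-below lu) in
        some-large (ℤ.<⇒≤ (level-positive 12)) many lu attains Aₐ Aᵤ
          (λ v → proj₁ (flatₐ v)) (λ v → proj₂ (flatₐ v) refl) (λ v → proj₁ (flatᵤ v))

    findArc-spec : ∀ u → live a b R u ≡ true → gap {R} u ≡ η →
      ∀ σ → Env R σ → regs σ 11 ≡ level 1 → regs σ 12 ≡ level 12 → Holds σ 13 a → Holds σ 14 a →
      Verdict R X* ⊥ (⟪ findArc ⟫ σ)
    findArc-spec u lu attains σ e c γ hp hq = subst (Verdict R X* ⊥)
      (sym (branch-bit (rel 13 14) search nop σ₁ (rel-bit e₁ (at-source fallen) (at-target fallen))))
      (cases (outcome fallen))
      where
      σ₁ : State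
      σ₁ = ⟪ falls ⟫ σ
      fallen : Verdict R X* (Falls {R} {level 1} n) σ₁
      fallen = falls-spec ref sub 0≤η up nη≤C σ e c hp hq
      p q : Fin n
      p = source fallen
      q = target fallen
      fr : Frame falls σ σ₁
      fr = frame-run falls σ
      e₁ : Env R σ₁
      e₁ = env-frame refl fr e
      cases : (R p q ≡ true × Falls {R} {level 1} n) ⊎ (R p q ≡ false × (X* p ≡ true → X* q ≡ true)) →
        Verdict R X* ⊥ (if R p q then ⟪ search ⟫ σ₁ else σ₁)
      cases (inj₂ (new , valid)) = subst (Verdict R X* ⊥) (sym (if-else new))
        (verdict (at-source fallen) (at-target fallen) (inj₂ (new , valid)))
      cases (inj₁ (old , clear)) = subst (Verdict R X* ⊥) (sym (if-then old))
        (verdict-map {σ = ⟪ search ⟫ σ₁} refl refl (searched-absurd clear u lu attains)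
          (search-spec clear σ₁ e₁ (trans (onReg fr 11 refl) c) (trans (onReg fr 12 refl) γ)
            (verdict (at-source fallen) (at-target fallen) (inj₁ (old , tt)))))

module PhaseLoop {n : ℕ} (f : Subset n → ℤ) {F : Pred (Subset n) 0ℓ} (F? : Decidable F) (sub : SubmodularOn (onSub f))
  (a b : Fin n) where

  open ArcSearch f F? sub a b public

  amplify-spec : ∀ x k σ → (x ℕ.≡ᵇ 10) ≡ false → (∀ j → (100 ℕ.+ j ℕ.≡ᵇ x) ≡ false) →
    wellFormed (nest 100 k (set x (reg x ⊕ reg 10))) ≡ true →
    regs (⟪ amplify x k ⟫ σ) x ≡ + ((n ℕ.+ 3) ℕ.^ k) * regs σ 10
  amplify-spec x k σ x≢10 x<100 wf = proj₂ (nest-spec {add} P counter step 0 k wf 0 (⟪ set x (lit 0ℤ) ⟫ σ)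
    (other 0ℤ σ , writeReg-same x 0ℤ σ))
    where
    add : Prog
    add = set x (reg x ⊕ reg 10)
    P : ℕ → State → Set
    P t τ = regs τ 10 ≡ regs σ 10 × regs τ x ≡ + t * regs σ 10
    other : ∀ z τ → regs (writeReg x z τ) 10 ≡ regs τ 10
    other z τ rewrite x≢10 = refl
    counter : ∀ j z t τ → P t τ → P t (writeReg (100 ℕ.+ j) z τ)
    counter j z t τ (p , q) = p , trans (if-else (x<100 j)) q
    step : ∀ t τ → P t τ → P (suc t) (⟪ add ⟫ τ)
    step t τ (p , q) = trans (other _ τ) p ,
      trans (writeReg-same x _ τ) (trans (cong₂ _+_ q p) (sym (suc-* t (regs σ 10))))

  update-spec : ∀ {R} p q σ → Env R σ → Holds σ 13 p → Holds σ 14 q → Env (addArc p q R) (⟪ update ⟫ σ)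
  update-spec {R} p q σ e hp hq = record
    { tables = tables-frame refl refl fr (tables e)
    ; stored = fill₂-spec 1 (arr 5 (reg 19) (reg 18)) σ₁ (λ v w → bit (addArc p q R v w)) λ v w τ fr′ hv hw _ →
        trans (cong₂ (arrs τ 5) hv hw) (trans (onArr fr′ 5 refl _ _) (next v w))
    ; at-a   = holds-frame 1 refl fr (at-a e)
    ; at-b   = holds-frame 4 refl fr (at-b e)
    }
    where
    fr : Frame update σ (⟪ update ⟫ σ)
    fr = frame-run update σ
    new : Expr
    new = or (rel 19 18) (and (rel 19 13) (rel 14 18))
    σ₁ : State
    σ₁ = ⟪ fill₂ 5 new ⟫ σ
    next : Matrix σ₁ 5 (addArc p q R)
    next = fill₂-spec 5 new σ (λ v w → bit (addArc p q R v w)) λ v w τ fr′ hv hw _ →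
      let e′ = env-frame refl fr′ e in
      evaluates (or-bit (tables e′) (rel-bit e′ hv hw)
        (and-bit (tables e′) (rel-bit e′ hv (holds-frame 13 refl fr′ hp)) (rel-bit e′ (holds-frame 14 refl fr′ hq) hw)))

  Settled : (Fin n → Sub n) → Set
  Settled R = ∀ v → live a b R v ≡ true → gap {R} v ≤ 0ℤ

  record Refined (X* : Sub n) (R : Fin n → Sub n) (σ : State) : Set where
    field
      {R′}       : Fin n → Sub n
      env        : Env R′ σ
      refinement : Refinement a b g X* R′
      extends    : ∀ v w → R v w ≡ true → R′ v w ≡ true
      still      : Settled R → Settled R′
      progress   : Settled R′ ⊎ pairs R ℕ.< pairs R′
  open Refined

  module _ {R : Fin n → Sub n} {X* : Sub n} (ref : Refinement a b g X* R) where

    phase-spec : ∀ σ → Env R σ → Refined X* R (⟪ phase ⟫ σ)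
    phase-spec σ e = cases (1ℤ ℤ.≤? η) refl
      where
      prepare : Prog
      prepare = rises ⨟ amplify 11 1 ⨟ amplify 12 12 ⨟ aim
      σ₁ σ₂ σ₃ σ₄ σ₅ : State
      σ₁ = ⟪ rises ⟫ σ
      σ₂ = ⟪ amplify 11 1 ⟫ σ₁
      σ₃ = ⟪ amplify 12 12 ⟫ σ₂
      σ₄ = ⟪ aim ⟫ σ₃
      σ₅ = ⟪ refine ⟫ σ₄
      η : ℤ
      η = regs σ₁ 10
      rising : RisesTo {R} n η
      rising = rises-spec σ e
      up : ∀ v → live a b R v ≡ true → gap {R} v ≤ η
      up v = proj₁ (proj₂ rising) v (Fin.toℕ<n v)
      e₄ : Env R σ₄
      e₄ = env-frame refl (frame-run prepare σ) e
      e₅ : Env R σ₅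
      e₅ = env-frame refl (frame-run refine σ₄) e₄
      at-10 : regs σ₂ 10 ≡ η
      at-10 = regs-frame (amplify 11 1) σ₁ 10 refl
      at-11 : regs σ₄ 11 ≡ + ((n ℕ.+ 3) ℕ.^ 1) * η
      at-11 = trans (regs-frame (amplify 12 12 ⨟ aim) σ₂ 11 refl) (amplify-spec 11 1 σ₁ refl (λ j → refl) refl)
      at-12 : regs σ₄ 12 ≡ + ((n ℕ.+ 3) ℕ.^ 12) * η
      at-12 = trans (amplify-spec 12 12 σ₂ refl (λ j → refl) refl) (cong (+ ((n ℕ.+ 3) ℕ.^ 12) *_) at-10)
      at-13 : Holds σ₄ 13 a
      at-13 = trans (regs-frame (rises ⨟ amplify 11 1 ⨟ amplify 12 12) σ 1 refl) (at-a e)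
      at-14 : Holds σ₄ 14 a
      at-14 = at-13
      σ₅≡ : σ₅ ≡ (if does (1ℤ ℤ.≤? η) then ⟪ findArc ⟫ σ₄ else σ₄)
      σ₅≡ = branch-leq (lit 1ℤ) (reg 10) findArc nop σ₄ refl
        (trans (regs-frame (amplify 12 12 ⨟ aim) σ₂ 10 refl) at-10)
      cases : (d : Dec (1ℤ ≤ η)) → d ≡ (1ℤ ℤ.≤? η) → Refined X* R (⟪ update ⟫ σ₅)
      cases (no η<1) d = record
        { env        = record
          { tables = tables e₆ ; at-a = at-a e₆ ; at-b = at-b e₆
          ; stored = λ v w → trans (stored e₆ v w)
              (cong bit (addArc-idle ref (Order.reflexive (Refinement.order ref) a) v w)) }
        ; refinement = ref
        ; extends    = λ v w vw → vw
        ; still      = λ settled → settled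
        ; progress   = inj₁ λ v lv → ℤ.≤-trans (up v lv) (ℤ.≮⇒≥ (λ 0<η → η<1 (<⇒+1≤ 0<η)))
        }
        where
        same : σ₅ ≡ σ₄
        same = trans σ₅≡ (if-else (to-does-false (1ℤ ℤ.≤? η) η<1))
        e₆ : Env (addArc a a R) (⟪ update ⟫ σ₅)
        e₆ = update-spec a a σ₅ e₅ (trans (cong (λ τ → regs τ 13) same) at-13) (trans (cong (λ τ → regs τ 14) same) at-14)
      cases (yes 1≤η) d = found (proj₂ (proj₂ rising))
        where
        0<η : 0ℤ < η
        0<η = +1≤⇒< 1≤η
        found : Max (λ y → ∃[ u ] live a b R u ≡ true × gap {R} u ≡ y) η → Refined X* R (⟪ update ⟫ σ₅)
        found (zero-max η≡0) = ⊥-elim (ℤ.<-irrefl (sym η≡0) 0<η)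
        found (attained (u , lu , gap≡η)) = conclude (outcome result)
          where
          open Parameters n 0<η
          result : Verdict R X* ⊥ σ₅
          result = subst (Verdict R X* ⊥) (sym (trans σ₅≡ (if-then (to-does (1ℤ ℤ.≤? η) 1≤η))))
            (findArc-spec ref 0<η up u lu gap≡η σ₄ e₄ (trans at-11 (sym (level-def 1))) (trans at-12 (sym (level-def 12)))
              at-13 at-14)
          p q : Fin n
          p = source result
          q = target result
          conclude : (R p q ≡ true × ⊥) ⊎ (R p q ≡ false × (X* p ≡ true → X* q ≡ true)) → Refined X* R (⟪ update ⟫ σ₅)
          conclude (inj₂ (new , valid)) = record
            { env        = update-spec p q σ₅ e₅ (at-source result) (at-target result)
            ; refinement = addArc-refinement ref valid
            ; extends    = λ v w vw → ∨-introˡ vw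
            ; still      = λ settled → ⊥-elim (ℤ.<⇒≱ 0<η (subst (_≤ 0ℤ) gap≡η (settled u lu)))
            ; progress   = inj₂ (addArc-grows ref new)
            }

  module _ {R₀ : Fin n → Sub n} {X* : Sub n} (ref : Refinement a b g X* R₀) where

    phases-spec : ∀ σ → Env R₀ σ →
      ∃[ R′ ] Env R′ (⟪ nest 120 2 phase ⟫ σ) × Refinement a b g X* R′ ×
        (∀ v w → R₀ v w ≡ true → R′ v w ≡ true) × Settled R′
    phases-spec σ e = finish (nest-spec {phase} P counter step 20 2 refl 0 σ (R₀ , e , ref , (λ v w vw → vw) , inj₂ ℕ.z≤n))
      where
      P : ℕ → State → Set
      P t τ = ∃[ R′ ] Env R′ τ × Refinement a b g X* R′ × (∀ v w → R₀ v w ≡ true → R′ v w ≡ true) ×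
        (Settled R′ ⊎ t ℕ.≤ pairs R′)
      counter : ∀ j z t τ → P t τ → P t (writeReg (100 ℕ.+ j) z τ)
      counter j z t τ (R′ , e′ , rest) = R′ , env-counter j z τ e′ , rest
      finish : ∀ {τ} → P ((n ℕ.+ 3) ℕ.^ 2) τ →
        ∃[ R′ ] Env R′ τ × Refinement a b g X* R′ × (∀ v w → R₀ v w ≡ true → R′ v w ≡ true) × Settled R′
      finish (R′ , e′ , ref′ , ext , inj₁ settled) = R′ , e′ , ref′ , ext , settled
      finish (R′ , e′ , ref′ , ext , inj₂ many) = ⊥-elim (ℕ.<⇒≱ few (ℕ.≤-trans many (pairs-bound R′)))
        where
        expand : ∀ n → (n ℕ.+ 3) ℕ.* ((n ℕ.+ 3) ℕ.* 1) ≡ suc (n ℕ.* n) ℕ.+ (6 ℕ.* n ℕ.+ 8)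
        expand = solve-∀ℕ
        few : n ℕ.* n ℕ.< (n ℕ.+ 3) ℕ.^ 2
        few = ℕ.≤-trans (ℕ.m≤m+n _ (6 ℕ.* n ℕ.+ 8)) (ℕ.≤-reflexive (sym (expand n)))

      step : ∀ t τ → P t τ → P (suc t) (⟪ phase ⟫ τ)
      step t τ (R₁ , e₁ , ref₁ , ext₁ , done) =
        R′ ρ , env ρ , refinement ρ , (λ v w vw → extends ρ v w (ext₁ v w vw)) , advance done (progress ρ)
        where
        ρ : Refined X* R₁ (⟪ phase ⟫ τ)
        ρ = phase-spec ref₁ τ e₁
        advance : Settled R₁ ⊎ t ℕ.≤ pairs R₁ → Settled (R′ ρ) ⊎ pairs R₁ ℕ.< pairs (R′ ρ) →
          Settled (R′ ρ) ⊎ suc t ℕ.≤ pairs (R′ ρ)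
        advance (inj₁ settled) _              = inj₁ (still ρ settled)
        advance (inj₂ _)       (inj₁ settled) = inj₁ settled
        advance (inj₂ t≤)      (inj₂ lt)      = inj₂ (ℕ.≤-<-trans t≤ lt)

module Separation {n : ℕ} (a a′ c b : Fin n) where

  meets : Bool
  meets = (singleton a c ∨ singleton a b) ∨ (singleton a′ c ∨ singleton a′ b)

  separation : Fin n → Sub n
  separation v w = singleton v w ∨ ((singleton v b ∨ singleton v c) ∨ (singleton w a ∨ singleton w a′))

  data Implied (v w : Fin n) : Set where
    same   : v ≡ w → Implied v w
    from-b : v ≡ b → Implied v w
    from-c : v ≡ c → Implied v w
    to-a   : w ≡ a → Implied v w
    to-a′  : w ≡ a′ → Implied v w

  implied : ∀ v w → separation v w ≡ true → Implied v w
  implied v w e with ∨-elim {singleton v w} e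
  ... | inj₁ p = same (singleton-≡ v w p)
  ... | inj₂ e₁ with ∨-elim {singleton v b ∨ singleton v c} e₁
  ... | inj₁ e₂ = [ (λ p → from-b (singleton-≡ v b p)) , (λ p → from-c (singleton-≡ v c p)) ]′ (∨-elim e₂)
  ... | inj₂ e₂ = [ (λ p → to-a (singleton-≡ w a p)) , (λ p → to-a′ (singleton-≡ w a′ p)) ]′ (∨-elim e₂)

  implies : ∀ {v w} → Implied v w → separation v w ≡ true
  implies {v} {w} (same refl)   = ∨-introˡ (singleton-self v)
  implies {v} {w} (from-b refl) = ∨-introʳ {singleton v w} (∨-introˡ (∨-introˡ (singleton-self v)))
  implies {v} {w} (from-c refl) = ∨-introʳ {singleton v w} (∨-introˡ (∨-introʳ {singleton v b} (singleton-self v)))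
  implies {v} {w} (to-a refl)   = ∨-introʳ {singleton v w} (∨-introʳ {singleton v b ∨ singleton v c} (∨-introˡ (singleton-self w)))
  implies {v} {w} (to-a′ refl)  = ∨-introʳ {singleton v w} (∨-introʳ {singleton v b ∨ singleton v c} (∨-introʳ {singleton w a} (singleton-self w)))

  separates⇒ideal : ∀ {X} → Separates a a′ c b X → Ideal a b separation X
  separates⇒ideal {X} (Xa , Xa′ , ¬Xc , ¬Xb) = record { closed = λ {v} {w} Xv vw → cl Xv (implied v w vw) ; has = Xa ; avoids = ¬Xb }
    where
    cl : ∀ {v w} → X v ≡ true → Implied v w → X w ≡ true
    cl Xv (same refl)   = Xv
    cl Xv (from-b refl) = true≢false Xv ¬Xb
    cl Xv (from-c refl) = true≢false Xv ¬Xc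
    cl Xv (to-a refl)   = Xa
    cl Xv (to-a′ refl)  = Xa′

  ideal⇒separates : ∀ {X} → Ideal a b separation X → Separates a a′ c b X
  ideal⇒separates I = Ideal.has I , Ideal.closed I (Ideal.has I) (implies {a} {a′} (to-a′ refl)) ,
    (≢true λ Xc → true≢false (Ideal.closed I Xc (implies {c} {b} (from-c refl))) (Ideal.avoids I)) , Ideal.avoids I

  module _ (disjoint : meets ≡ false) where

    private
      distinct : ∀ (v w : Fin n) → singleton v w ≡ false → ¬ v ≡ w
      distinct v w = from-does-false (v Fin.≟ w)
      a≢c : ¬ a ≡ c
      a≢c = distinct a c (∨-falseˡ {singleton a c} (∨-falseˡ {singleton a c ∨ singleton a b} disjoint))
      a≢b : ¬ a ≡ b
      a≢b = distinct a b (∨-falseʳ {singleton a c} (∨-falseˡ {singleton a c ∨ singleton a b} disjoint))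
      a′≢c : ¬ a′ ≡ c
      a′≢c = distinct a′ c (∨-falseˡ {singleton a′ c} (∨-falseʳ {singleton a c ∨ singleton a b} disjoint))
      a′≢b : ¬ a′ ≡ b
      a′≢b = distinct a′ b (∨-falseʳ {singleton a′ c} (∨-falseʳ {singleton a c ∨ singleton a b} disjoint))

    separation-order : Order a b separation
    separation-order = record
      { reflexive  = λ v → implies {v} {v} (same refl)
      ; transitive = λ {u} {v} {w} p q → implies (tr (implied u v p) (implied v w q))
      ; bottom     = λ v → implies {v} {a} (to-a refl)
      ; top        = λ v → implies {b} {v} (from-b refl)
      ; proper     = ≢true λ e → pr (implied a b e)
      }
      where
      pr : ¬ Implied a b
      pr (same e)   = a≢b e
      pr (from-b e) = a≢b e
      pr (from-c e) = a≢c e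
      pr (to-a e)   = a≢b (sym e)
      pr (to-a′ e)  = a′≢b (sym e)
      tr : ∀ {u v w} → Implied u v → Implied v w → Implied u w
      tr (same refl) q         = q
      tr (from-b e)  q         = from-b e
      tr (from-c e)  q         = from-c e
      tr p           (same refl) = p
      tr (to-a e)    (from-b e′) = ⊥-elim (a≢b (trans (sym e) e′))
      tr (to-a e)    (from-c e′) = ⊥-elim (a≢c (trans (sym e) e′))
      tr (to-a′ e)   (from-b e′) = ⊥-elim (a′≢b (trans (sym e) e′))
      tr (to-a′ e)   (from-c e′) = ⊥-elim (a′≢c (trans (sym e) e′))
      tr p           (to-a e)  = to-a e
      tr p           (to-a′ e) = to-a′ e

    initial-refinement : (f : Subset n → ℤ) →
      ∃[ X* ] Refinement a b (onSub f) X* separation × (∀ Y → Separates a a′ c b Y → onSub f X* ≤ onSub f Y)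
    initial-refinement f with argmin f (λ V → (lookup V a ∧ lookup V a′) ∧ (not (lookup V c) ∧ not (lookup V b)))
    ... | inj₁ none = true≢false witness (none (tabulate λ w → singleton a w ∨ singleton a′ w))
      where
      at : ∀ w → lookup (tabulate λ w → singleton a w ∨ singleton a′ w) w ≡ singleton a w ∨ singleton a′ w
      at = lookup∘tabulate λ w → singleton a w ∨ singleton a′ w
      witness : _ ≡ true
      witness = ∧-intro
        (∧-intro (trans (at a) (∨-introˡ (singleton-self a))) (trans (at a′) (∨-introʳ {singleton a a′} (singleton-self a′))))
        (∧-intro
          (not-false (trans (at c) (cong₂ _∨_ (to-does-false (a Fin.≟ c) a≢c) (to-does-false (a′ Fin.≟ c) a′≢c))))
          (not-false (trans (at b) (cong₂ _∨_ (to-does-false (a Fin.≟ b) a≢b) (to-does-false (a′ Fin.≟ b) a′≢b)))))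
    ... | inj₂ (V , PV , least) = lookup V ,
      record
        { order    = separation-order
        ; X*-ideal = separates⇒ideal
            ( ∧-trueˡ (∧-trueˡ PV) , ∧-trueʳ {lookup V a} (∧-trueˡ PV)
            , not-true (∧-trueˡ (∧-trueʳ {lookup V a ∧ lookup V a′} PV))
            , not-true (∧-trueʳ {not (lookup V c)} (∧-trueʳ {lookup V a ∧ lookup V a′} PV)) )
        ; X*-least = λ {X} I → best X (ideal⇒separates I)
        } , best
      where
      best : ∀ Y → Separates a a′ c b Y → onSub f (lookup V) ≤ onSub f Y
      best Y (Ya , Ya′ , ¬Yc , ¬Yb) = subst (λ W → f W ≤ onSub f Y) (sym (tabulate∘lookup V))
        (least (tabulate Y) (∧-intro
          (∧-intro (trans (lookup∘tabulate Y a) Ya) (trans (lookup∘tabulate Y a′) Ya′))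
          (∧-intro (not-false (trans (lookup∘tabulate Y c) ¬Yc)) (not-false (trans (lookup∘tabulate Y b) ¬Yb)))))

module Candidates {n : ℕ} (f : Subset n → ℤ) {F : Pred (Subset n) 0ℓ} (F? : Decidable F) (sub : SubmodularOn (onSub f)) where

  open Specifications f F?

  id-bit : ∀ {σ i j v w} → Tables σ → Holds σ i v → Holds σ j w → IsBit (idn i j) σ (singleton v w)
  id-bit t = matrix-bit singleton (identity t)

  module _ (a a′ c b : Fin n) where

    open Separation a a′ c b
    open PhaseLoop f F? sub a b using (env-frame; rel-bit; phases-spec; Env; Settled)

    minimise-spec : meets ≡ false → ∀ σ → Tables σ → Holds σ 1 a → Holds σ 2 a′ → Holds σ 3 c → Holds σ 4 b →
      ∃[ X ] Row (⟪ minimise ⟫ σ) 3 X × Separates a a′ c b X × (∀ Y → Separates a a′ c b Y → g X ≤ g Y)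
    minimise-spec disjoint σ t ha ha′ hc hb =
      let _ , ref , least = initial-refinement disjoint f
          R , e , ref′ , extends , settled = phases-spec ref σ₁ e₁
      in finish ref′ e extends settled least
      where
      entries : Expr
      entries = or (idn 19 18) (or (or (idn 19 4) (idn 19 3)) (or (idn 18 1) (idn 18 2)))
      σ₁ : State
      σ₁ = ⟪ initialise ⟫ σ
      fr₁ : Frame initialise σ σ₁
      fr₁ = frame-run initialise σ
      e₁ : Env separation σ₁
      e₁ = record
        { tables = tables-frame refl refl fr₁ t
        ; stored = fill₂-spec 1 entries σ (λ v w → bit (separation v w)) λ v w τ fr hv hw _ →
            let t′ = tables-frame refl refl fr t in
            evaluates (or-bit t′ (id-bit t′ hv hw)
              (or-bit t′
                (or-bit t′ (id-bit t′ hv (holds-frame 4 refl fr hb)) (id-bit t′ hv (holds-frame 3 refl fr hc)))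
                (or-bit t′ (id-bit t′ hw (holds-frame 1 refl fr ha)) (id-bit t′ hw (holds-frame 2 refl fr ha′)))))
        ; at-a   = holds-frame 1 refl fr₁ ha
        ; at-b   = holds-frame 4 refl fr₁ hb
        }
      finish : ∀ {X* R} → Refinement a b g X* R → Env R (⟪ nest 120 2 phase ⟫ σ₁) →
        (∀ v w → separation v w ≡ true → R v w ≡ true) → Settled R → (∀ Y → Separates a a′ c b Y → g X* ≤ g Y) →
        ∃[ X ] Row (⟪ minimise ⟫ σ) 3 X × Separates a a′ c b X × (∀ Y → Separates a a′ c b Y → g X ≤ g Y)
      finish {X*} {R} ref e extends settled least = largest a b R , row , sep ,
        λ Y sepY → ℤ.≤-trans (largest-minimal ref sub settled) (least Y sepY)
        where
        open Family (Refinement.order ref)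
        row : Row (⟪ minimise ⟫ σ) 3 (largest a b R)
        row = fill-spec 3 (neg (rel 18 4)) (⟪ nest 120 2 phase ⟫ σ₁) (λ w → bit (largest a b R w)) λ w τ fr hw _ →
          let e′ = env-frame refl fr e in evaluates (neg-bit (rel-bit e′ hw (Env.at-b e′)))
        sep : Separates a a′ c b (largest a b R)
        sep = ideal⇒separates (record
          { closed = λ {v} {w} Xv vw → closed largest-ideal Xv (extends v w vw)
          ; has    = has largest-ideal
          ; avoids = avoids largest-ideal })

  Best : State → Set
  Best σ = regs σ 24 ≡ 0ℤ ⊎
    (regs σ 24 ≡ 1ℤ × ∃[ B ] Row σ 0 B × ¬ F (tabulate B) × regs σ 25 ≡ g B)

  Covered : State → Sub n → Set
  Covered σ X = F (tabulate X) ⊎ (regs σ 24 ≡ 1ℤ × regs σ 25 ≤ g X)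

  Improves : State → State → Set
  Improves σ τ = Best τ × (∀ Y → Covered σ Y → Covered τ Y)

  carry : ∀ {σ τ} → regs τ 24 ≡ regs σ 24 → regs τ 25 ≡ regs σ 25 → (∀ k l → arrs τ 0 k l ≡ arrs σ 0 k l) →
    Best σ → Improves σ τ
  carry {σ} {τ} e₁ e₂ e₃ best = kept best , λ Y →
    [ inj₁ , (λ { (have , le) → inj₂ (trans e₁ have , subst (_≤ g Y) (sym e₂) le) }) ]′
    where
    kept : Best σ → Best τ
    kept (inj₁ none) = inj₁ (trans e₁ none)
    kept (inj₂ (have , B , row , ¬FB , val)) = inj₂ (trans e₁ have , B , (λ w → trans (e₃ _ _) (row w)) , ¬FB , trans e₂ val)

  1≢0 : ∀ {z} {A : Set} → z ≡ 1ℤ → z ≡ 0ℤ → A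
  1≢0 refl ()

  accept-spec : ∀ X σ → Row σ 3 X → regs σ 20 ≡ g X → ¬ F (tabulate X) → (regs σ 24 ≡ 1ℤ → g X ≤ regs σ 25) →
    Improves σ (⟪ accept ⟫ σ) × Covered (⟪ accept ⟫ σ) X
  accept-spec X σ row val ¬FX better =
    (inj₂ (refl , X , copied , ¬FX , new) ,
     λ Y → [ inj₁ , (λ { (have , le) → inj₂ (refl , subst (_≤ g Y) (sym new) (ℤ.≤-trans (better have) le)) }) ]′) ,
    inj₂ (refl , ℤ.≤-reflexive new)
    where
    copied : ∀ w → cell (⟪ fill 0 (entry 3 18) ⟫ σ) 0 0ℤ w ≡ bit (X w)
    copied = fill-spec 0 (entry 3 18) σ (bit ∘ X) λ w τ fr hw _ →
      trans (entry-cell {τ} {3} {18} hw) (trans (onArr fr 3 refl _ _) (row w))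
    new : regs (⟪ accept ⟫ σ) 25 ≡ g X
    new = trans (regs-frame (fill 0 (entry 3 18)) σ 20 refl) val

  candidate-spec : ∀ X σ → Row σ 3 X → Best σ → Improves σ (⟪ candidate ⟫ σ) × Covered (⟪ candidate ⟫ σ) X
  candidate-spec X σ row best = subst (λ τ → Improves σ τ × Covered τ X)
    (sym (branch-bit (reg 26) nop fresh σ₁ member-bit)) (cases (F? (tabulate X)))
    where
    contest fresh : Prog
    contest = branch (reg 20 ⊕ lit 1ℤ) (reg 25) accept nop
    fresh = branch (lit 1ℤ) (reg 24) contest accept
    σ₁ : State
    σ₁ = ⟪ member 26 3 (lit 0ℤ) ⨟ value 20 3 (lit 0ℤ) ⟫ σ
    member-bit : IsBit (reg 26) σ₁ (does (F? (tabulate X)))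
    member-bit = isBit (cong (λ V → if does (F? V) then 1ℤ else 0ℤ) (row-set {σ} {3} {X} row))
    val : regs σ₁ 20 ≡ g X
    val = row-value {σ} {3} {X} row
    cases : (d : Dec (F (tabulate X))) →
      Improves σ (if does d then ⟪ nop ⟫ σ₁ else ⟪ fresh ⟫ σ₁) × Covered (if does d then ⟪ nop ⟫ σ₁ else ⟪ fresh ⟫ σ₁) X
    cases (yes FX) = (best , λ Y cov → cov) , inj₁ FX
    cases (no ¬FX) = compare best
      where
      compare : Best σ → Improves σ (⟪ fresh ⟫ σ₁) × Covered (⟪ fresh ⟫ σ₁) X
      compare (inj₁ none) = subst (λ τ → Improves σ τ × Covered τ X)
        (sym (branch-bit (reg 24) contest accept σ₁ {false} (isBit none)))
        (accept-spec X σ₁ row val ¬FX λ have → 1≢0 have none)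
      compare (inj₂ (have , _)) = subst (λ τ → Improves σ τ × Covered τ X)
        (sym (trans (branch-bit (reg 24) contest accept σ₁ {true} (isBit have))
          (branch-leq (reg 20 ⊕ lit 1ℤ) (reg 25) accept nop σ₁ (cong (_+ 1ℤ) val) refl)))
        (decide (g X + 1ℤ ℤ.≤? regs σ 25))
        where
        decide : (d : Dec (g X + 1ℤ ≤ regs σ 25)) →
          Improves σ (if does d then ⟪ accept ⟫ σ₁ else σ₁) × Covered (if does d then ⟪ accept ⟫ σ₁ else σ₁) X
        decide (yes better) = accept-spec X σ₁ row val ¬FX λ _ → ℤ.<⇒≤ (+1≤⇒< better)
        decide (no ¬better) = (best , λ Y cov → cov) , inj₂ (have , ℤ.≮⇒≥ (¬better ∘ <⇒+1≤))

  Sound : State → Set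
  Sound σ = Tables σ × Best σ

  record Leads (σ τ : State) : Set where
    constructor leads
    field
      sound : Sound τ
      keeps : ∀ Y → Covered σ Y → Covered τ Y
  open Leads

  leads-refl : ∀ {σ} → Sound σ → Leads σ σ
  leads-refl s = leads s λ Y cov → cov

  leads-trans : ∀ {σ τ υ} → Leads σ τ → Leads τ υ → Leads σ υ
  leads-trans l m = leads (sound m) λ Y → keeps m Y ∘ keeps l Y

  leads-write : ∀ i → (i ℕ.≡ᵇ 24) ≡ false → (i ℕ.≡ᵇ 25) ≡ false → ∀ z {τ υ} → Leads τ υ → Leads τ (writeReg i z υ)
  leads-write i i≢24 i≢25 z {τ} {υ} l =
    let t , best = sound l
        best′ , keep = carry {υ} {writeReg i z υ} (if-else i≢24) (if-else i≢25) (λ _ _ → refl) best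
    in leads-trans l (leads (tables-frame refl refl (frame-run (set i (lit z)) υ) t , best′) keep)

  Met : (a a′ c b : Fin n) → State → Set
  Met a a′ c b σ = Separation.meets a a′ c b ≡ false →
    ∃[ X ] Separates a a′ c b X × (∀ Y → Separates a a′ c b Y → g X ≤ g Y) × Covered σ X

  met-leads : ∀ {a a′ c b σ τ} → Leads σ τ → Met a a′ c b σ → Met a a′ c b τ
  met-leads l met disjoint = let X , sep , least , cov = met disjoint in X , sep , least , keeps l X cov

  loop-leads : ∀ i p σ (M : Fin n → State → Set) → (∀ v {τ υ} → Leads τ υ → M v τ → M v υ) →
    writes i p ≡ false → (∀ z {τ υ} → Leads τ υ → Leads τ (writeReg i z υ)) → Sound σ →
    (∀ v τ → Frame (loop i 0 p) σ τ → Holds τ i v → Sound τ → Leads τ (⟪ p ⟫ τ) × M v (⟪ p ⟫ τ)) →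
    Leads σ (⟪ loop i 0 p ⟫ σ) × (∀ v → M v (⟪ loop i 0 p ⟫ σ))
  loop-leads i p σ M stable safe counter s body =
    let l , done = loop-rule-Fin {i} {p} {σ}
          (λ k τ → Leads σ τ × (∀ v → toℕ v ℕ.< k → M v τ)) safe
          (counter 0ℤ (leads-refl s) , λ v ()) next
    in l , λ v → done v (Fin.toℕ<n v)
    where
    next : ∀ v τ z → Frame (loop i 0 p) σ τ → Holds τ i v → Leads σ τ × (∀ w → toℕ w ℕ.< toℕ v → M w τ) →
      Leads σ (writeReg i z (⟪ p ⟫ τ)) × (∀ w → toℕ w ℕ.< suc (toℕ v) → M w (writeReg i z (⟪ p ⟫ τ)))
    next v τ z fr hv (l , done) =
      let m , new = body v τ fr hv (sound l)
          tick = counter z m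
      in leads-trans l tick ,
         λ w lt → [ (λ lt′ → stable w tick (done w lt′))
                  , (λ { refl → stable v (counter z (leads-refl (sound m))) new }) ]′ (<-suc-split lt)

  separate-spec : ∀ a a′ c b σ → Holds σ 1 a → Holds σ 2 a′ → Holds σ 3 c → Holds σ 4 b → Sound σ →
    Leads σ (⟪ separate ⟫ σ) × Met a a′ c b (⟪ separate ⟫ σ)
  separate-spec a a′ c b σ ha ha′ hc hb (t , best) = subst (λ τ → Leads σ τ × Met a a′ c b τ)
    (sym (branch-bit (or (or (idn 1 3) (idn 1 4)) (or (idn 2 3) (idn 2 4))) nop (minimise ⨟ candidate) σ
      (or-bit t (or-bit t (id-bit t ha hc) (id-bit t ha hb)) (or-bit t (id-bit t ha′ hc) (id-bit t ha′ hb)))))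
    (cases (Separation.meets a a′ c b) refl)
    where
    σ₁ : State
    σ₁ = ⟪ minimise ⟫ σ
    fr : Frame minimise σ σ₁
    fr = frame-run minimise σ
    carried : Improves σ σ₁
    carried = carry {σ} {σ₁} (onReg fr 24 refl) (onReg fr 25 refl) (onArr fr 0 refl) best
    cases : ∀ x → Separation.meets a a′ c b ≡ x →
      Leads σ (if x then ⟪ nop ⟫ σ else ⟪ minimise ⨟ candidate ⟫ σ) ×
      Met a a′ c b (if x then ⟪ nop ⟫ σ else ⟪ minimise ⨟ candidate ⟫ σ)
    cases true  e = leads-refl (t , best) , λ disjoint → true≢false e disjoint
    cases false e =
      let X , row , sep , least = minimise-spec a a′ c b e σ t ha ha′ hc hb
          (best′ , keep) , cov = candidate-spec X σ₁ row (proj₁ carried)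
      in leads (tables-frame refl refl (frame-run (minimise ⨟ candidate) σ) t , best′) (λ Y → keep Y ∘ proj₂ carried Y) ,
         λ _ → X , sep , least , cov

  tuples-spec : ∀ σ → Sound σ → Leads σ (⟪ tuples ⟫ σ) × (∀ a a′ c b → Met a a′ c b (⟪ tuples ⟫ σ))
  tuples-spec σ s = loop-leads 1 p₁ σ (λ a τ → ∀ a′ c b → Met a a′ c b τ)
    (λ a l m a′ c b → met-leads l (m a′ c b)) refl (leads-write 1 refl refl) s λ a τ₁ _ ha s₁ →
    loop-leads 2 p₂ τ₁ (λ a′ τ → ∀ c b → Met a a′ c b τ)
      (λ a′ l m c b → met-leads l (m c b)) refl (leads-write 2 refl refl) s₁ λ a′ τ₂ fr₂ ha′ s₂ →
      loop-leads 3 p₃ τ₂ (λ c τ → ∀ b → Met a a′ c b τ)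
        (λ c l m b → met-leads l (m b)) refl (leads-write 3 refl refl) s₂ λ c τ₃ fr₃ hc s₃ →
        loop-leads 4 separate τ₃ (λ b τ → Met a a′ c b τ)
          (λ b l m → met-leads l m) refl (leads-write 4 refl refl) s₃ λ b τ₄ fr₄ hb s₄ →
          separate-spec a a′ c b τ₄
            (holds-frame 1 refl fr₄ (holds-frame 1 refl fr₃ (holds-frame 1 refl fr₂ ha)))
            (holds-frame 2 refl fr₄ (holds-frame 2 refl fr₃ ha′))
            (holds-frame 3 refl fr₄ hc) hb s₄
    where
    p₁ p₂ p₃ : Prog
    p₃ = loop 4 0 separate
    p₂ = loop 3 0 p₃
    p₁ = loop 2 0 p₂

module Correctness {n : ℕ} (f : Subset n → ℤ) {F : Pred (Subset n) 0ℓ} (F? : Decidable F) (sub : SubmodularOn (onSub f)) where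

  open Specifications f F?
  open Candidates f F? sub

  prelude-tables : Tables (⟪ prelude ⟫ (initial n))
  prelude-tables = record
    { conjunction = λ x y → trans (arrs-frame identityTable σ₁ 9 refl (bit x) (bit y)) (truth x y)
    ; identity    = λ v w → proj₁ filled v (Fin.toℕ<n v) w
    }
    where
    σ₁ : State
    σ₁ = ⟪ put 9 (lit 1ℤ) (lit 1ℤ) (lit 1ℤ) ⟫ (initial n)
    truth : ∀ x y → arrs σ₁ 9 (bit x) (bit y) ≡ bit (x ∧ y)
    truth false false = refl
    truth false true  = refl
    truth true  false = refl
    truth true  true  = refl
    Inv : ℕ → State → Set
    Inv k τ = (∀ v → toℕ v ℕ.< k → ∀ w → cell τ 8 (+ toℕ v) w ≡ bit (singleton v w)) ×
              (∀ v → k ℕ.≤ toℕ v → ∀ w → cell τ 8 (+ toℕ v) w ≡ 0ℤ)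
    next : ∀ v τ z → Frame identityTable σ₁ τ → Holds τ 16 v → Inv (toℕ v) τ →
      Inv (suc (toℕ v)) (writeReg 16 z (⟪ put 8 (reg 16) (reg 16) (lit 1ℤ) ⟫ τ))
    next v τ z fr hv (done , todo) rewrite hv =
      (λ u lt w → [ (λ lt′ → trans (other u w λ { refl → ℕ.<-irrefl refl lt′ }) (done u lt′ w))
                  , (λ { refl → trans (write-cell 8 (+ toℕ v) v 1ℤ τ w) (cong (if_then_else_ (singleton v w) 1ℤ) (todo v ℕ.≤-refl w)) })
                  ]′ (<-suc-split lt)) ,
      (λ u le w → trans (other u w λ { refl → ℕ.<-irrefl refl le }) (todo u (ℕ.<⇒≤ le) w))
      where
      other : ∀ u w → ¬ v ≡ u → cell (writeArr 8 (+ toℕ v) (+ toℕ v) 1ℤ τ) 8 (+ toℕ u) w ≡ cell τ 8 (+ toℕ u) w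
      other u w v≢u = write-other-row 8 (+ toℕ v) (+ toℕ u) (+ toℕ v) 1ℤ τ w (v≢u ∘ Fin.toℕ-injective ∘ ℤ.+-injective)
    filled : Inv n (⟪ prelude ⟫ (initial n))
    filled = loop-rule-Fin {16} {put 8 (reg 16) (reg 16) (lit 1ℤ)} {σ₁} Inv refl ((λ v ()) , λ v _ w → refl) next

  trial-spec : ∀ y σ → Sound σ →
    Leads σ (⟪ trial y ⟫ σ) × Covered (⟪ trial y ⟫ σ) (λ _ → y)
  trial-spec y σ (t , best) =
    let best₁ , keep₁ = carry {σ} {σ₁} (onReg fr 24 refl) (onReg fr 25 refl) (onArr fr 0 refl) best
        (best₂ , keep₂) , cov = candidate-spec (λ _ → y) σ₁
          (fill-spec 3 (lit (bit y)) σ (λ _ → bit y) λ _ _ _ _ _ → refl) best₁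
    in leads (tables-frame refl refl (frame-run (trial y) σ) t , best₂) (λ Y → keep₂ Y ∘ keep₁ Y) , cov
    where
    σ₁ : State
    σ₁ = ⟪ fill 3 (lit (bit y)) ⟫ σ
    fr : Frame (fill 3 (lit (bit y))) σ σ₁
    fr = frame-run (fill 3 (lit (bit y))) σ

  record Complete (σ : State) : Set where
    field
      best  : Best σ
      empty : Covered σ (λ _ → false)
      full  : Covered σ (λ _ → true)
      met   : ∀ a a′ c b → Met a a′ c b σ

  private
    σ₁ σ₂ σ₃ σ₄ : State
    σ₁ = execute prelude (initial n)
    σ₂ = execute (trial false) σ₁
    σ₃ = execute (trial true) σ₂
    σ₄ = execute tuples σ₃

    sound₁ : Sound σ₁
    sound₁ = subst Sound (sym (execute-def prelude (initial n)))
      (prelude-tables , inj₁ (regs-frame prelude (initial n) 24 refl))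

    tried : ∀ y σ → Sound σ → Leads σ (execute (trial y) σ) × Covered (execute (trial y) σ) (λ _ → y)
    tried y σ s = subst (λ τ → Leads σ τ × Covered τ (λ _ → y)) (sym (execute-def (trial y) σ)) (trial-spec y σ s)

    tried₂ : Leads σ₁ σ₂ × Covered σ₂ (λ _ → false)
    tried₂ = tried false σ₁ sound₁

    tried₃ : Leads σ₂ σ₃ × Covered σ₃ (λ _ → true)
    tried₃ = tried true σ₂ (Leads.sound (proj₁ tried₂))

    swept : Leads σ₃ σ₄ × (∀ a a′ c b → Met a a′ c b σ₄)
    swept = subst (λ τ → Leads σ₃ τ × (∀ a a′ c b → Met a a′ c b τ)) (sym (execute-def tuples σ₃))
      (tuples-spec σ₃ (Leads.sound (proj₁ tried₃)))

  final : State
  final = execute algorithm (initial n)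

  halting : ∃[ t ] (Run f F? (compile algorithm) (initial n) t final × t ℕ.≤ timeBound algorithm ⟦ n ⟧)
  halting = subst (λ σ → ∃[ t ] (Run f F? (compile algorithm) (initial n) t σ × t ℕ.≤ timeBound algorithm ⟦ n ⟧))
    (sym (execute-def algorithm (initial n)))
    (halts algorithm (initial n) algorithm-wellFormed algorithm-keeps-n refl)

  complete : Complete final
  complete = subst Complete
    (sym (trans (execute-⨟ prelude (trial false ⨟ trial true ⨟ tuples) (initial n))
      (trans (execute-⨟ (trial false) (trial true ⨟ tuples) σ₁) (execute-⨟ (trial true) tuples σ₂))))
    (record
      { best  = proj₂ (Leads.sound (proj₁ swept))
      ; empty = Leads.keeps (proj₁ swept) _ (Leads.keeps (proj₁ tried₃) _ (proj₂ tried₂))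
      ; full  = Leads.keeps (proj₁ swept) _ (proj₂ tried₃)
      ; met   = proj₂ swept
      })

  module _ (crossing : Crossing F) where

    open Complete complete
    open CrossingFamily crossing

    beaten : ∀ Y → ¬ F (tabulate Y) → regs final 24 ≡ 1ℤ × regs final 25 ≤ g Y
    beaten Y ¬FY = decidable-stable (regs final 24 ℤ.≟ 1ℤ ×-dec regs final 25 ℤ.≤? g Y) λ unbeaten →
      ¬FY (contained λ { X le (inj₁ FX) → FX
                       ; X le (inj₂ (have , le′)) → ⊥-elim (unbeaten (have , ℤ.≤-trans le′ le)) })
      where
      contained : (∀ X → g X ≤ g Y → Covered final X → F (tabulate X)) → F (tabulate Y)
      contained inside with Fin.any? (λ v → Y v Bool.≟ true) | Fin.any? (λ v → Y v Bool.≟ false)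
      ... | no ∅ | _ = subst F (tabulate-cong λ v → sym (≢true λ Yv → ∅ (v , Yv)))
        (inside (λ _ → false) (ℤ.≤-reflexive (SubmodularOn.cong-g sub λ v → sym (≢true λ Yv → ∅ (v , Yv)))) empty)
      ... | yes _ | no all = subst F (tabulate-cong λ v → sym (Bool.¬-not λ ¬Yv → all (v , ¬Yv)))
        (inside (λ _ → true) (ℤ.≤-reflexive (SubmodularOn.cong-g sub λ v → sym (Bool.¬-not λ ¬Yv → all (v , ¬Yv)))) full)
      ... | yes (a , Ya) | yes (c , ¬Yc) = separable⇒member Y Ya ¬Yc λ a′ b Ya′ ¬Yb →
        let apart = λ v w (Yv : Y v ≡ true) (¬Yw : Y w ≡ false) →
              to-does-false (v Fin.≟ w) λ { refl → true≢false Yv ¬Yw }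
            X , sep , least , cov = met a a′ c b
              (cong₂ _∨_ (cong₂ _∨_ (apart a c Ya ¬Yc) (apart a b Ya ¬Yb)) (cong₂ _∨_ (apart a′ c Ya′ ¬Yc) (apart a′ b Ya′ ¬Yb)))
        in X , inside X (least Y (Ya , Ya′ , ¬Yc , ¬Yb)) cov , sep

    correct : Satisfiable (∁ F) → Minimizer f (∁ F) (output n final)
    correct (Y₀ , ¬FY₀) = conclude best
      where
      beats : ∀ Y → ¬ F Y → regs final 24 ≡ 1ℤ × regs final 25 ≤ f Y
      beats Y ¬FY = subst (λ W → regs final 24 ≡ 1ℤ × regs final 25 ≤ f W) (tabulate∘lookup Y)
        (beaten (lookup Y) (¬FY ∘ subst F (tabulate∘lookup Y)))
      conclude : Best final → Minimizer f (∁ F) (output n final)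
      conclude (inj₁ none) = 1≢0 (proj₁ (beats Y₀ ¬FY₀)) none
      conclude (inj₂ (_ , B , row , ¬FB , val)) = subst (Minimizer f (∁ F)) (sym (row-set {final} {0} {B} row))
        (¬FB , λ Y ¬FY → subst (_≤ f Y) val (proj₂ (beats Y ¬FY)))

corollary4p1 : Σ[ algorithm ∈ Cmd ] Σ[ p ∈ Polynomial ]
    ((n : ℕ) (f : Subset n → ℤ) → Submodular f →
    (F : Pred (Subset n) 0ℓ) (F? : Decidable F) → Intersecting F ⊎ Crossing F →
    Σ[ t ∈ ℕ ] Σ[ σ ∈ State ]
    (Run f F? algorithm (initial n) t σ ×
    t ℕ.≤ p ⟦ n ⟧ ×
    (Satisfiable (∁ F) → Minimizer f (∁ F) (output n σ))))
corollary4p1 = compile algorithm , timeBound algorithm , λ n f submodular F F? family →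
  let sub = submodularOn {f = f} submodular
      t , run , bound = Correctness.halting f F? sub
  in t , Correctness.final f F? sub , run , bound ,
     Correctness.correct f F? sub (intersecting⇒crossing family)
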